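{- Let $p$ be an odd prime. Then there does not exist a $(4p,p,4p,4)$ relative difference set in $G=\mathbb{Z}_4\times\mathbb{Z}_p^2$ (relative to any subgroup of order $p$).
   Context: Let $G$ be a finite group of order $mn$ and $N$ a subgroup of order $n$. A $k$-subset $R$ of $G$ is an $(m,n,k,\lambda)$ relative difference set in $G$ relative to $N$ if every element $g\in G\setminus N$ has exactly $\lambda$ representations $g=r_1r_2^{ -1}$ with $r_1,r_2\in R$, and no non-identity element of $N$ has such a representation. -}

module Defs where

open import Data.Nat using (ℕ; NonZero; _+_; _∸_)
open import Data.Nat.DivMod using (_mod_)
open import Data.Fin using (Fin; toℕ)
import Data.Fin as Fin
open import Data.Fin.Properties using () renaming (_≟_ to _≟F_)
open import Data.Product using (_×_; _,_)
open import Data.Product.Properties using (≡-dec)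
open import Data.List using (List; length; filter; cartesianProduct)
open import Data.List.Membership.Propositional using (_∈_; _∉_)
open import Data.List.Relation.Unary.Unique.Propositional using (Unique)
open import Relation.Binary.PropositionalEquality using (_≡_; _≢_)
open import Relation.Binary.Definitions using (DecidableEquality)
open import Relation.Nullary using (Dec)

module _ {n : ℕ} .{{_ : NonZero n}} where
  _+ₙ_ : Fin n → Fin n → Fin n
  a +ₙ b = (toℕ a + toℕ b) mod n

  -ₙ_ : Fin n → Fin n
  -ₙ a = (n ∸ toℕ a) mod n

  0ₙ : Fin n
  0ₙ = 0 mod n

G : (p : ℕ) → Set
G p = Fin 4 × Fin p × Fin p

module _ {p : ℕ} .{{_ : NonZero p}} where
  _⊕_ : G p → G p → G p
  (a , b , c) ⊕ (a' , b' , c') = (a +ₙ a') , (b +ₙ b') , (c +ₙ c')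

  ⊖_ : G p → G p
  ⊖ (a , b , c) = (-ₙ a) , (-ₙ b) , (-ₙ c)

  _⊘_ : G p → G p → G p
  g ⊘ h = g ⊕ (⊖ h)

  e : G p
  e = 0ₙ , 0ₙ , 0ₙ

  _≟G_ : DecidableEquality (G p)
  _≟G_ = ≡-dec _≟F_ (≡-dec _≟F_ _≟F_)

  record IsSubgroup (N : List (G p)) : Set where
    field
      unique   : Unique N
      has-e    : e ∈ N
      closed-⊕ : ∀ {x y} → x ∈ N → y ∈ N → (x ⊕ y) ∈ N
      closed-⊖ : ∀ {x} → x ∈ N → (⊖ x) ∈ N

  reps : List (G p) → G p → ℕ
  reps R g = length (filter (λ (rr : G p × G p) → (Data.Product.proj₁ rr ⊘ Data.Product.proj₂ rr) ≟G g)
                            (cartesianProduct R R))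

  record IsRDS (m n k λ' : ℕ) (N : List (G p)) (R : List (G p)) : Set where
    field
      order-G    : 4 Data.Nat.* (p Data.Nat.* p) ≡ m Data.Nat.* n
      order-N    : length N ≡ n
      subgroup-N : IsSubgroup N
      unique-R   : Unique R
      size-R     : length R ≡ k
      outside-N  : ∀ g → g ∉ N → reps R g ≡ λ'
      inside-N   : ∀ g → g ∈ N → g ≢ e → reps R g ≡ 0

{-# OPTIONS --safe #-}
-- Let φ be a linear functional on ℤ_p² that does not vanish on N, and let n_i(v) be the number of
-- elements of R in class i ∈ ℤ₄ on which φ takes the value v. As elements of ℤ[ℤ_p] the n_i satisfy
-- Σ n_i n_i* = 4p + 4(p-1)𝐙 and Σ n_{i+j} n_i* = 4p𝐙 for j ≠ 0, where 𝐙 is the sum of all group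
-- elements.
--
-- Modulo p the augmentation ideal is generated by the nilpotent d = ζ - 1, so A A* ≡ c𝐙 (mod p) forces
-- d^{(p-1)/2} ∣ A. The same holds for the quadratic Gauss sum g, hence p divides A g modulo 𝐙:
-- elements of norm 4p are g* times elements of norm 4, up to multiples of 𝐙. An element of norm 4 is
-- ±2ζ^j or ±(ζ^a + ζ^b + ζ^c - ζ^d), and comparing moments of order 2, 4 and 6 the latter forces
-- p = 7, where the counts n_i would have to be negative or violate a congruence modulo 8. So n₀+n₁+n₂+n₃
-- and n₀-n₁+n₂-n₃ are 2g*ζ^j and 2g*ζ^j' up to sign and 𝐙. With U = n₀-n₂ and V = n₁-n₃ the element
-- (U²+V²)/2 has norm 4p², so it is p times an element W of norm 4, and W ≡ V² ≡ ζ^{2j} + ζ^{2j'}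
-- (mod 2) forces j = j'. Hence U and V are even.
--
-- Thus every line not parallel to N meets the classes i and i+2 of R in numbers of points of equal
-- parity. Summing over the lines through a point shows that R is invariant under translation by
-- (2,0,0), which then has 4p > 4 representations.

module Submission where

-- The work is done in ℤ[ℤ_p] and not in its quotient ℤ[ζ] by 𝐙, because there the coefficients keep
-- a meaning: the coefficient of B B* at 0 is the sum of the squares of those of B. The price is an
-- unknown multiple of 𝐙 in every equation. It is recovered from augmentations, and moving the
-- augmentation of B to ±2 turns norm 4 modulo 𝐙 into norm exactly 4, so that B has at most four
-- nonzero coefficients. The four characters of ℤ₄ send R to n, m and U ± iV. As i is not in the
-- ring, |U + iV|² is kept as its real part UU* + VV* and its vanishing imaginary part, and (U +
-- iV)(U - iV) = U² + V² replaces U + iV. It can be halved only because n is even, so odd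
-- multipliers have to be excluded beforehand. Parity survives division by g: z and -z have the same
-- square, so g ≡ 1 (mod 2), and an element agrees modulo 2 with its multiplier once the multiple of
-- 𝐙 is even. Moreover the coefficients modulo 2 determine the sum of their squares modulo 4; this
-- separates W, where it is 4, from ζ^(2j) + ζ^(2j') with j ≠ j', where it is 2.

module Development where

  open import Algebra using (CommutativeRing)
  import Algebra.Properties.CommutativeSemiring.Binomial as Binomial
  import Algebra.Properties.CommutativeSemiring.Exp as CExp
  import Algebra.Properties.Semiring.Exp as Exp
  import Algebra.Properties.Semiring.Mult as Mult
  import Algebra.Properties.Semiring.Sum as Σ
  import Algebra.Solver.Ring as RingSolver
  import Algebra.Solver.Ring.AlmostCommutativeRing as ACR
  open import Data.Empty using (⊥; ⊥-elim)
  open import Data.Fin using (Fin; toℕ; fromℕ; inject₁)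
  import Data.Fin as Fin
  open import Data.Fin.Patterns using (0F; 1F; 2F; 3F)
  import Data.Fin.Properties as Finₚ
  open import Data.Integer hiding (suc; _^_) renaming (∣_∣ to abs)
  open import Data.Integer.Divisibility.Signed
  import Data.Integer.DivMod as ℤ/
  open import Data.Integer.Properties
  open import Data.Integer.Tactic.RingSolver using (solve-∀)
  open import Data.List using (List; []; _∷_; _++_; map; length; filter; cartesianProduct; allFin; tabulate)
  import Data.List.Membership.DecPropositional as DecMembership
  open import Data.List.Membership.Propositional using (_∈_; _∉_)
  open import Data.List.Membership.Propositional.Properties using (∈-cartesianProduct⁺; ∈-allFin)
  import Data.List.Relation.Unary.All as All
  open import Data.List.Relation.Unary.AllPairs using ([]; _∷_)
  open import Data.List.Relation.Unary.Any using (here; there)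
  open import Data.List.Relation.Unary.Unique.Propositional using (Unique)
  import Data.List.Relation.Unary.Unique.Propositional.Properties as Uniqueₚ
  open import Data.Maybe.Base as Maybe using (Maybe)
  open import Data.Nat as ℕ using (ℕ; zero; suc; _!)
  open import Data.Nat.Combinatorics using (nCk≡n!/k![n-k]!; k![n∸k]!∣n!; nCn≡1) renaming (_C_ to _choose_)
  import Data.Nat.Coprimality as Cop
  import Data.Nat.Divisibility as ℕ∣
  import Data.Nat.DivMod as ℕ/
  import Data.Nat.GCD as GCD
  open import Data.Nat.Primality using (Prime; prime?; euclidsLemma; prime⇒irreducible; prime⇒nonTrivial)
  import Data.Nat.Properties as ℕₚ
  open import Data.Product using (∃-syntax; _×_; _,_; proj₁; proj₂)
  open import Data.Sum as Sum using (_⊎_; inj₁; inj₂)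
  open import Function using (_∘_)
  open import Level using (0ℓ)
  open import Relation.Binary.Definitions using (DecidableEquality)
  open import Relation.Binary.PropositionalEquality hiding ([_])
  open import Relation.Nullary using (¬_; Dec; yes; no; contradiction)
  open import Relation.Nullary.Decidable using (dec⇒maybe; toWitness; from-no; from-yes; _×-dec_; _⊎-dec_; _→-dec_)

  -- Finite sums of integers

  ∑ : {A : Set} → List A → (A → ℤ) → ℤ
  ∑ []       f = 0ℤ
  ∑ (x ∷ xs) f = f x + ∑ xs f

  ∑-cong-∈ : ∀ {A : Set} (xs : List A) {f g : A → ℤ} → (∀ x → x ∈ xs → f x ≡ g x) → ∑ xs f ≡ ∑ xs g
  ∑-cong-∈ []       eq = refl
  ∑-cong-∈ (x ∷ xs) eq = cong₂ _+_ (eq x (here refl)) (∑-cong-∈ xs (λ y y∈ → eq y (there y∈)))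

  ∑-cong : ∀ {A : Set} (xs : List A) {f g : A → ℤ} → (∀ x → f x ≡ g x) → ∑ xs f ≡ ∑ xs g
  ∑-cong xs eq = ∑-cong-∈ xs (λ x _ → eq x)

  ∑-0 : ∀ {A : Set} (xs : List A) → ∑ xs (λ _ → 0ℤ) ≡ 0ℤ
  ∑-0 []       = refl
  ∑-0 (x ∷ xs) = trans (+-identityˡ _) (∑-0 xs)

  ∑-+ : ∀ {A : Set} (xs : List A) f g → ∑ xs (λ x → f x + g x) ≡ ∑ xs f + ∑ xs g
  ∑-+ []       f g = refl
  ∑-+ (x ∷ xs) f g = trans (cong (_+_ (f x + g x)) (∑-+ xs f g)) (lemma (f x) (g x) _ _)
    where
    lemma : ∀ a b c d → a + b + (c + d) ≡ a + c + (b + d)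
    lemma = solve-∀

  ∑-*ˡ : ∀ {A : Set} (xs : List A) k f → ∑ xs (λ x → k * f x) ≡ k * ∑ xs f
  ∑-*ˡ []       k f = sym (*-zeroʳ k)
  ∑-*ˡ (x ∷ xs) k f = trans (cong (_+_ (k * f x)) (∑-*ˡ xs k f)) (sym (*-distribˡ-+ k (f x) _))

  ∑-*ʳ : ∀ {A : Set} (xs : List A) f k → ∑ xs (λ x → f x * k) ≡ ∑ xs f * k
  ∑-*ʳ xs f k = trans (∑-cong xs (λ x → *-comm (f x) k)) (trans (∑-*ˡ xs k f) (*-comm k _))

  ∑-neg : ∀ {A : Set} (xs : List A) f → ∑ xs (λ x → - f x) ≡ - ∑ xs f
  ∑-neg []       f = refl
  ∑-neg (x ∷ xs) f = trans (cong (_+_ (- f x)) (∑-neg xs f)) (sym (neg-distrib-+ (f x) _))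

  ∑-- : ∀ {A : Set} (xs : List A) f g → ∑ xs (λ x → f x - g x) ≡ ∑ xs f - ∑ xs g
  ∑-- xs f g = trans (∑-+ xs f (λ x → - g x)) (cong (_+_ (∑ xs f)) (∑-neg xs g))

  ∑-swap : ∀ {A B : Set} (xs : List A) (ys : List B) (f : A → B → ℤ) →
           ∑ xs (λ x → ∑ ys (f x)) ≡ ∑ ys (λ y → ∑ xs (λ x → f x y))
  ∑-swap []       ys f = sym (∑-0 ys)
  ∑-swap (x ∷ xs) ys f =
    trans (cong (_+_ (∑ ys (f x))) (∑-swap xs ys f)) (sym (∑-+ ys (f x) (λ y → ∑ xs (λ x → f x y))))

  ∑-nonneg : ∀ {A : Set} (xs : List A) {f} → (∀ x → 0ℤ ≤ f x) → 0ℤ ≤ ∑ xs f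
  ∑-nonneg []       nn = ≤-refl
  ∑-nonneg (x ∷ xs) nn = +-mono-≤ (nn x) (∑-nonneg xs nn)

  term≤∑ : ∀ {A : Set} {xs : List A} {f} → (∀ x → 0ℤ ≤ f x) → ∀ {x} → x ∈ xs → f x ≤ ∑ xs f
  term≤∑ {xs = x ∷ xs} {f} nn (here refl) =
    subst (_≤ f x + ∑ xs f) (+-identityʳ (f x)) (+-monoʳ-≤ (f x) (∑-nonneg xs nn))
  term≤∑ {xs = y ∷ xs} {f} nn {x} (there x∈) =
    subst (_≤ f y + ∑ xs f) (+-identityˡ (f x)) (+-mono-≤ (nn y) (term≤∑ nn x∈))

  ∑≢0⇒∃ : ∀ {A : Set} (xs : List A) f → ∑ xs f ≢ 0ℤ → ∃[ x ] (x ∈ xs × f x ≢ 0ℤ)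
  ∑≢0⇒∃ []       f ne = contradiction refl ne
  ∑≢0⇒∃ (x ∷ xs) f ne with f x ≟ 0ℤ
  ... | no  fx≢0 = x , here refl , fx≢0
  ... | yes fx≡0 with ∑≢0⇒∃ xs f (λ eq → ne (cong₂ _+_ fx≡0 eq))
  ...   | y , y∈ , fy≢0 = y , there y∈ , fy≢0

  ∣∑ : ∀ {A : Set} (xs : List A) {k f} → (∀ x → k ∣ f x) → k ∣ ∑ xs f
  ∣∑ []       k∣f = divides 0ℤ refl
  ∣∑ (x ∷ xs) k∣f = ∣m∣n⇒∣m+n (k∣f x) (∣∑ xs k∣f)

  𝟙 : ∀ {P : Set} → Dec P → ℤ
  𝟙 (yes _) = 1ℤ
  𝟙 (no  _) = 0ℤ

  𝟙-yes : ∀ {P : Set} (P? : Dec P) → P → 𝟙 P? ≡ 1ℤ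
  𝟙-yes (yes _) _ = refl
  𝟙-yes (no ¬p) p = contradiction p ¬p

  𝟙-no : ∀ {P : Set} (P? : Dec P) → ¬ P → 𝟙 P? ≡ 0ℤ
  𝟙-no (yes p) ¬p = contradiction p ¬p
  𝟙-no (no _)  _  = refl

  𝟙-cong : ∀ {P Q : Set} (P? : Dec P) (Q? : Dec Q) → (P → Q) → (Q → P) → 𝟙 P? ≡ 𝟙 Q?
  𝟙-cong (yes p) Q? f g = sym (𝟙-yes Q? (f p))
  𝟙-cong (no ¬p) Q? f g = sym (𝟙-no Q? (¬p ∘ g))

  𝟙-nonneg : ∀ {P : Set} (P? : Dec P) → 0ℤ ≤ 𝟙 P?
  𝟙-nonneg (yes _) = +≤+ ℕ.z≤n
  𝟙-nonneg (no  _) = +≤+ ℕ.z≤n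

  𝟙≢0 : ∀ {P : Set} (P? : Dec P) → 𝟙 P? ≢ 0ℤ → P
  𝟙≢0 (yes p) _  = p
  𝟙≢0 (no _)  ne = contradiction refl ne

  square-nonneg : ∀ i → 0ℤ ≤ i * i
  square-nonneg (+ n)    = subst (0ℤ ≤_) (pos-* n n) (+≤+ ℕ.z≤n)
  square-nonneg -[1+ n ] = +≤+ ℕ.z≤n

  square≡0 : ∀ i → i * i ≡ 0ℤ → i ≡ 0ℤ
  square≡0 i eq with i*j≡0⇒i≡0∨j≡0 i eq
  ... | inj₁ e = e
  ... | inj₂ e = e

  ∑-square≡0 : ∀ {A : Set} (xs : List A) (f : A → ℤ) → ∑ xs (λ x → f x * f x) ≡ 0ℤ → ∀ {x} → x ∈ xs → f x ≡ 0ℤ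
  ∑-square≡0 xs f eq {x} x∈ = square≡0 (f x)
    (≤-antisym (subst (f x * f x ≤_) eq (term≤∑ {f = λ y → f y * f y} (λ y → square-nonneg (f y)) x∈)) (square-nonneg (f x)))

  *-cancelˡ : ∀ k → k ≢ 0ℤ → ∀ {i j} → k * i ≡ k * j → i ≡ j
  *-cancelˡ k k≢0 {i} {j} = *-cancelˡ-≡ k i j {{≢-nonZero k≢0}}

  ∣-resp : ∀ {k i j} → i ≡ j → k ∣ i → k ∣ j
  ∣-resp refl d = d

  range : ℕ → List ℤ
  range zero    = []
  range (suc n) = + n ∷ range n

  ∈-range⁻ : ∀ {n v} → v ∈ range n → ∃[ i ] (i ℕ.< n × v ≡ + i)
  ∈-range⁻ {suc n} (here refl) = n , ℕₚ.≤-refl , refl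
  ∈-range⁻ {suc n} (there v∈) with ∈-range⁻ v∈
  ... | i , i<n , eq = i , ℕₚ.m≤n⇒m≤1+n i<n , eq

  ∈-range⁺ : ∀ {n i} → i ℕ.< n → + i ∈ range n
  ∈-range⁺ {suc n} {i} (ℕ.s≤s i≤n) with i ℕₚ.≟ n
  ... | yes refl = here refl
  ... | no  i≢n  = there (∈-range⁺ (ℕₚ.≤∧≢⇒< i≤n i≢n))

  ∑-const : ∀ n k → ∑ (range n) (λ _ → k) ≡ + n * k
  ∑-const zero    k = refl
  ∑-const (suc n) k = trans (cong (_+_ k) (∑-const n k)) (lemma k (+ n))
    where
    lemma : ∀ a b → a + b * a ≡ (1ℤ + b) * a
    lemma = solve-∀

  ∑-telescope : ∀ n (F : ℤ → ℤ) → ∑ (range n) (λ v → F (v + 1ℤ)) ≡ ∑ (range n) F - F 0ℤ + F (+ n)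
  ∑-telescope zero    F = lemma (F 0ℤ)
    where
    lemma : ∀ a → 0ℤ ≡ 0ℤ - a + a
    lemma = solve-∀
  ∑-telescope (suc n) F = trans
    (cong₂ _+_ (cong F (+-comm (+ n) 1ℤ)) (∑-telescope n F))
    (lemma (F (+ suc n)) (F (+ n)) (F 0ℤ) _)
    where
    lemma : ∀ a b c s → a + (s - c + b) ≡ (b + s) - c + a
    lemma = solve-∀

  ∑-front : ∀ n (F : ℤ → ℤ) → ∑ (range (suc n)) F ≡ ∑ (range n) (λ v → F (v + 1ℤ)) + F 0ℤ
  ∑-front n F = trans (lemma (F (+ n)) (∑ (range n) F) (F 0ℤ)) (cong (_+ F 0ℤ) (sym (∑-telescope n F)))
    where
    lemma : ∀ a s c → a + s ≡ (s - c + a) + c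
    lemma = solve-∀

  -- The window -h, ..., h is symmetric, so the terms pair off under negation and only the centre
  -- remains. Applied to solutions z of z² ≡ v it gives the parity of the Gauss sum.
  ∑-symmetric-parity : ∀ h (F : ℤ → ℤ) → (∀ v → F (- v) ≡ F v) →
    + 2 ∣ ∑ (range (suc (h ℕ.+ h))) (λ v → F (v - + h)) - F 0ℤ
  ∑-symmetric-parity zero    F even = divides 0ℤ (lemma (F 0ℤ))
    where
    lemma : ∀ a → a + 0ℤ - a ≡ 0ℤ * + 2
    lemma = solve-∀
  ∑-symmetric-parity (suc h) F even = ∣-resp (sym eq)
    (∣m∣n⇒∣m+n (∑-symmetric-parity h F even) (divides (F (+ suc h)) refl))
    where
    n = suc (h ℕ.+ h)
    W : ℤ → ℤ
    W v = F (v - + suc h)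
    cancel : ∀ v h → v + 1ℤ - (1ℤ + h) ≡ v - h
    cancel = solve-∀
    top : ∀ h → 1ℤ + (1ℤ + (h + h)) - (1ℤ + h) ≡ 1ℤ + h
    top = solve-∀
    collect : ∀ a s c → a + (s + a) - c ≡ s - c + a * + 2
    collect = solve-∀
    eq : ∑ (range (suc (suc h ℕ.+ suc h))) W - F 0ℤ ≡ ∑ (range n) (λ v → F (v - + h)) - F 0ℤ + F (+ suc h) * + 2
    eq = begin
      ∑ (range (suc (suc h ℕ.+ suc h))) W - F 0ℤ
        ≡⟨ cong (λ m → ∑ (range (suc (suc m))) W - F 0ℤ) (ℕₚ.+-suc h h) ⟩
      W (+ suc n) + ∑ (range (suc n)) W - F 0ℤ
        ≡⟨ cong (λ s → W (+ suc n) + s - F 0ℤ) (∑-front n W) ⟩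
      W (+ suc n) + (∑ (range n) (λ v → W (v + 1ℤ)) + W 0ℤ) - F 0ℤ
        ≡⟨ cong₂ (λ a b → a + b - F 0ℤ) (cong F (top (+ h)))
             (cong₂ _+_ (∑-cong (range n) (λ v → cong F (cancel v (+ h))))
               (trans (cong F (+-identityˡ _)) (even (+ suc h)))) ⟩
      F (+ suc h) + (∑ (range n) (λ v → F (v - + h)) + F (+ suc h)) - F 0ℤ
        ≡⟨ collect (F (+ suc h)) (∑ (range n) (λ v → F (v - + h))) (F 0ℤ) ⟩
      ∑ (range n) (λ v → F (v - + h)) - F 0ℤ + F (+ suc h) * + 2 ∎
      where open ≡-Reasoning

  -- Integer arithmetic

  prime∤! : ∀ {p} → Prime p → ∀ k → k ℕ.< p → ¬ (p ℕ∣.∣ k !)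
  prime∤! pr zero    k<p d = ℕₚ.<-irrefl (sym (ℕ∣.∣1⇒≡1 d)) (ℕ.nonTrivial⇒n>1 _ {{prime⇒nonTrivial pr}})
  prime∤! pr (suc k) k<p d with euclidsLemma (suc k) (k !) pr d
  ... | inj₁ e = ℕ∣.>⇒∤ k<p e
  ... | inj₂ e = prime∤! pr k (ℕₚ.<-trans ℕₚ.≤-refl k<p) e

  prime∣C : ∀ {p} → Prime p → ∀ k → 0 ℕ.< k → k ℕ.< p → p ℕ∣.∣ p choose k
  prime∣C {suc q} pr k 0<k k<p
    with euclidsLemma (suc q choose k) (k ! ℕ.* (suc q ℕ.∸ k) !) pr (subst (suc q ℕ∣.∣_) (sym eq) (ℕ∣.m∣m*n (q !)))
    where
    instance
      _ = k ℕₚ.!* (suc q ℕ.∸ k) !≢0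
    eq : (suc q choose k) ℕ.* (k ! ℕ.* (suc q ℕ.∸ k) !) ≡ suc q !
    eq = trans (cong (ℕ._* (k ! ℕ.* (suc q ℕ.∸ k) !)) (nCk≡n!/k![n-k]! (ℕₚ.<⇒≤ k<p)))
               (ℕ/.m/n*n≡m (k![n∸k]!∣n! (ℕₚ.<⇒≤ k<p)))
  ... | inj₁ d = d
  ... | inj₂ d with euclidsLemma (k !) ((suc q ℕ.∸ k) !) pr d
  ...   | inj₁ e = contradiction e (prime∤! pr k k<p)
  ...   | inj₂ e = contradiction e (prime∤! pr (suc q ℕ.∸ k) (ℕₚ.∸-monoʳ-< 0<k (ℕₚ.<⇒≤ k<p)))

  square≡1 : ∀ i → i * i ≡ 1ℤ → i ≡ 1ℤ ⊎ i ≡ -1ℤ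
  square≡1 i eq with i*j≡0⇒i≡0∨j≡0 (i - 1ℤ) (trans (lemma i) (cong (_- 1ℤ) eq))
    where
    lemma : ∀ i → (i - 1ℤ) * (i + 1ℤ) ≡ i * i - 1ℤ
    lemma = solve-∀
  ... | inj₁ e = inj₁ (trans (lemma i) (cong (_+ 1ℤ) e))
    where
    lemma : ∀ i → i ≡ i - 1ℤ + 1ℤ
    lemma = solve-∀
  ... | inj₂ e = inj₂ (trans (lemma i) (cong (_- 1ℤ) e))
    where
    lemma : ∀ i → i ≡ i + 1ℤ - 1ℤ
    lemma = solve-∀

  square≤3⇒1 : ∀ i → i ≢ 0ℤ → i * i ≤ + 3 → i * i ≡ 1ℤ
  square≤3⇒1 (+ 0)    ne le = contradiction refl ne
  square≤3⇒1 (+ 1)    ne le = refl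
  square≤3⇒1 (+ suc (suc n)) ne (+≤+ le) = contradiction
    (ℕₚ.≤-trans (ℕₚ.*-mono-≤ {2} {suc (suc n)} {2} {suc (suc n)} (ℕ.s≤s (ℕ.s≤s ℕ.z≤n)) (ℕ.s≤s (ℕ.s≤s ℕ.z≤n))) le) (λ { (ℕ.s≤s (ℕ.s≤s (ℕ.s≤s ()))) })
  square≤3⇒1 -[1+ 0 ] ne le = refl
  square≤3⇒1 -[1+ suc n ] ne (+≤+ le) = contradiction
    (ℕₚ.≤-trans (ℕₚ.*-mono-≤ {2} {suc (suc n)} {2} {suc (suc n)} (ℕ.s≤s (ℕ.s≤s ℕ.z≤n)) (ℕ.s≤s (ℕ.s≤s ℕ.z≤n))) le) (λ { (ℕ.s≤s (ℕ.s≤s (ℕ.s≤s ()))) })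

  odd-square≤4⇒1 : ∀ i → ¬ (+ 2 ∣ i) → i * i ≤ + 4 → i * i ≡ 1ℤ
  odd-square≤4⇒1 i odd le with i * i ≟ + 4
  ... | no  ne = square≤3⇒1 i (λ { refl → odd (divides 0ℤ refl) }) (≤-pred⁺ (≤∧≢⇒< le ne))
    where
    ≤-pred⁺ : ∀ {j} → j < + 4 → j ≤ + 3
    ≤-pred⁺ {+ n} (+<+ (ℕ.s≤s l)) = +≤+ l
    ≤-pred⁺ { -[1+ n ]} _ = -≤+
  ... | yes e with i*j≡0⇒i≡0∨j≡0 (i - + 2) (trans (lemma i) (cong (_- + 4) e))
    where
    lemma : ∀ i → (i - + 2) * (i + + 2) ≡ i * i - + 4
    lemma = solve-∀
  ...   | inj₁ e' = contradiction (divides 1ℤ (trans (lemma i) (cong (_+ + 2) e'))) odd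
    where
    lemma : ∀ i → i ≡ i - + 2 + + 2
    lemma = solve-∀
  ...   | inj₂ e' = contradiction (divides -1ℤ (trans (lemma i) (cong (_- + 2) e'))) odd
    where
    lemma : ∀ i → i ≡ i + + 2 - + 2
    lemma = solve-∀

  search-∈ : ∀ {A : Set} {Q : A → Set} → (∀ x → Dec (Q x)) → ∀ xs → (∀ x → x ∈ xs → Q x) ⊎ ∃[ x ] (x ∈ xs × ¬ Q x)
  search-∈ Q? []       = inj₁ (λ x ())
  search-∈ Q? (x ∷ xs) with Q? x | search-∈ Q? xs
  ... | no ¬q | _                  = inj₂ (x , here refl , ¬q)
  ... | yes q | inj₂ (y , y∈ , ¬q) = inj₂ (y , there y∈ , ¬q)
  ... | yes q | inj₁ all           = inj₁ (λ { _ (here refl) → q ; y (there y∈) → all y y∈ })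

  sq₂ sq₄ sq₆ : ℤ → ℤ
  sq₂ x = x * x
  sq₄ x = sq₂ x * sq₂ x
  sq₆ x = sq₄ x * sq₂ x

  -- In the norm of ζ^a + ζ^b + ζ^c - ζ^d the differences among a, b, c carry the sign +, those with
  -- d the sign -. With x = a-d, y = b-d, z = c-d and φ even, this is half of their sum weighted by
  -- φ.
  Δ[_] : (ℤ → ℤ) → ℤ → ℤ → ℤ → ℤ
  Δ[ φ ] x y z = φ (x - y) + φ (x - z) + φ (y - z) - φ x - φ y - φ z

  Δ₂-identity : ∀ x y z → Δ[ sq₂ ] x y z ≡ (x + y + z) * (x + y + z) - + 4 * (x * y + x * z + y * z)
  Δ₂-identity = lemma
    where
    lemma : ∀ x y z → (x - y) * (x - y) + (x - z) * (x - z) + (y - z) * (y - z) - x * x - y * y - z * z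
      ≡ (x + y + z) * (x + y + z) - + 4 * (x * y + x * z + y * z)
    lemma = solve-∀

  -- Written so that Δ₂ splits off: if p divides Δ₂ and Δ₄, it divides 4(x+y+z)xyz. As x, y, z are
  -- prime to p, the sum x+y+z must vanish, and then Δ₂ = e₁² - 4e₂ makes e₂ vanish too.
  Δ₄-identity : ∀ x y z → let m = Δ[ sq₂ ] x y z in
    Δ[ sq₄ ] x y z ≡ m * (+ 2 * (x * x + y * y + z * z) - m - + 4 * (x * y + x * z + y * z)) - + 4 * ((x + y + z) * (x * y * z))
  Δ₄-identity = lemma
    where
    lemma : ∀ x y z → let m = (x - y) * (x - y) + (x - z) * (x - z) + (y - z) * (y - z) - x * x - y * y - z * z in
      (x - y) * (x - y) * ((x - y) * (x - y)) + (x - z) * (x - z) * ((x - z) * (x - z)) + (y - z) * (y - z) * ((y - z) * (y - z))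
        - x * x * (x * x) - y * y * (y * y) - z * z * (z * z)
      ≡ m * (+ 2 * (x * x + y * y + z * z) - m - + 4 * (x * y + x * z + y * z)) - + 4 * ((x + y + z) * (x * y * z))
    lemma = solve-∀

  -- The squares are q-3xy, 4q-3y², 4q-3x² and q+xy; each of the first four summands is what remains
  -- of the cube of one of them after its constant term in q is dropped and q is divided out. The
  -- constant terms add up to -28(x⁶+x³y³+y⁶), and the last summand turns this into -84x⁶ by means
  -- of x³-y³ = (x-y)q.
  Δ₆-cofactor : ℤ → ℤ → ℤ
  Δ₆-cofactor x y = let q = x * x + x * y + y * y in
    q * q - + 9 * q * (x * y) + + 27 * (x * y * (x * y))
      + + 4 * (+ 16 * (q * q) - + 36 * q * (y * y) + + 27 * (y * y * (y * y)))
      + + 4 * (+ 16 * (q * q) - + 36 * q * (x * x) + + 27 * (x * x * (x * x)))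
      - (q * q + + 3 * q * (x * y) + + 3 * (x * y * (x * y)))
      + + 28 * (+ 3 * (x * x * x) * (x - y) - (x - y) * (x - y) * q)

  -- On z = -x-y each of (x-y)², (2x+y)², (x+2y)², (x+y)² is a monomial modulo x²+xy+y², and x³ ≡ y³.
  Δ₆-identity : ∀ x y → Δ[ sq₆ ] x y (- x - y) ≡ (x * x + x * y + y * y) * Δ₆-cofactor x y - + 84 * sq₆ x
  Δ₆-identity = lemma
    where
    lemma : ∀ x y → let q = x * x + x * y + y * y in
      let u = (x - y) * (x - y) ; v = (x - (- x - y)) * (x - (- x - y)) ; w = (y - (- x - y)) * (y - (- x - y)) ; s = (- x - y) * (- x - y) in
      u * u * u + v * v * v + w * w * w - x * x * (x * x) * (x * x) - y * y * (y * y) * (y * y) - s * s * s ≡ q *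
      (q * q - + 9 * q * (x * y) + + 27 * (x * y * (x * y))
        + + 4 * (+ 16 * (q * q) - + 36 * q * (y * y) + + 27 * (y * y * (y * y)))
        + + 4 * (+ 16 * (q * q) - + 36 * q * (x * x) + + 27 * (x * x * (x * x)))
        - (q * q + + 3 * q * (x * y) + + 3 * (x * y * (x * y)))
        + + 28 * (+ 3 * (x * x * x) * (x - y) - (x - y) * (x - y) * q))
      - + 84 * (x * x * (x * x) * (x * x))
    lemma = solve-∀

  -- Signs are indexed by a finite type so that a statement about five of them can be decided by
  -- running through all patterns.
  ± : Fin 2 → ℤ
  ± 0F = 1ℤ
  ± 1F = -1ℤ

  square≡1⇒sign : ∀ i → i * i ≡ 1ℤ → ∃[ t ] i ≡ ± t
  square≡1⇒sign i e with square≡1 i e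
  ... | inj₁ i≡1  = 0F , i≡1
  ... | inj₂ i≡-1 = 1F , i≡-1

  OneNegated : ℤ → ℤ → ℤ → ℤ → ℤ → Set
  OneNegated ε s₁ s₂ s₃ s₄ =
    (s₁ ≡ ε × s₂ ≡ ε × s₃ ≡ ε × s₄ ≡ - ε) ⊎ (s₁ ≡ ε × s₂ ≡ ε × s₃ ≡ - ε × s₄ ≡ ε) ⊎
    (s₁ ≡ ε × s₂ ≡ - ε × s₃ ≡ ε × s₄ ≡ ε) ⊎ (s₁ ≡ - ε × s₂ ≡ ε × s₃ ≡ ε × s₄ ≡ ε)

  opaque
    sign-sum≡2 : ∀ e a b c d → ± a + ± b + ± c + ± d ≡ + 2 * ± e →
      OneNegated (± e) (± a) (± b) (± c) (± d)
    sign-sum≡2 = toWitness {a? = Finₚ.all? λ e → Finₚ.all? λ a → Finₚ.all? λ b → Finₚ.all? λ c → Finₚ.all? λ d →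
      (± a + ± b + ± c + ± d ≟ + 2 * ± e) →-dec
      ((same a e ×-dec same b e ×-dec same c e ×-dec opposite d e) ⊎-dec (same a e ×-dec same b e ×-dec opposite c e ×-dec same d e) ⊎-dec
       (same a e ×-dec opposite b e ×-dec same c e ×-dec same d e) ⊎-dec (opposite a e ×-dec same b e ×-dec same c e ×-dec same d e))} _
      where
      same : ∀ i j → Dec (± i ≡ ± j)
      same i j = ± i ≟ ± j
      opposite : ∀ i j → Dec (± i ≡ - ± j)
      opposite i j = ± i ≟ - ± j

  signs : ∀ ε s₁ s₂ s₃ s₄ → ε * ε ≡ 1ℤ → s₁ * s₁ ≡ 1ℤ → s₂ * s₂ ≡ 1ℤ → s₃ * s₃ ≡ 1ℤ → s₄ * s₄ ≡ 1ℤ →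
    s₁ + s₂ + s₃ + s₄ ≡ + 2 * ε → OneNegated ε s₁ s₂ s₃ s₄
  signs ε s₁ s₂ s₃ s₄ e e₁ e₂ e₃ e₄
    with square≡1⇒sign ε e | square≡1⇒sign s₁ e₁ | square≡1⇒sign s₂ e₂ | square≡1⇒sign s₃ e₃ | square≡1⇒sign s₄ e₄
  ... | t , refl | t₁ , refl | t₂ , refl | t₃ , refl | t₄ , refl = sign-sum≡2 t t₁ t₂ t₃ t₄

  parity⁺ : ∀ n → + 2 ∣ + n ⊎ + 2 ∣ + n - 1ℤ
  parity⁺ zero    = inj₁ (divides 0ℤ refl)
  parity⁺ (suc n) with parity⁺ n
  ... | inj₁ e = inj₂ (∣-resp (lemma (+ n)) e)
    where
    lemma : ∀ n → n ≡ 1ℤ + n - 1ℤ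
    lemma = solve-∀
  ... | inj₂ e = inj₁ (∣-resp (lemma (+ n)) (∣m∣n⇒∣m+n e (divides 1ℤ refl)))
    where
    lemma : ∀ n → n - 1ℤ + + 2 ≡ 1ℤ + n
    lemma = solve-∀

  parity : ∀ x → + 2 ∣ x ⊎ + 2 ∣ x - 1ℤ
  parity (+ n)    = parity⁺ n
  parity -[1+ n ] with parity⁺ (suc n)
  ... | inj₁ e = inj₁ (∣m⇒∣-m e)
  ... | inj₂ e = inj₂ (∣-resp (lemma (+ suc n)) (∣m∣n⇒∣m-n (∣m⇒∣-m e) (divides 1ℤ refl)))
    where
    lemma : ∀ n → - (n - 1ℤ) - + 2 ≡ - n - 1ℤ
    lemma = solve-∀

  2∣w²-w : ∀ w → + 2 ∣ w * w - w
  2∣w²-w w with parity w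
  ... | inj₁ e = ∣-resp (lemma w) (∣m⇒∣m*n (w - 1ℤ) e)
    where
    lemma : ∀ w → w * (w - 1ℤ) ≡ w * w - w
    lemma = solve-∀
  ... | inj₂ e = ∣-resp (lemma w) (∣n⇒∣m*n w e)
    where
    lemma : ∀ w → w * (w - 1ℤ) ≡ w * w - w
    lemma = solve-∀

  odd-square : ∀ x → ¬ (+ 2 ∣ x) → + 8 ∣ x * x - 1ℤ
  odd-square x odd with parity x
  ... | inj₁ e = contradiction e odd
  -- For x = 2k+1 one has x²-1 = 4k(k+1), and k(k+1) is w²-w at w = -k.
  ... | inj₂ (divides k e) with 2∣w²-w (- k)
  ...   | divides m e' = divides m (trans (trans (cong (λ y → y * y - 1ℤ) (trans (l₁ x) (cong (_+ 1ℤ) e))) (l₂ k)) (trans (cong (+ 4 *_) e') (l₃ m)))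
    where
    l₁ : ∀ x → x ≡ x - 1ℤ + 1ℤ
    l₁ = solve-∀
    l₂ : ∀ k → (k * + 2 + 1ℤ) * (k * + 2 + 1ℤ) - 1ℤ ≡ + 4 * ((- k) * (- k) - - k)
    l₂ = solve-∀
    l₃ : ∀ m → + 4 * (m * + 2) ≡ m * + 8
    l₃ = solve-∀

  square1⇒odd : ∀ x → x * x ≡ 1ℤ → ¬ (+ 2 ∣ x)
  square1⇒odd x e d with square≡1 x e
  ... | inj₁ refl = contradiction d (from-no (+ 2 ∣? 1ℤ))
  ... | inj₂ refl = contradiction d (from-no (+ 2 ∣? -1ℤ))

  opaque
    prime-7 : Prime 7
    prime-7 = from-yes (prime? 7)

  -- Residues modulo p

  opaque
    δ[_] : ℕ → ℤ → ℤ
    δ[ p ] v = 𝟙 (+ p ∣? v)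

    δ-yes : ∀ p {v} → + p ∣ v → δ[ p ] v ≡ 1ℤ
    δ-yes p = 𝟙-yes _

    δ-no : ∀ p {v} → ¬ (+ p ∣ v) → δ[ p ] v ≡ 0ℤ
    δ-no p = 𝟙-no _

    δ-cong[_] : ∀ p {v w} → (+ p ∣ v → + p ∣ w) → (+ p ∣ w → + p ∣ v) → δ[ p ] v ≡ δ[ p ] w
    δ-cong[ p ] = 𝟙-cong _ _

    δ-nonneg : ∀ p v → 0ℤ ≤ δ[ p ] v
    δ-nonneg p v = 𝟙-nonneg (+ p ∣? v)

    δ≢0 : ∀ p {v} → δ[ p ] v ≢ 0ℤ → + p ∣ v
    δ≢0 p = 𝟙≢0 _

  opaque
    -- The number of square roots of v modulo p, which is the coefficient of the quadratic Gauss sum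
    -- at v. It is defined for a bare number p so that it can be tabulated for p = 7.
    γ[_] : ℕ → ℤ → ℤ
    γ[ p ] v = ∑ (range p) (λ z → δ[ p ] (v - z * z))

    γ-def : ∀ p v → ∑ (range p) (λ z → δ[ p ] (v - z * z)) ≡ γ[ p ] v
    γ-def p v = refl

  γ-per : ∀ p v w → + p ∣ v - w → γ[ p ] v ≡ γ[ p ] w
  γ-per p v w d = trans (sym (γ-def p v)) (trans (∑-cong (range p) (λ z → δ-cong[ p ]
      (λ e → ∣-resp (l₁ v w (z * z)) (∣m∣n⇒∣m-n e d)) (λ e → ∣-resp (l₂ v w (z * z)) (∣m∣n⇒∣m+n e d)))) (γ-def p w))
    where
    l₁ : ∀ v w s → v - s - (v - w) ≡ w - s
    l₁ = solve-∀
    l₂ : ∀ v w s → w - s + (v - w) ≡ v - s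
    l₂ = solve-∀

  square-roots₇ : ℕ → ℤ
  square-roots₇ 0 = 1ℤ
  square-roots₇ 1 = + 2
  square-roots₇ 2 = + 2
  square-roots₇ 4 = + 2
  square-roots₇ _ = 0ℤ

  opaque
    unfolding δ[_] γ[_]

    γ₇-residue : ∀ i → i ℕ.< 7 → γ[ 7 ] (+ i) ≡ square-roots₇ i
    γ₇-residue 0 _ = refl
    γ₇-residue 1 _ = refl
    γ₇-residue 2 _ = refl
    γ₇-residue 3 _ = refl
    γ₇-residue 4 _ = refl
    γ₇-residue 5 _ = refl
    γ₇-residue 6 _ = refl
    γ₇-residue (suc (suc (suc (suc (suc (suc (suc i))))))) (ℕ.s≤s (ℕ.s≤s (ℕ.s≤s (ℕ.s≤s (ℕ.s≤s (ℕ.s≤s (ℕ.s≤s ())))))))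

  quadratic₇ : ℤ → ℤ
  quadratic₇ v = square-roots₇ (v ℤ/.%ℕ 7)

  γ₇ : ∀ v → γ[ 7 ] v ≡ quadratic₇ v
  γ₇ v = trans (γ-per 7 v (+ (v ℤ/.%ℕ 7)) (divides (v ℤ/./ℕ 7) (trans (cong (_- + (v ℤ/.%ℕ 7)) (ℤ/.a≡a%ℕn+[a/ℕn]*n v 7)) (l (+ (v ℤ/.%ℕ 7)) _))))
      (γ₇-residue (v ℤ/.%ℕ 7) (ℤ/.n%ℕd<d v 7))
    where
    l : ∀ r q → r + q - r ≡ q
    l = solve-∀

  -- For p = 7, the value of n₀ + n₂ at d + tA when n₁ + n₃ = 2 and (a , b , c) = (d + A , d + 2A , d + 4A).
  profile : (ℤ → ℤ) → ℤ → ℤ → ℤ → ℤ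
  profile γ ε A t = ε * (γ ((1ℤ - t) * A) + γ ((+ 2 - t) * A) + γ ((+ 4 - t) * A) - γ ((0ℤ - t) * A)) + (+ 2 - + 2 * ε)

  profile-cong : ∀ γ γ' ε A A' t → (∀ k → γ ((k - t) * A) ≡ γ' ((k - t) * A')) → profile γ ε A t ≡ profile γ' ε A' t
  profile-cong γ γ' ε A A' t eq = cong (λ s → ε * s + (+ 2 - + 2 * ε)) (cong₂ _-_ (cong₂ _+_ (cong₂ _+_ (eq 1ℤ) (eq (+ 2))) (eq (+ 4))) (eq 0ℤ))

  -- The sign of ε times the Legendre symbol of A decides: for -1 a count would be -1 at t = 0, for
  -- +1 the values at t = 0, ..., 6 are 5, 3, 3, 0, 3, 0, 0, with zeros at the nonresidues.
  Profile₇ : (ℤ → ℤ) → ℤ → ℤ → Set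
  Profile₇ γ ε A = profile γ ε A 0ℤ ≡ -1ℤ ⊎ (profile γ ε A (+ 3) ≡ 0ℤ × profile γ ε A (+ 5) ≡ 0ℤ × profile γ ε A (+ 6) ≡ 0ℤ)

  profile₇ : ∀ ε → ε * ε ≡ 1ℤ → ∀ i → 0 ℕ.< i → i ℕ.< 7 → Profile₇ γ[ 7 ] ε (+ i)
  profile₇ ε ε² i 0<i i<7 = Sum.map (trans (eq 0ℤ)) (λ (e₃ , e₅ , e₆) → trans (eq (+ 3)) e₃ , trans (eq (+ 5)) e₅ , trans (eq (+ 6)) e₆) (table ε ε² i 0<i i<7)
    where
    eq : ∀ t → profile γ[ 7 ] ε (+ i) t ≡ profile quadratic₇ ε (+ i) t
    eq t = profile-cong γ[ 7 ] quadratic₇ ε (+ i) (+ i) t (λ k → γ₇ ((k - t) * + i))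
    table : ∀ ε → ε * ε ≡ 1ℤ → ∀ i → 0 ℕ.< i → i ℕ.< 7 → Profile₇ quadratic₇ ε (+ i)
    table ε ε² i 0<i i<7 with square≡1 ε ε²
    table ε ε² 1 _ _ | inj₁ refl = inj₂ (refl , refl , refl)
    table ε ε² 2 _ _ | inj₁ refl = inj₂ (refl , refl , refl)
    table ε ε² 3 _ _ | inj₁ refl = inj₁ refl
    table ε ε² 4 _ _ | inj₁ refl = inj₂ (refl , refl , refl)
    table ε ε² 5 _ _ | inj₁ refl = inj₁ refl
    table ε ε² 6 _ _ | inj₁ refl = inj₁ refl
    table ε ε² 1 _ _ | inj₂ refl = inj₁ refl
    table ε ε² 2 _ _ | inj₂ refl = inj₁ refl
    table ε ε² 3 _ _ | inj₂ refl = inj₂ (refl , refl , refl)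
    table ε ε² 4 _ _ | inj₂ refl = inj₁ refl
    table ε ε² 5 _ _ | inj₂ refl = inj₂ (refl , refl , refl)
    table ε ε² 6 _ _ | inj₂ refl = inj₂ (refl , refl , refl)
    table ε ε² (suc (suc (suc (suc (suc (suc (suc i))))))) _ (ℕ.s≤s (ℕ.s≤s (ℕ.s≤s (ℕ.s≤s (ℕ.s≤s (ℕ.s≤s (ℕ.s≤s ()))))))) | _

  -- Sums of periodic functions over a full residue system.

  module Residues (p : ℕ) (pr : Prime p) where

    P : ℤ
    P = + p

    rng : List ℤ
    rng = range p

    δ : ℤ → ℤ
    δ = δ[ p ]

    1<p : 1 ℕ.< p
    1<p = ℕ.nonTrivial⇒n>1 p {{prime⇒nonTrivial pr}}

    0<p : 0 ℕ.< p
    0<p = ℕₚ.<-trans (ℕ.s≤s ℕ.z≤n) 1<p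

    P≢0 : P ≢ 0ℤ
    P≢0 eq = ℕₚ.<-irrefl (sym (+-injective eq)) 0<p

    P∤small : ∀ {i} → 0 ℕ.< i → i ℕ.< p → ¬ (P ∣ + i)
    P∤small 0<i i<p d = ℕ∣.>⇒∤ {{ℕ.>-nonZero 0<i}} i<p (∣⇒∣ᵤ d)

    euclid : ∀ x y → P ∣ x * y → P ∣ x ⊎ P ∣ y
    euclid x y d with euclidsLemma (abs x) (abs y) pr (subst (p ℕ∣.∣_) (abs-* x y) (∣⇒∣ᵤ d))
    ... | inj₁ e = inj₁ (∣ᵤ⇒∣ e)
    ... | inj₂ e = inj₂ (∣ᵤ⇒∣ e)

    euclid-square : ∀ x → P ∣ x * x → P ∣ x
    euclid-square x d with euclid x x d
    ... | inj₁ e = e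
    ... | inj₂ e = e

    Per : (ℤ → ℤ) → Set
    Per F = ∀ v w → P ∣ v - w → F v ≡ F w

    ∣-diff-sym : ∀ v w → P ∣ v - w → P ∣ w - v
    ∣-diff-sym v w d = ∣-resp (lemma v w) (∣m⇒∣-m d)
      where
      lemma : ∀ v w → - (v - w) ≡ w - v
      lemma = solve-∀

    δ-∣ : ∀ {v} → P ∣ v → δ v ≡ 1ℤ
    δ-∣ = δ-yes p

    δ-∤ : ∀ {v} → ¬ P ∣ v → δ v ≡ 0ℤ
    δ-∤ = δ-no p

    δ-cong : ∀ {v w} → (P ∣ v → P ∣ w) → (P ∣ w → P ∣ v) → δ v ≡ δ w
    δ-cong = δ-cong[ p ]

    δ-per : Per δ
    δ-per v w d = δ-cong (λ dv → ∣-resp (lemma₁ v w) (∣m∣n⇒∣m-n dv d))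
                             (λ dw → ∣-resp (lemma₂ v w) (∣m∣n⇒∣m+n d dw))
      where
      lemma₁ : ∀ v w → v - (v - w) ≡ w
      lemma₁ = solve-∀
      lemma₂ : ∀ v w → v - w + w ≡ v
      lemma₂ = solve-∀

    δ-neg : ∀ v → δ (- v) ≡ δ v
    δ-neg v = δ-cong (λ d → ∣-resp (neg-involutive v) (∣m⇒∣-m d)) ∣m⇒∣-m

    ∑-δ-upto : ∀ n → n ℕ.< p → ∑ (range (suc n)) δ ≡ 1ℤ
    ∑-δ-upto zero    _   = cong (_+ 0ℤ) (δ-∣ {0ℤ} (divides 0ℤ refl))
    ∑-δ-upto (suc n) n<p = trans
      (cong₂ _+_ (δ-∤ (P∤small (ℕ.s≤s ℕ.z≤n) n<p)) (∑-δ-upto n (ℕₚ.<-trans ℕₚ.≤-refl n<p)))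
      refl

    ∑-shift-suc : ∀ {F} → Per F → ∑ rng (λ v → F (v + 1ℤ)) ≡ ∑ rng F
    ∑-shift-suc {F} per = trans (∑-telescope p F)
      (trans (cong (λ x → ∑ rng F - F 0ℤ + x) (per P 0ℤ (divides 1ℤ (lemma₁ P)))) (lemma₂ (∑ rng F) (F 0ℤ)))
      where
      lemma₁ : ∀ P → P - 0ℤ ≡ 1ℤ * P
      lemma₁ = solve-∀
      lemma₂ : ∀ s c → s - c + c ≡ s
      lemma₂ = solve-∀

    per-shift : ∀ {F} k → Per F → Per (λ v → F (v + k))
    per-shift k per v w d = per (v + k) (w + k) (∣-resp (lemma v w k) d)
      where
      lemma : ∀ v w k → v - w ≡ v + k - (w + k)
      lemma = solve-∀

    ∑-shift⁺ : ∀ {F} → Per F → ∀ n → ∑ rng (λ v → F (v + + n)) ≡ ∑ rng F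
    ∑-shift⁺ {F} per zero    = ∑-cong rng (λ v → cong F (+-identityʳ v))
    ∑-shift⁺ {F} per (suc n) = trans (∑-cong rng (λ v → cong F (lemma v (+ n))))
      (trans (∑-shift-suc (per-shift (+ n) per)) (∑-shift⁺ per n))
      where
      lemma : ∀ v n → v + (1ℤ + n) ≡ v + 1ℤ + n
      lemma = solve-∀

    ∑-shift : ∀ {F} → Per F → ∀ k → ∑ rng (λ v → F (v + k)) ≡ ∑ rng F
    ∑-shift {F} per (+ n)    = ∑-shift⁺ per n
    ∑-shift {F} per -[1+ n ] = sym (trans
      (∑-cong rng (λ v → cong F (lemma v (+ suc n))))
      (∑-shift⁺ (per-shift -[1+ n ] per) (suc n)))
      where
      lemma : ∀ v n → v ≡ v + n + - n
      lemma = solve-∀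

    inverse : ∀ k → ¬ P ∣ k → ∃[ k' ] P ∣ k * k' - 1ℤ
    inverse k ¬d with Cop.coprime-Bézout {abs k} {p} cop
      where
      cop : Cop.Coprime (abs k) p
      cop {d} (d∣k , d∣p) with prime⇒irreducible pr d∣p
      ... | inj₁ d≡1 = d≡1
      ... | inj₂ refl = contradiction (∣ᵤ⇒∣ d∣k) ¬d
    ... | GCD.Bézout.+- x y eq = sgn k * + x , divides (+ y) (begin
        k * (sgn k * + x) - 1ℤ   ≡⟨ cong (_- 1ℤ) (sgn-lemma k x) ⟩
        + (x ℕ.* (abs k)) - 1ℤ     ≡⟨ cong (λ z → + z - 1ℤ) (sym eq) ⟩
        1ℤ + + (y ℕ.* p) - 1ℤ    ≡⟨ cong (λ z → 1ℤ + z - 1ℤ) (pos-* y p) ⟩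
        1ℤ + + y * P - 1ℤ        ≡⟨ lemma (+ y * P) ⟩
        + y * P                  ∎)
      where
      open ≡-Reasoning
      lemma : ∀ a → 1ℤ + a - 1ℤ ≡ a
      lemma = solve-∀
      sgn : ℤ → ℤ
      sgn (+ _)    = 1ℤ
      sgn -[1+ _ ] = -1ℤ
      sgn-lemma : ∀ k x → k * (sgn k * + x) ≡ + (x ℕ.* (abs k))
      sgn-lemma (+ n) x = trans (l (+ n) (+ x)) (sym (pos-* x n))
        where
        l : ∀ a b → a * (1ℤ * b) ≡ b * a
        l = solve-∀
      sgn-lemma -[1+ n ] x = trans (l (+ suc n) (+ x)) (sym (pos-* x (suc n)))
        where
        l : ∀ a b → (- a) * (-1ℤ * b) ≡ b * a
        l = solve-∀
    ... | GCD.Bézout.-+ x y eq = sgn k * + x , divides (- + y) (begin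
        k * (sgn k * + x) - 1ℤ   ≡⟨ cong (_- 1ℤ) (sgn-lemma k x) ⟩
        - + (x ℕ.* (abs k)) - 1ℤ     ≡⟨ lemma (+ (x ℕ.* (abs k))) ⟩
        - + (1 ℕ.+ x ℕ.* (abs k))    ≡⟨ cong (λ z → - + z) eq ⟩
        - + (y ℕ.* p)        ≡⟨ cong -_ (pos-* y p) ⟩
        - (+ y * P)          ≡⟨ neg-distribˡ-* (+ y) P ⟩
        - + y * P                  ∎)
      where
      open ≡-Reasoning
      lemma : ∀ a → - a - 1ℤ ≡ - (1ℤ + a)
      lemma = solve-∀
      sgn : ℤ → ℤ
      sgn (+ _)    = -1ℤ
      sgn -[1+ _ ] = 1ℤ
      sgn-lemma : ∀ k x → k * (sgn k * + x) ≡ - + (x ℕ.* (abs k))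
      sgn-lemma (+ n) x = trans (l (+ n) (+ x)) (cong -_ (sym (pos-* x n)))
        where
        l : ∀ a b → a * (-1ℤ * b) ≡ - (b * a)
        l = solve-∀
      sgn-lemma -[1+ n ] x = trans (l (+ suc n) (+ x)) (cong -_ (sym (pos-* x (suc n))))
        where
        l : ∀ a b → (- a) * (1ℤ * b) ≡ - (b * a)
        l = solve-∀

    ∑-δ : ∑ rng δ ≡ 1ℤ
    ∑-δ = lemma p refl
      where
      lemma : ∀ n → n ≡ p → ∑ (range n) δ ≡ 1ℤ
      lemma zero    eq = contradiction (subst (0 ℕ.<_) (sym eq) 0<p) (λ ())
      lemma (suc n) eq = ∑-δ-upto n (ℕₚ.≤-reflexive eq)

    -- An inverse k' of k turns c ≡ kw into w ≡ k'c, and a residue system contains that class once.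
    ∑-δ-linear : ∀ c k → ¬ P ∣ k → ∑ rng (λ w → δ (c - k * w)) ≡ 1ℤ
    ∑-δ-linear c k ¬d with inverse k ¬d
    ... | k' , kk' = trans (∑-cong rng step) (trans (∑-shift δ-per (- (k' * c))) ∑-δ)
      where
      decomp : ∀ c k k' w → c - k * w ≡ - (k * (w + - (k' * c)) + (k * k' - 1ℤ) * c)
      decomp = solve-∀
      step : ∀ w → δ (c - k * w) ≡ δ (w + - (k' * c))
      step w = trans (cong δ (decomp c k k' w)) (trans (δ-neg _) (δ-cong to from))
        where
        x = w + - (k' * c)
        r : P ∣ (k * k' - 1ℤ) * c
        r = ∣m⇒∣m*n c kk'
        to : P ∣ k * x + (k * k' - 1ℤ) * c → P ∣ x
        to d with euclid k x (∣m+n∣n⇒∣m {m = k * x} d r)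
        ... | inj₁ e = contradiction e ¬d
        ... | inj₂ e = e
        from : P ∣ x → P ∣ k * x + (k * k' - 1ℤ) * c
        from d = ∣m∣n⇒∣m+n (∣n⇒∣m*n k d) r

    δ-pick : ∀ {F} → Per F → ∀ v w → δ (v - w) * F v ≡ δ (v - w) * F w
    δ-pick {F} per v w with P ∣? (v - w)
    ... | yes d = cong (δ (v - w) *_) (per v w d)
    ... | no ¬d = trans (cong (_* F v) (δ-∤ ¬d)) (cong (_* F w) (sym (δ-∤ ¬d)))

    -- Instead of permuting the list, F(kv) is written as a δ-weighted sum over w; after exchanging
    -- the sums, each w is reached from exactly one v.
    ∑-scale : ∀ {F} → Per F → ∀ k → ¬ P ∣ k → ∑ rng (λ v → F (k * v)) ≡ ∑ rng F
    ∑-scale {F} per k ¬d = begin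
      ∑ rng (λ v → F (k * v))                             ≡⟨ ∑-cong rng expand ⟩
      ∑ rng (λ v → ∑ rng (λ w → δ (w - k * v) * F w))     ≡⟨ ∑-swap rng rng _ ⟩
      ∑ rng (λ w → ∑ rng (λ v → δ (w - k * v) * F w))     ≡⟨ ∑-cong rng (λ w → ∑-*ʳ rng (λ v → δ (w - k * v)) (F w)) ⟩
      ∑ rng (λ w → ∑ rng (λ v → δ (w - k * v)) * F w)     ≡⟨ ∑-cong rng (λ w → cong (_* F w) (∑-δ-linear w k ¬d)) ⟩
      ∑ rng (λ w → 1ℤ * F w)                              ≡⟨ ∑-cong rng (λ w → *-identityˡ (F w)) ⟩
      ∑ rng F                                             ∎
      where
      open ≡-Reasoning
      expand : ∀ v → F (k * v) ≡ ∑ rng (λ w → δ (w - k * v) * F w)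
      expand v = sym (trans (∑-cong rng (λ w → δ-pick per w (k * v)))
        (trans (∑-*ʳ rng (λ w → δ (w - k * v)) (F (k * v)))
          (trans (cong (_* F (k * v)) (trans (∑-shift δ-per (- (k * v))) ∑-δ)) (*-identityˡ _))))

    ¬P∣-1 : ¬ P ∣ -1ℤ
    ¬P∣-1 d = P∤small (ℕ.s≤s ℕ.z≤n) 1<p (∣m⇒∣-m d)

    ∑-reflect : ∀ {F} → Per F → ∀ t → ∑ rng (λ v → F (t - v)) ≡ ∑ rng F
    ∑-reflect {F} per t = trans
      (∑-cong rng (λ v → cong F (lemma t v)))
      (trans (∑-scale (per-shift t per) -1ℤ ¬P∣-1) (∑-shift per t))
      where
      lemma : ∀ t v → t - v ≡ -1ℤ * v + t
      lemma = solve-∀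

    ∑-δ-pick : ∀ {F} → Per F → ∀ w → ∑ rng (λ v → δ (v - w) * F v) ≡ F w
    ∑-δ-pick {F} per w = trans (∑-cong rng (λ v → δ-pick per v w))
        (trans (∑-*ʳ rng (λ v → δ (v - w)) (F w))
          (trans (cong (_* F w) (trans (∑-shift δ-per (- w)) ∑-δ)) (*-identityˡ _)))

    -- The δ-weights at v sum to 1 over the range, so one of them is nonzero; its index is the
    -- representative.
    residue : ∀ v → ∃[ i ] (i ℕ.< p × P ∣ v - + i)
    residue v with ∑≢0⇒∃ rng (λ w → δ (w - v)) ne
      where
      ne : ∑ rng (λ w → δ (w - v)) ≢ 0ℤ
      ne eq with trans (sym (trans (∑-shift δ-per (- v)) ∑-δ)) eq
      ... | ()
    ... | w , w∈ , ne with ∈-range⁻ w∈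
    ...   | i , i<p , refl = i , i<p , ∣-diff-sym (+ i) v (δ≢0 p ne)

  -- The group ring ℤ[ℤ/p]

  module GroupRing (p : ℕ) (pr : Prime p) (h : ℕ) (p-odd : p ≡ suc (h ℕ.+ h)) where
    open Residues p pr public

    infixl 6 _⊞_
    infixl 7 _⊛_
    infix  8 ⊟_
    infix  9 _ᵒ
    infix  4 _≈_

    -- Elements of ℤ[ℤ/p] as p-periodic functions on ℤ.
    record El : Set where
      no-eta-equality
      constructor el
      field
        at  : ℤ → ℤ
        per : Per at
    open El public

    record _≈_ (f h : El) : Set where
      constructor pw
      field
        pt : ∀ v → at f v ≡ at h v
    open _≈_ public

    ≈-refl : ∀ {f} → f ≈ f
    ≈-refl = pw (λ _ → refl)

    ≈-sym : ∀ {f h} → f ≈ h → h ≈ f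
    ≈-sym e = pw (λ v → sym (pt e v))

    ≈-trans : ∀ {f h k} → f ≈ h → h ≈ k → f ≈ k
    ≈-trans e₁ e₂ = pw (λ v → trans (pt e₁ v) (pt e₂ v))

    opaque
      _⊞_ : El → El → El
      f ⊞ h = el (λ v → at f v + at h v) (λ v w d → cong₂ _+_ (per f v w d) (per h v w d))

      ⊟_ : El → El
      ⊟ f = el (λ v → - at f v) (λ v w d → cong -_ (per f v w d))

      sub-per : ∀ t {F} → Per F → Per (λ v → F (t - v))
      sub-per t per v w d = per (t - v) (t - w) (∣-resp (lemma t v w) (∣m⇒∣-m d))
        where
        lemma : ∀ t v w → - (v - w) ≡ t - v - (t - w)
        lemma = solve-∀

      *-per : ∀ {F H} → Per F → Per H → Per (λ v → F v * H v)
      *-per perF perH v w d = cong₂ _*_ (perF v w d) (perH v w d)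

      _⊛_ : El → El → El
      f ⊛ h = el (λ t → ∑ rng (λ v → at f v * at h (t - v)))
        (λ t s d → ∑-cong rng (λ v → cong (at f v *_) (per-shift (- v) (per h) t s d)))

      -- The involution ζ ↦ ζ⁻¹, which becomes complex conjugation on character values.
      _ᵒ : El → El
      f ᵒ = el (λ v → at f (- v)) (λ v w d → per f (- v) (- w) (∣-resp (lemma v w) (∣m⇒∣-m d)))
        where
        lemma : ∀ v w → - (v - w) ≡ - v - - w
        lemma = solve-∀

      [_] : ℤ → El
      [ a ] = el (λ v → δ (v - a)) (per-shift (- a) δ-per)

      κ : ℤ → El
      κ k = el (λ v → k * δ v) (λ v w d → cong (k *_) (δ-per v w d))

      𝐙 : El
      𝐙 = el (λ _ → 1ℤ) (λ _ _ _ → refl)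

      -- The augmentation, that is, the trivial character.
      τ : El → ℤ
      τ f = ∑ rng (at f)

      ⊞-cong : ∀ {f f' h h'} → f ≈ f' → h ≈ h' → f ⊞ h ≈ f' ⊞ h'
      ⊞-cong e₁ e₂ = pw (λ v → cong₂ _+_ (pt e₁ v) (pt e₂ v))

      ⊟-cong : ∀ {f f'} → f ≈ f' → ⊟ f ≈ ⊟ f'
      ⊟-cong e = pw (λ v → cong -_ (pt e v))

      ⊛-cong : ∀ {f f' h h'} → f ≈ f' → h ≈ h' → f ⊛ h ≈ f' ⊛ h'
      ⊛-cong e₁ e₂ = pw (λ t → ∑-cong rng (λ v → cong₂ _*_ (pt e₁ v) (pt e₂ (t - v))))

      ⊛-comm : ∀ f h → f ⊛ h ≈ h ⊛ f
      ⊛-comm f h = pw (λ t → trans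
        (sym (∑-reflect (*-per (per f) (sub-per t (per h))) t))
        (∑-cong rng (λ v → trans (*-comm (at f (t - v)) _) (cong (λ w → at h w * at f (t - v)) (lemma t v)))))
        where
        lemma : ∀ t v → t - (t - v) ≡ v
        lemma = solve-∀

      ⊛-assoc : ∀ f h k → (f ⊛ h) ⊛ k ≈ f ⊛ (h ⊛ k)
      ⊛-assoc f h k = pw λ t → begin
        ∑ rng (λ v → ∑ rng (λ w → at f w * at h (v - w)) * at k (t - v))
          ≡⟨ ∑-cong rng (λ v → sym (∑-*ʳ rng (λ w → at f w * at h (v - w)) (at k (t - v)))) ⟩
        ∑ rng (λ v → ∑ rng (λ w → at f w * at h (v - w) * at k (t - v)))
          ≡⟨ ∑-swap rng rng _ ⟩
        ∑ rng (λ w → ∑ rng (λ v → at f w * at h (v - w) * at k (t - v)))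
          ≡⟨ ∑-cong rng (λ w → trans (∑-cong rng (λ v → *-assoc (at f w) (at h (v - w)) (at k (t - v))))
                                     (∑-*ˡ rng (at f w) (λ v → at h (v - w) * at k (t - v)))) ⟩
        ∑ rng (λ w → at f w * ∑ rng (λ v → at h (v - w) * at k (t - v)))
          ≡⟨ ∑-cong rng (λ w → cong (at f w *_) (inner t w)) ⟩
        ∑ rng (λ w → at f w * ∑ rng (λ v → at h v * at k (t - w - v))) ∎
        where
        open ≡-Reasoning
        lemma : ∀ t w v → t - v ≡ t - w - (v - w)
        lemma = solve-∀
        inner : ∀ t w → ∑ rng (λ v → at h (v - w) * at k (t - v)) ≡ ∑ rng (λ v → at h v * at k (t - w - v))
        inner t w = trans (∑-cong rng (λ v → cong (λ x → at h (v - w) * at k x) (lemma t w v)))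
          (∑-shift (*-per (per h) (sub-per (t - w) (per k))) (- w))

      κ-scale : ∀ k f v → at (κ k ⊛ f) v ≡ k * at f v
      κ-scale k f t = begin
        ∑ rng (λ v → k * δ v * at f (t - v))        ≡⟨ ∑-cong rng (λ v → trans (*-assoc k (δ v) _)
                                                          (cong (λ x → k * (δ x * at f (t - v))) (lemma v))) ⟩
        ∑ rng (λ v → k * (δ (v - 0ℤ) * at f (t - v)))   ≡⟨ ∑-*ˡ rng k _ ⟩
        k * ∑ rng (λ v → δ (v - 0ℤ) * at f (t - v))     ≡⟨ cong (k *_) (∑-δ-pick (sub-per t (per f)) 0ℤ) ⟩
        k * at f (t - 0ℤ)                           ≡⟨ cong (λ x → k * at f x) (sym (lemma t)) ⟩
        k * at f t                                  ∎
        where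
        open ≡-Reasoning
        lemma : ∀ v → v ≡ v - 0ℤ
        lemma = solve-∀

      ⊛-identityˡ : ∀ f → κ 1ℤ ⊛ f ≈ f
      ⊛-identityˡ f = pw (λ v → trans (κ-scale 1ℤ f v) (*-identityˡ _))

      ⊛-distribˡ : ∀ f h k → f ⊛ (h ⊞ k) ≈ (f ⊛ h) ⊞ (f ⊛ k)
      ⊛-distribˡ f h k = pw (λ t → trans
        (∑-cong rng (λ v → *-distribˡ-+ (at f v) (at h (t - v)) (at k (t - v))))
        (∑-+ rng _ _))

      κ-0 : ∀ v → at (κ 0ℤ) v ≡ 0ℤ
      κ-0 v = *-zeroˡ (δ v)

      ⊞-at : ∀ f h v → at (f ⊞ h) v ≡ at f v + at h v
      ⊞-at f h v = refl

      ⊟-at : ∀ f v → at (⊟ f) v ≡ - at f v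
      ⊟-at f v = refl

      ⊛-at : ∀ f h t → at (f ⊛ h) t ≡ ∑ rng (λ v → at f v * at h (t - v))
      ⊛-at f h t = refl

      ᵒ-at : ∀ f v → at (f ᵒ) v ≡ at f (- v)
      ᵒ-at f v = refl

      []-at : ∀ a v → at [ a ] v ≡ δ (v - a)
      []-at a v = refl

      κ-at : ∀ k v → at (κ k) v ≡ k * δ v
      κ-at k v = refl

      τ-at : ∀ f → τ f ≡ ∑ rng (at f)
      τ-at f = refl

      𝐙-at : ∀ v → at 𝐙 v ≡ 1ℤ
      𝐙-at v = refl

      ⊞-assoc : ∀ f h k → (f ⊞ h) ⊞ k ≈ f ⊞ (h ⊞ k)
      ⊞-assoc f h k = pw (λ v → +-assoc (at f v) (at h v) (at k v))

      ⊞-comm : ∀ f h → f ⊞ h ≈ h ⊞ f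
      ⊞-comm f h = pw (λ v → +-comm (at f v) (at h v))

      ⊞-identityˡ : ∀ f → κ 0ℤ ⊞ f ≈ f
      ⊞-identityˡ f = pw (λ v → trans (cong (_+ at f v) (κ-0 v)) (+-identityˡ (at f v)))

      ⊞-inverseˡ : ∀ f → ⊟ f ⊞ f ≈ κ 0ℤ
      ⊞-inverseˡ f = pw (λ v → trans (+-inverseˡ (at f v)) (sym (κ-0 v)))

      κ-+ : ∀ a b → κ (a + b) ≈ κ a ⊞ κ b
      κ-+ a b = pw (λ v → *-distribʳ-+ (δ v) a b)

      κ-neg : ∀ a → κ (- a) ≈ ⊟ κ a
      κ-neg a = pw (λ v → sym (neg-distribˡ-* a (δ v)))

      κ-* : ∀ a b → κ (a * b) ≈ κ a ⊛ κ b
      κ-* a b = pw (λ v → trans (*-assoc a b (δ v)) (sym (κ-scale a (κ b) v)))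

      ᵒ-cong : ∀ {f h} → f ≈ h → f ᵒ ≈ h ᵒ
      ᵒ-cong e = pw (λ v → pt e (- v))

      ᵒ-⊛ : ∀ f h → (f ⊛ h) ᵒ ≈ f ᵒ ⊛ h ᵒ
      ᵒ-⊛ f h = pw (λ t → trans
        (sym (∑-reflect (*-per (per f) (sub-per (- t) (per h))) 0ℤ))
        (∑-cong rng (λ v → cong₂ (λ a b → at f a * at h b) (+-identityˡ (- v)) (lemma t v))))
        where
        lemma : ∀ t v → - t - (0ℤ - v) ≡ - (t - v)
        lemma = solve-∀

      ᵒ-⊞ : ∀ f h → (f ⊞ h) ᵒ ≈ f ᵒ ⊞ h ᵒ
      ᵒ-⊞ f h = ≈-refl

      ᵒ-⊟ : ∀ f → (⊟ f) ᵒ ≈ ⊟ f ᵒ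
      ᵒ-⊟ f = ≈-refl

      ᵒ-𝐙 : 𝐙 ᵒ ≈ 𝐙
      ᵒ-𝐙 = ≈-refl

      ᵒ-κ : ∀ k → κ k ᵒ ≈ κ k
      ᵒ-κ k = pw (λ v → cong (k *_) (δ-neg v))

      ᵒ-[] : ∀ a → [ a ] ᵒ ≈ [ - a ]
      ᵒ-[] a = pw (λ v → trans (sym (δ-neg (- v - a))) (cong δ (lemma v a)))
        where
        lemma : ∀ v a → - (- v - a) ≡ v - - a
        lemma = solve-∀

      ᵒᵒ : ∀ f → f ᵒ ᵒ ≈ f
      ᵒᵒ f = pw (λ v → cong (at f) (neg-involutive v))

      []-⊛ : ∀ a f v → at ([ a ] ⊛ f) v ≡ at f (v - a)
      []-⊛ a f t = ∑-δ-pick (sub-per t (per f)) a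

      []-+ : ∀ a b → [ a ] ⊛ [ b ] ≈ [ a + b ]
      []-+ a b = pw (λ v → trans ([]-⊛ a [ b ] v) (cong δ (lemma v a b)))
        where
        lemma : ∀ v a b → v - a - b ≡ v - (a + b)
        lemma = solve-∀

      [0] : [ 0ℤ ] ≈ κ 1ℤ
      [0] = pw (λ v → trans (cong δ (+-identityʳ v)) (sym (*-identityˡ _)))

      []-cong : ∀ {a b} → P ∣ a - b → [ a ] ≈ [ b ]
      []-cong {a} {b} d = pw (λ v → sub-per v δ-per a b d)

      τ-cong : ∀ {f h} → f ≈ h → τ f ≡ τ h
      τ-cong e = ∑-cong rng (pt e)

      τ-⊞ : ∀ f h → τ (f ⊞ h) ≡ τ f + τ h
      τ-⊞ f h = ∑-+ rng (at f) (at h)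

      τ-⊟ : ∀ f → τ (⊟ f) ≡ - τ f
      τ-⊟ f = ∑-neg rng (at f)

      τ-⊛ : ∀ f h → τ (f ⊛ h) ≡ τ f * τ h
      τ-⊛ f h = begin
        ∑ rng (λ t → ∑ rng (λ v → at f v * at h (t - v)))   ≡⟨ ∑-swap rng rng _ ⟩
        ∑ rng (λ v → ∑ rng (λ t → at f v * at h (t - v)))   ≡⟨ ∑-cong rng (λ v → ∑-*ˡ rng (at f v) (λ t → at h (t - v))) ⟩
        ∑ rng (λ v → at f v * ∑ rng (λ t → at h (t - v)))   ≡⟨ ∑-cong rng (λ v → cong (at f v *_) (∑-shift (per h) (- v))) ⟩
        ∑ rng (λ v → at f v * τ h)                          ≡⟨ ∑-*ʳ rng (at f) (τ h) ⟩
        τ f * τ h                                           ∎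
        where open ≡-Reasoning

      τ-ᵒ : ∀ f → τ (f ᵒ) ≡ τ f
      τ-ᵒ f = trans (∑-cong rng (λ v → cong (at f) (sym (+-identityˡ (- v))))) (∑-reflect (per f) 0ℤ)

      τ-κ : ∀ k → τ (κ k) ≡ k
      τ-κ k = trans (∑-*ˡ rng k δ) (trans (cong (k *_) ∑-δ) (*-identityʳ k))

      τ-[] : ∀ a → τ [ a ] ≡ 1ℤ
      τ-[] a = trans (∑-shift δ-per (- a)) ∑-δ

      τ-𝐙 : τ 𝐙 ≡ P
      τ-𝐙 = trans (∑-const p 1ℤ) (*-identityʳ P)

      -- The ring acts on 𝐙 through the augmentation. Hence every multiple of 𝐙 is an integer
      -- multiple, and computing modulo 𝐙 only requires keeping track of one integer.
      ⊛-𝐙 : ∀ f → f ⊛ 𝐙 ≈ κ (τ f) ⊛ 𝐙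
      ⊛-𝐙 f = pw (λ v → trans (∑-*ʳ rng (at f) 1ℤ) (sym (κ-scale (τ f) 𝐙 v)))

      cst-at : ∀ k v → at (κ k ⊛ 𝐙) v ≡ k
      cst-at k v = trans (κ-scale k 𝐙 v) (*-identityʳ k)

      -- This is what turns a norm equation into a bound for the coefficients.
      norm-at-0 : ∀ f → at (f ⊛ f ᵒ) 0ℤ ≡ ∑ rng (λ v → at f v * at f v)
      norm-at-0 f = ∑-cong rng (λ v → cong (λ w → at f v * at f w) (lemma v))
        where
        lemma : ∀ v → - (0ℤ - v) ≡ v
        lemma = solve-∀

    groupRing : CommutativeRing 0ℓ 0ℓ
    groupRing = record
      { Carrier = El ; _≈_ = _≈_ ; _+_ = _⊞_ ; _*_ = _⊛_ ; -_ = ⊟_ ; 0# = κ 0ℤ ; 1# = κ 1ℤ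
      ; isCommutativeRing = record
        { isRing = record
          { +-isAbelianGroup = record
            { isGroup = record
              { isMonoid = record
                { isSemigroup = record
                  { isMagma = record
                    { isEquivalence = record { refl = ≈-refl ; sym = ≈-sym ; trans = ≈-trans }
                    ; ∙-cong = ⊞-cong }
                  ; assoc = ⊞-assoc }
                ; identity = ⊞-identityˡ , (λ f → ≈-trans (⊞-comm f (κ 0ℤ)) (⊞-identityˡ f)) }
              ; inverse = ⊞-inverseˡ , (λ f → ≈-trans (⊞-comm f (⊟ f)) (⊞-inverseˡ f))
              ; ⁻¹-cong = ⊟-cong }
            ; comm = ⊞-comm }
          ; *-cong = ⊛-cong
          ; *-assoc = ⊛-assoc
          ; *-identity = ⊛-identityˡ , (λ f → ≈-trans (⊛-comm f (κ 1ℤ)) (⊛-identityˡ f))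
          ; distrib = ⊛-distribˡ , λ f h k → ≈-trans (⊛-comm (h ⊞ k) f)
              (≈-trans (⊛-distribˡ f h k) (⊞-cong (⊛-comm f h) (⊛-comm f k)))
          }
        ; *-comm = ⊛-comm } }

    κ-cong : ∀ {a b} → a ≡ b → κ a ≈ κ b
    κ-cong refl = ≈-refl

    private
      ring : ACR.AlmostCommutativeRing 0ℓ 0ℓ
      ring = ACR.fromCommutativeRing groupRing

      embedding : ACR._-Raw-AlmostCommutative⟶_ (CommutativeRing.rawRing +-*-commutativeRing) ring
      embedding = record
        { ⟦_⟧ = κ ; +-homo = κ-+ ; *-homo = κ-* ; -‿homo = κ-neg ; 0-homo = ≈-refl ; 1-homo = ≈-refl }

      κ≟ : ∀ a b → Maybe (κ a ≈ κ b)
      κ≟ a b = Maybe.map κ-cong (dec⇒maybe (a ≟ b))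

    module S = RingSolver (CommutativeRing.rawRing +-*-commutativeRing) ring embedding κ≟

    module GR = CommutativeRing groupRing

    open S using (_:=_; _:+_; _:*_; _:-_; :-_; con)

    δ0 : δ 0ℤ ≡ 1ℤ
    δ0 = δ-∣ {0ℤ} (divides 0ℤ refl)

    -- Congruence of group ring elements modulo an integer, and finite sums of elements.

    module Congruence where

      infix 4 _≋_[_]

      record _≋_[_] (f h : El) (m : ℤ) : Set where
        constructor md
        field
          dv : ∀ v → m ∣ at f v - at h v
      open _≋_[_] public

      private variable
        m : ℤ
        f f' f'' k k' : El

      ≈⇒≋ : f ≈ f' → f ≋ f' [ m ]
      ≈⇒≋ {f} {f'} {m} e = md (λ v → divides 0ℤ (trans (cong (_- at f' v) (pt e v)) (+-inverseʳ (at f' v))))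

      ≋-sym : f ≋ f' [ m ] → f' ≋ f [ m ]
      ≋-sym {f} {f'} e = md (λ v → ∣-resp (lemma (at f v) (at f' v)) (∣m⇒∣-m (dv e v)))
        where
        lemma : ∀ a b → - (a - b) ≡ b - a
        lemma = solve-∀

      ≋-trans : f ≋ f' [ m ] → f' ≋ f'' [ m ] → f ≋ f'' [ m ]
      ≋-trans {f} {f'} {f'' = f''} e₁ e₂ =
        md (λ v → ∣-resp (lemma (at f v) (at f' v) (at f'' v)) (∣m∣n⇒∣m+n (dv e₁ v) (dv e₂ v)))
        where
        lemma : ∀ a b c → a - b + (b - c) ≡ a - c
        lemma = solve-∀

      ≋-⊞ : f ≋ f' [ m ] → k ≋ k' [ m ] → f ⊞ k ≋ f' ⊞ k' [ m ]
      ≋-⊞ {f} {f'} {k = k} {k'} e₁ e₂ = md (λ v → ∣-resp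
        (trans (lemma (at f v) (at f' v) (at k v) (at k' v)) (sym (cong₂ _-_ (⊞-at f k v) (⊞-at f' k' v))))
        (∣m∣n⇒∣m+n (dv e₁ v) (dv e₂ v)))
        where
        lemma : ∀ a b c d → a - b + (c - d) ≡ a + c - (b + d)
        lemma = solve-∀

      ≋-⊛ : f ≋ f' [ m ] → k ≋ k' [ m ] → f ⊛ k ≋ f' ⊛ k' [ m ]
      ≋-⊛ {f} {f'} {m} {k} {k'} e₁ e₂ = md (λ t → ∣-resp (eq t) (∣∑ rng (λ v →
          ∣m∣n⇒∣m+n (∣m⇒∣m*n (at k (t - v)) (dv e₁ v)) (∣n⇒∣m*n (at f' v) (dv e₂ (t - v))))))
        where
        lemma : ∀ a b c d → (a - b) * c + b * (c - d) ≡ a * c - b * d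
        lemma = solve-∀
        eq : ∀ t → ∑ rng (λ v → (at f v - at f' v) * at k (t - v) + at f' v * (at k (t - v) - at k' (t - v)))
                 ≡ at (f ⊛ k) t - at (f' ⊛ k') t
        eq t = trans (∑-cong rng (λ v → lemma (at f v) (at f' v) (at k (t - v)) (at k' (t - v))))
          (trans (∑-- rng (λ v → at f v * at k (t - v)) (λ v → at f' v * at k' (t - v)))
            (sym (cong₂ _-_ (⊛-at f k t) (⊛-at f' k' t))))

      ≋-ᵒ : f ≋ f' [ m ] → f ᵒ ≋ f' ᵒ [ m ]
      ≋-ᵒ {f} {f'} e = md (λ v → ∣-resp (sym (cong₂ _-_ (ᵒ-at f v) (ᵒ-at f' v))) (dv e (- v)))

      ≋-lift : m ≢ 0ℤ → f ≋ f' [ m ] → ∃[ K ] f ≈ f' ⊞ κ m ⊛ K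
      ≋-lift {m} {f} {f'} m≢0 e = K , pw eq
        where
        q : ℤ → ℤ
        q v = quotient (dv e v)
        -- The quotients come from separate divisibility proofs at every v; that they form a
        -- periodic function follows by cancelling m.
        q-per : Per q
        q-per v w d = *-cancelˡ m m≢0 (begin
          m * q v            ≡⟨ *-comm m (q v) ⟩
          q v * m            ≡⟨ sym (_∣_.equality (dv e v)) ⟩
          at f v - at f' v   ≡⟨ cong₂ _-_ (per f v w d) (per f' v w d) ⟩
          at f w - at f' w   ≡⟨ _∣_.equality (dv e w) ⟩
          q w * m            ≡⟨ *-comm (q w) m ⟩
          m * q w            ∎)
          where open ≡-Reasoning
        K : El
        K = el q q-per
        lemma : ∀ a b c → a - b ≡ c → a ≡ b + c
        lemma a b _ refl = l a b
          where
          l : ∀ a b → a ≡ b + (a - b)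
          l = solve-∀
        eq : ∀ v → at f v ≡ at (f' ⊞ κ m ⊛ K) v
        eq v = trans (lemma (at f v) (at f' v) _ (trans (_∣_.equality (dv e v)) (*-comm (q v) m)))
          (sym (trans (⊞-at f' (κ m ⊛ K) v) (cong (_+_ (at f' v)) (κ-scale m K v))))

      ≋-multiple : ∀ f K → f ⊞ κ m ⊛ K ≋ f [ m ]
      ≋-multiple {m} f K = md (λ v → divides (at K v)
        (trans (cong (_- at f v) (trans (⊞-at f (κ m ⊛ K) v) (cong (_+_ (at f v)) (κ-scale m K v))))
          (lemma (at f v) m (at K v))))
        where
        lemma : ∀ a m k → a + m * k - a ≡ k * m
        lemma = solve-∀

      const⇒ : ∀ f → (∀ v → at f v ≡ at f 0ℤ) → f ≈ κ (at f 0ℤ) ⊛ 𝐙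
      const⇒ f c = pw (λ v → trans (c v) (sym (cst-at (at f 0ℤ) v)))

      ⊞∑ : {A : Set} → List A → (A → El) → El
      ⊞∑ []       F = κ 0ℤ
      ⊞∑ (x ∷ xs) F = F x ⊞ ⊞∑ xs F

      ⊞∑-at : ∀ {A : Set} (xs : List A) F v → at (⊞∑ xs F) v ≡ ∑ xs (λ x → at (F x) v)
      ⊞∑-at []       F v = κ-0 v
      ⊞∑-at (x ∷ xs) F v = trans (⊞-at (F x) (⊞∑ xs F) v) (cong (_+_ (at (F x) v)) (⊞∑-at xs F v))

      ⊞∑-cong : ∀ {A : Set} (xs : List A) {F H : A → El} → (∀ x → F x ≈ H x) → ⊞∑ xs F ≈ ⊞∑ xs H
      ⊞∑-cong []       e = ≈-refl
      ⊞∑-cong (x ∷ xs) e = ⊞-cong (e x) (⊞∑-cong xs e)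

      ⊛-⊞∑ : ∀ {A : Set} f (xs : List A) F → f ⊛ ⊞∑ xs F ≈ ⊞∑ xs (λ x → f ⊛ F x)
      ⊛-⊞∑ f []       F = S.solve 1 (λ f → f S.:* S.con 0ℤ S.:= S.con 0ℤ) ≈-refl f
      ⊛-⊞∑ f (x ∷ xs) F = ≈-trans (⊛-distribˡ f (F x) (⊞∑ xs F)) (⊞-cong ≈-refl (⊛-⊞∑ f xs F))

      ⊞∑-⊛-⊞∑ : ∀ {A B : Set} (xs : List A) (ys : List B) F H →
        ⊞∑ xs F ⊛ ⊞∑ ys H ≈ ⊞∑ xs (λ x → ⊞∑ ys (λ y → F x ⊛ H y))
      ⊞∑-⊛-⊞∑ xs ys F H = ≈-trans (⊛-comm (⊞∑ xs F) (⊞∑ ys H)) (≈-trans (⊛-⊞∑ (⊞∑ ys H) xs F)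
        (⊞∑-cong xs (λ x → ≈-trans (⊛-comm (⊞∑ ys H) (F x)) (⊛-⊞∑ (F x) ys H))))

      ᵒ-⊞∑ : ∀ {A : Set} (xs : List A) F → (⊞∑ xs F) ᵒ ≈ ⊞∑ xs (λ x → F x ᵒ)
      ᵒ-⊞∑ []       F = ᵒ-κ 0ℤ
      ᵒ-⊞∑ (x ∷ xs) F = ≈-trans (ᵒ-⊞ (F x) (⊞∑ xs F)) (⊞-cong ≈-refl (ᵒ-⊞∑ xs F))

      -- Identities modulo 𝐙 are checked after multiplication by p, p² or another nonzero integer;
      -- this removes the factor again.
      div-const : ∀ {m s f} → m ≢ 0ℤ → κ m ⊛ f ≈ κ s ⊛ 𝐙 → f ≈ κ (at f 0ℤ) ⊛ 𝐙
      div-const {m} {s} {f} m≢0 e = const⇒ f (λ v → *-cancelˡ m m≢0 (trans (val v) (sym (val 0ℤ))))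
        where
        val : ∀ v → m * at f v ≡ s
        val v = trans (sym (κ-scale m f v)) (trans (pt e v) (cst-at s v))

    open Congruence public

    -- The augmentation ideal modulo p

    open Exp GR.semiring using (_^_; ^-homo-*; ^-congˡ)
    open CExp GR.commutativeSemiring using (^-distrib-*)

    d : El
    d = [ 1ℤ ] ⊞ ⊟ κ 1ℤ

    d-⊛ : ∀ f v → at (d ⊛ f) v ≡ at f (v - 1ℤ) - at f v
    d-⊛ f v = begin
      at (d ⊛ f) v                             ≡⟨ pt (S.solve 2 (λ x f → (x :- con 1ℤ) :* f := x :* f :- f) ≈-refl [ 1ℤ ] f) v ⟩
      at ([ 1ℤ ] ⊛ f ⊞ ⊟ f) v                  ≡⟨ ⊞-at _ _ v ⟩
      at ([ 1ℤ ] ⊛ f) v + at (⊟ f) v           ≡⟨ cong₂ _+_ ([]-⊛ 1ℤ f v) (⊟-at f v) ⟩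
      at f (v - 1ℤ) - at f v                   ∎
      where open ≡-Reasoning

    d⊛𝐙 : d ⊛ 𝐙 ≈ κ 0ℤ
    d⊛𝐙 = pw (λ v → trans (d-⊛ 𝐙 v) (trans (cong₂ _-_ (𝐙-at (v - 1ℤ)) (𝐙-at v)) (sym (κ-0 v))))

    opaque
      []-aug : ∀ n → ∃[ q ] [ + n ] ≈ κ 1ℤ ⊞ d ⊛ q
      []-aug zero    = κ 0ℤ , ≈-trans [0] (S.solve 1 (λ d → con 1ℤ := con 1ℤ :+ d :* con 0ℤ) ≈-refl d)
      []-aug (suc n) with []-aug n
      ... | q , eq = κ 1ℤ ⊞ q ⊞ d ⊛ q , ≈-trans (≈-sym ([]-+ 1ℤ (+ n))) (≈-trans (⊛-cong ≈-refl eq)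
        (S.solve 2 (λ x q → x :* (con 1ℤ :+ (x :- con 1ℤ) :* q)
           := con 1ℤ :+ (x :- con 1ℤ) :* (con 1ℤ :+ q :+ (x :- con 1ℤ) :* q)) ≈-refl [ 1ℤ ] q))

    opaque
      aug-list : ∀ f n → ∃[ q ] ⊞∑ (range n) (λ w → κ (at f w) ⊛ [ w ]) ≈ κ (∑ (range n) (at f)) ⊞ d ⊛ q
      aug-list f zero    = κ 0ℤ , S.solve 1 (λ d → con 0ℤ := con 0ℤ :+ d :* con 0ℤ) ≈-refl d
      aug-list f (suc n) with aug-list f n | []-aug n
      ... | q , eq | r , eq' = κ (at f (+ n)) ⊛ r ⊞ q , ≈-trans (⊞-cong (⊛-cong ≈-refl eq') eq)
        (≈-trans (S.solve 5 (λ d c s r q → c :* (con 1ℤ :+ d :* r) :+ (s :+ d :* q)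
                    := (c :+ s) :+ d :* (c :* r :+ q)) ≈-refl d (κ (at f (+ n))) (κ (∑ (range n) (at f))) r q)
          (⊞-cong (≈-sym (κ-+ (at f (+ n)) _)) ≈-refl))

    expand : ∀ f → f ≈ ⊞∑ rng (λ w → κ (at f w) ⊛ [ w ])
    expand f = pw (λ v → sym (trans (⊞∑-at rng _ v) (trans
      (∑-cong rng (λ w → trans (κ-scale (at f w) [ w ] v) (trans (*-comm (at f w) _)
         (cong (_* at f w) (trans ([]-at w v) (trans (sym (δ-neg (v - w))) (cong δ (lemma v w))))))))
      (∑-δ-pick (per f) v))))
      where
      lemma : ∀ v w → - (v - w) ≡ w - v
      lemma = solve-∀

    opaque
      -- f - τ f is the sum of the f(w)(ζ^w - 1), and ζ^w - 1 is a multiple of ζ - 1: over ℤ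
      -- already, the augmentation ideal is principal.
      aug : ∀ f → ∃[ q ] f ≈ κ (τ f) ⊞ d ⊛ q
      aug f with aug-list f p
      ... | q , eq = q , ≈-trans (expand f) (≈-trans eq (⊞-cong (κ-cong (sym τ-eq)) ≈-refl))
        where
        τ-eq : τ f ≡ ∑ rng (at f)
        τ-eq = τ-at f

    -- For k < p the polynomial (ζ-1)^k does not wrap around, so its leading coefficient 1 stays
    -- visible. In particular no such power vanishes modulo p.
    d^-top : ∀ k → k ℕ.< p → at (d ^ k) (+ k) ≡ 1ℤ × (∀ v → k ℕ.< v → v ℕ.< p → at (d ^ k) (+ v) ≡ 0ℤ)
    d^-top zero    0<p = trans (κ-at 1ℤ 0ℤ) (cong (1ℤ *_) δ0) ,
      λ v 0<v v<p → trans (κ-at 1ℤ (+ v)) (cong (1ℤ *_) (δ-∤ (P∤small 0<v v<p)))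
    d^-top (suc k) k<p with d^-top k (ℕₚ.<-trans ℕₚ.≤-refl k<p)
    ... | one , zeros =
        trans (d-⊛ (d ^ k) (+ suc k)) (cong₂ _-_ (trans (cong (at (d ^ k)) (lemma (+ k))) one) (zeros (suc k) ℕₚ.≤-refl k<p))
      , λ { (suc v) (ℕ.s≤s k<v) v<p → trans (d-⊛ (d ^ k) (+ suc v))
              (cong₂ _-_ (trans (cong (at (d ^ k)) (lemma (+ v))) (zeros v k<v (ℕₚ.<-trans ℕₚ.≤-refl v<p)))
                         (zeros (suc v) (ℕₚ.m≤n⇒m≤1+n k<v) v<p)) }
      where
      lemma : ∀ k → 1ℤ + k - 1ℤ ≡ k
      lemma = solve-∀

    []^ : ∀ n → [ 1ℤ ] ^ n ≈ [ + n ]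
    []^ zero    = ≈-sym [0]
    []^ (suc n) = ≈-trans (⊛-cong ≈-refl ([]^ n)) ([]-+ 1ℤ (+ n))

    neg^-odd : ∀ n → (⊟ κ 1ℤ) ^ suc (n ℕ.+ n) ≈ ⊟ κ 1ℤ
    neg^-odd zero    = S.solve 0 ((:- con 1ℤ) :* con 1ℤ := :- con 1ℤ) ≈-refl
    neg^-odd (suc n) rewrite ℕₚ.+-suc n n = ≈-trans (⊛-cong ≈-refl (⊛-cong ≈-refl (neg^-odd n)))
      (S.solve 0 ((:- con 1ℤ) :* ((:- con 1ℤ) :* (:- con 1ℤ)) := :- con 1ℤ) ≈-refl)

    ×-at : ∀ n f v → at (Mult._×_ GR.semiring n f) v ≡ + n * at f v
    ×-at zero    f v = trans (κ-0 v) (sym (*-zeroˡ (at f v)))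
    ×-at (suc n) f v = trans (⊞-at f _ v) (trans (cong (_+_ (at f v)) (×-at n f v)) (lemma (at f v) (+ n)))
      where
      lemma : ∀ a n → a + n * a ≡ (1ℤ + n) * a
      lemma = solve-∀

    sum≋0 : ∀ {n} (t : Fin n → El) → (∀ i → t i ≋ κ 0ℤ [ P ]) → Σ.sum GR.semiring t ≋ κ 0ℤ [ P ]
    sum≋0 {zero}  t z = ≈⇒≋ ≈-refl
    sum≋0 {suc n} t z = ≋-trans (≋-⊞ (z Fin.zero) (sum≋0 (λ i → t (Fin.suc i)) (λ i → z (Fin.suc i))))
      (≈⇒≋ (S.solve 0 (con 0ℤ :+ con 0ℤ := con 0ℤ) ≈-refl))

    -- The inner binomial coefficients are divisible by p, and the two outer terms are ζ^p = 1 and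
    -- (-1)^p = -1, since p is odd.
    d^p : d ^ p ≋ κ 0ℤ [ P ]
    d^p = ≋-trans (≈⇒≋ (B.theorem p [ 1ℤ ] (⊟ κ 1ℤ))) (expansion p refl)
      where
      module B = Binomial GR.commutativeSemiring
      expansion : ∀ n → n ≡ p → B.binomialExpansion [ 1ℤ ] (⊟ κ 1ℤ) n ≋ κ 0ℤ [ P ]
      expansion zero    n≡p = contradiction (subst (0 ℕ.<_) (sym n≡p) 0<p) (λ ())
      expansion (suc n) n≡p = ≋-trans
        (≋-⊞ (≈⇒≋ ≈-refl) (≋-trans (≈⇒≋ (Σ.sum-init-last GR.semiring (λ i → term (Fin.suc i)))) (≋-⊞ (sum≋0 (λ i → term (Fin.suc (inject₁ i))) middle) (≈⇒≋ ≈-refl))))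
        (≈⇒≋ (≈-trans (⊞-cong first (⊞-cong ≈-refl last))
          (S.solve 0 ((:- con 1ℤ) :+ (con 0ℤ :+ con 1ℤ) := con 0ℤ) ≈-refl)))
        where
        term : Fin (suc (suc n)) → El
        term = B.binomialTerm [ 1ℤ ] (⊟ κ 1ℤ) (suc n)
        n≡h+h : suc n ≡ suc (h ℕ.+ h)
        n≡h+h = trans n≡p p-odd
        first : term Fin.zero ≈ ⊟ κ 1ℤ
        first = ≈-trans (S.solve 1 (λ y → con 1ℤ :* y :+ con 0ℤ := y) ≈-refl ((⊟ κ 1ℤ) ^ suc n))
          (subst (λ m → (⊟ κ 1ℤ) ^ m ≈ ⊟ κ 1ℤ) (sym n≡h+h) (neg^-odd h))
        middle : ∀ i → term (Fin.suc (inject₁ i)) ≋ κ 0ℤ [ P ]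
        middle i = md (λ v → ∣-resp (sym (trans (cong₂ _-_ (×-at (suc n choose suc k) b v) (κ-0 v)) (+-identityʳ (+ (suc n choose suc k) * at b v))))
            (∣m⇒∣m*n (at b v) (∣ᵤ⇒∣ {P} {+ (suc n choose suc k)} p∣C)))
          where
          k = toℕ (inject₁ i)
          b = B.binomial [ 1ℤ ] (⊟ κ 1ℤ) (suc n) (Fin.suc (inject₁ i))
          p∣C : p ℕ∣.∣ suc n choose suc k
          p∣C = subst (λ m → m ℕ∣.∣ suc n choose suc k) n≡p (prime∣C (subst Prime (sym n≡p) pr) (suc k) (ℕ.s≤s ℕ.z≤n)
            (ℕ.s≤s (subst (ℕ._< n) (sym (Finₚ.toℕ-inject₁ i)) (Finₚ.toℕ<n i))))
        last : term (Fin.suc (fromℕ n)) ≈ κ 1ℤ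
        last rewrite Finₚ.toℕ-fromℕ n | nCn≡1 (suc n) | ℕₚ.n∸n≡0 n =
          ≈-trans (S.solve 1 (λ y → y :* con 1ℤ :+ con 0ℤ := y) ≈-refl ([ 1ℤ ] ^ suc n))
            (≈-trans ([]^ (suc n)) (≈-trans ([]-cong (divides 1ℤ (trans (cong (λ m → + m - 0ℤ) n≡p) (lemma P)))) [0]))
          where
          lemma : ∀ P → P - 0ℤ ≡ 1ℤ * P
          lemma = solve-∀

    ᵒ-^ : ∀ f k → (f ^ k) ᵒ ≈ (f ᵒ) ^ k
    ᵒ-^ f zero    = ᵒ-κ 1ℤ
    ᵒ-^ f (suc k) = ≈-trans (ᵒ-⊛ f (f ^ k)) (⊛-cong ≈-refl (ᵒ-^ f k))

    h+h<p : h ℕ.+ h ℕ.< p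
    h+h<p = ℕₚ.≤-reflexive (sym p-odd)

    -- X - τ X is a multiple of d, and one more factor d makes d^(p-1) vanish modulo p; here h+h =
    -- p-1.
    d^-reduce : ∀ X → d ^ (h ℕ.+ h) ⊛ X ≋ κ (τ X) ⊛ d ^ (h ℕ.+ h) [ P ]
    d^-reduce X with aug X
    ... | r , eq = ≋-trans (≈⇒≋ (≈-trans (⊛-cong ≈-refl eq)
        (S.solve 4 (λ d e t r → e :* (t :+ d :* r) := t :* e :+ d :* e :* r) ≈-refl d (d ^ (h ℕ.+ h)) (κ (τ X)) r)))
      (≋-trans (≋-⊞ (≈⇒≋ ≈-refl) (≋-⊛ (subst (λ n → d ^ n ≋ κ 0ℤ [ P ]) p-odd d^p) (≈⇒≋ ≈-refl)))
        (≈⇒≋ (S.solve 2 (λ x r → x :+ con 0ℤ :* r := x) ≈-refl (κ (τ X) ⊛ d ^ (h ℕ.+ h)) r)))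

    -- The unit -ζ by which d differs from its conjugate ζ⁻¹ - 1. It trades powers of the conjugate
    -- for powers of d.
    ϖ : El
    ϖ = ⊟ [ 1ℤ ]

    ϖ⊛dᵒ : ϖ ⊛ d ᵒ ≈ d
    ϖ⊛dᵒ = ≈-trans (⊛-cong ≈-refl (≈-trans (ᵒ-⊞ [ 1ℤ ] (⊟ κ 1ℤ))
        (⊞-cong (ᵒ-[] 1ℤ) (≈-trans (ᵒ-⊟ (κ 1ℤ)) (⊟-cong (ᵒ-κ 1ℤ))))))
      (≈-trans (S.solve 2 (λ x y → (:- x) :* (y :- con 1ℤ) := x :- x :* y) ≈-refl [ 1ℤ ] [ -1ℤ ])
        (⊞-cong ≈-refl (⊟-cong (≈-trans ([]-+ 1ℤ -1ℤ) [0]))))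

    -- If p ∤ τ A', multiplying d^{2k} A' A'ᵒ by d^{p-1-2k} gives a nonzero multiple of d^{p-1}
    -- on one side and c 𝐙 d^{p-1-2k} = 0 on the other.
    valuation : ∀ A c → A ⊛ A ᵒ ≋ κ c ⊛ 𝐙 [ P ] → ∀ k → k ℕ.≤ h → ∃[ A' ] A ≋ d ^ k ⊛ A' [ P ]
    valuation A c AA zero    k≤h = A , ≈⇒≋ (≈-sym (⊛-identityˡ A))
    valuation A c AA (suc k) k<h with valuation A c AA k (ℕₚ.<⇒≤ k<h)
    ... | A' , eq with aug A'
    ...   | r , eq' = r , ≋-trans eq (≋-trans (≋-⊛ (≈⇒≋ ≈-refl) A'≋)
                        (≈⇒≋ (S.solve 3 (λ e d r → e :* (d :* r) := d :* e :* r) ≈-refl (d ^ k) d r)))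
      where
      -- The missing exponent p-1-2k is `suc e'`; it is positive because k < h, and the factor d it
      -- provides annihilates 𝐙.
      e' = h ℕ.+ h ℕ.∸ suc (k ℕ.+ k)
      e-eq : suc e' ℕ.+ (k ℕ.+ k) ≡ h ℕ.+ h
      e-eq = trans (sym (ℕₚ.+-suc e' (k ℕ.+ k))) (ℕₚ.m∸n+n≡m (ℕₚ.+-mono-<-≤ k<h (ℕₚ.<⇒≤ k<h)))
      X : El
      X = ϖ ^ k ⊛ d ^ suc e' ⊛ (A ⊛ A ᵒ)
      X≋0 : X ≋ κ 0ℤ [ P ]
      X≋0 = ≋-trans (≋-⊛ (≈⇒≋ ≈-refl) AA) (≈⇒≋ (≈-trans
        (S.solve 5 (λ ϖ d e c z → ϖ :* (d :* e) :* (c :* z) := ϖ :* e :* c :* (d :* z)) ≈-refl (ϖ ^ k) d (d ^ e') (κ c) 𝐙)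
        (≈-trans (⊛-cong ≈-refl d⊛𝐙) (S.solve 1 (λ x → x :* con 0ℤ := con 0ℤ) ≈-refl _))))
      powers : ϖ ^ k ⊛ d ^ suc e' ⊛ (d ^ k ⊛ (d ᵒ) ^ k) ≈ d ^ (h ℕ.+ h)
      powers = ≈-trans
        (S.solve 4 (λ ϖ e dk dk' → ϖ :* e :* (dk :* dk') := e :* (dk :* (ϖ :* dk'))) ≈-refl (ϖ ^ k) (d ^ suc e') (d ^ k) ((d ᵒ) ^ k))
        (≈-trans (⊛-cong ≈-refl (⊛-cong ≈-refl (≈-trans (≈-sym (^-distrib-* ϖ (d ᵒ) k)) (^-congˡ k ϖ⊛dᵒ))))
          (≈-trans (⊛-cong ≈-refl (≈-sym (^-homo-* d k k)))
            (≈-trans (≈-sym (^-homo-* d (suc e') (k ℕ.+ k))) (subst (λ n → d ^ (suc e' ℕ.+ (k ℕ.+ k)) ≈ d ^ n) e-eq ≈-refl))))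
      X≋d : X ≋ κ (τ (A' ⊛ A' ᵒ)) ⊛ d ^ (h ℕ.+ h) [ P ]
      X≋d = ≋-trans (≋-⊛ (≈⇒≋ ≈-refl) (≋-⊛ eq (≋-ᵒ eq)))
        (≋-trans (≈⇒≋ (≈-trans (⊛-cong ≈-refl (⊛-cong ≈-refl (≈-trans (ᵒ-⊛ (d ^ k) A') (⊛-cong (ᵒ-^ d k) ≈-refl))))
          (≈-trans (S.solve 6 (λ ϖ e dk dk' a b → ϖ :* e :* ((dk :* a) :* (dk' :* b)) := ϖ :* e :* (dk :* dk') :* (a :* b)) ≈-refl
            (ϖ ^ k) (d ^ suc e') (d ^ k) ((d ᵒ) ^ k) A' (A' ᵒ)) (⊛-cong powers ≈-refl))))
          (d^-reduce (A' ⊛ A' ᵒ)))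
      -- Read off at ζ^(p-1), where d^(p-1) has coefficient 1, the two evaluations of X give τ(A')²
      -- ≡ 0 (mod p).
      P∣τ : P ∣ τ A'
      P∣τ = euclid-square (τ A') (∣-resp
        (trans (cong₂ _-_ (trans (κ-scale (τ (A' ⊛ A' ᵒ)) (d ^ (h ℕ.+ h)) (+ (h ℕ.+ h)))
            (cong (τ (A' ⊛ A' ᵒ) *_) (proj₁ (d^-top (h ℕ.+ h) h+h<p)))) (κ-0 (+ (h ℕ.+ h))))
          (trans (lemma (τ (A' ⊛ A' ᵒ))) (trans (τ-⊛ A' (A' ᵒ)) (cong (τ A' *_) (τ-ᵒ A')))))
        (dv (≋-trans (≋-sym X≋d) X≋0) (+ (h ℕ.+ h))))
        where
        lemma : ∀ x → x * 1ℤ - 0ℤ ≡ x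
        lemma = solve-∀
      A'≋ : A' ≋ d ⊛ r [ P ]
      A'≋ = ≋-trans (≈⇒≋ eq') (≋-trans (≋-⊞ (md λ v → ∣-resp (sym (trans (cong₂ _-_ (κ-at (τ A') v) (κ-0 v)) (+-identityʳ _)))
          (∣m⇒∣m*n (δ v) P∣τ)) (≈⇒≋ ≈-refl)) (≈⇒≋ (S.solve 1 (λ x → con 0ℤ :+ x := x) ≈-refl (d ⊛ r))))

    -- d · d^(p-1) ≡ 0 (mod p) says that d^(p-1) is invariant under the shift by 1 modulo p, so all
    -- its coefficients agree modulo p.
    d^-const : ∃[ c ] d ^ (h ℕ.+ h) ≋ κ c ⊛ 𝐙 [ P ]
    d^-const = at D 0ℤ , md (λ v → ∣-resp (cong (_-_ (at D v)) (sym (cst-at (at D 0ℤ) v))) (all v))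
      where
      D = d ^ (h ℕ.+ h)
      step : ∀ v → P ∣ at D (v - 1ℤ) - at D v
      step v = ∣-resp (trans (cong₂ _-_ (d-⊛ D v) (κ-0 v)) (+-identityʳ _))
        (dv (subst (λ n → d ^ n ≋ κ 0ℤ [ P ]) p-odd d^p) v)
      nat : ∀ i → P ∣ at D (+ i) - at D 0ℤ
      nat zero    = divides 0ℤ (+-inverseʳ (at D 0ℤ))
      nat (suc i) = ∣-resp (lemma (at D (+ i)) (at D (+ suc i)) (at D 0ℤ)) (∣m∣n⇒∣m-n (nat i) (∣-resp (cong (λ x → at D x - at D (+ suc i)) (back (+ i))) (step (+ suc i))))
        where
        lemma : ∀ a b c → a - c - (a - b) ≡ b - c
        lemma = solve-∀
        back : ∀ i → 1ℤ + i - 1ℤ ≡ i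
        back = solve-∀
      all : ∀ v → P ∣ at D v - at D 0ℤ
      all v = go (residue v)
        where
        go : ∃[ i ] (i ℕ.< p × P ∣ v - + i) → P ∣ at D v - at D 0ℤ
        go (i , _ , e) = ∣-resp (cong (_- at D 0ℤ) (sym (per D v (+ i) e))) (nat i)

    -- Each factor contributes (p-1)/2 powers of d, and d^(p-1) times anything is a multiple of 𝐙
    -- modulo p. This replaces comparing ideals above the totally ramified prime p.
    product-const : ∀ A G c c' → A ⊛ A ᵒ ≋ κ c ⊛ 𝐙 [ P ] → G ⊛ G ᵒ ≋ κ c' ⊛ 𝐙 [ P ] →
      ∃[ B ] ∃[ s ] A ⊛ G ≈ κ s ⊛ 𝐙 ⊞ κ P ⊛ B
    product-const A G c c' AA GG =
      go (valuation A c AA h ℕₚ.≤-refl) (valuation G c' GG h ℕₚ.≤-refl) d^-const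
      where
      go : ∃[ A' ] A ≋ d ^ h ⊛ A' [ P ] → ∃[ G' ] G ≋ d ^ h ⊛ G' [ P ] → ∃[ s ] d ^ (h ℕ.+ h) ≋ κ s ⊛ 𝐙 [ P ] →
           ∃[ B ] ∃[ s ] A ⊛ G ≈ κ s ⊛ 𝐙 ⊞ κ P ⊛ B
      go (A' , eA) (G' , eG) (s , es) = proj₁ lifted , τ (A' ⊛ G') * s , proj₂ lifted
        where
        congruent : A ⊛ G ≋ κ (τ (A' ⊛ G') * s) ⊛ 𝐙 [ P ]
        congruent = ≋-trans (≋-⊛ eA eG) (≋-trans (≈⇒≋ (≈-trans
            (S.solve 3 (λ e a g → (e :* a) :* (e :* g) := e :* e :* (a :* g)) ≈-refl (d ^ h) A' G')
            (⊛-cong (≈-sym (^-homo-* d h h)) ≈-refl)))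
          (≋-trans (d^-reduce (A' ⊛ G')) (≋-trans (≋-⊛ (≈⇒≋ ≈-refl) es) (≈⇒≋ (≈-trans
            (≈-sym (⊛-assoc (κ (τ (A' ⊛ G'))) (κ s) 𝐙)) (⊛-cong (≈-sym (κ-* (τ (A' ⊛ G')) s)) ≈-refl))))))
        lifted : ∃[ B ] A ⊛ G ≈ κ (τ (A' ⊛ G') * s) ⊛ 𝐙 ⊞ κ P ⊛ B
        lifted = ≋-lift P≢0 congruent

    -- The quadratic Gauss sum

    2<p : 2 ℕ.< p
    2<p = ℕₚ.≤∧≢⇒< 1<p (λ eq → odd≢2 h (trans eq p-odd))
      where
      odd≢2 : ∀ h → 2 ≢ suc (h ℕ.+ h)
      odd≢2 (suc h) eq with trans eq (cong suc (cong suc (ℕₚ.+-suc h h)))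
      ... | ()

    ¬P∣2 : ¬ P ∣ + 2
    ¬P∣2 = P∤small (ℕ.s≤s ℕ.z≤n) 2<p

    P∣2* : ∀ x → P ∣ + 2 * x → P ∣ x
    P∣2* x e with euclid (+ 2) x e
    ... | inj₁ e' = contradiction e' ¬P∣2
    ... | inj₂ e' = e'

    g : El
    g = ⊞∑ rng (λ z → [ z * z ])

    -- The coefficient at t counts the pairs with z² - w² ≡ t. Replacing z by z+w gives z² + 2zw,
    -- which is linear in w: one solution for each z ≢ 0, and for z ≡ 0 either all w or none.
    g-norm : g ⊛ g ᵒ ≈ κ P ⊞ κ (P - 1ℤ) ⊛ 𝐙
    g-norm = ≈-trans (⊛-cong ≈-refl (ᵒ-⊞∑ rng (λ z → [ z * z ]))) (≈-trans
        (⊞∑-⊛-⊞∑ rng rng (λ z → [ z * z ]) (λ z → [ z * z ] ᵒ)) (pw count))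
      where
      term : ∀ t z w → at ([ z * z ] ⊛ [ w * w ] ᵒ) t ≡ δ (t - (z * z - w * w))
      term t z w = trans (pt (≈-trans (⊛-cong ≈-refl (ᵒ-[] (w * w))) ([]-+ (z * z) (- (w * w)))) t) ([]-at (z * z - w * w) t)
      square-per : ∀ t w → Per (λ z → δ (t - (z * z - w * w)))
      square-per t w z z' e = δ-per _ _ (∣-resp (lemma t z z' w) (∣m⇒∣m*n (- (z + z')) e))
        where
        lemma : ∀ t z z' w → (z - z') * - (z + z') ≡ t - (z * z - w * w) - (t - (z' * z' - w * w))
        lemma = solve-∀
      shifted : ∀ t z w → t - ((z + w) * (z + w) - w * w) ≡ t - z * z - + 2 * z * w
      shifted = solve-∀
      linear : ∀ t z → ∑ rng (λ w → δ (t - z * z - + 2 * z * w)) ≡ 1ℤ + δ z * (P * δ t - 1ℤ)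
      linear t z with P ∣? z
      ... | no ¬e = trans (∑-δ-linear (t - z * z) (+ 2 * z) (λ e → ¬e (P∣2* z e)))
                      (sym (trans (cong (λ x → 1ℤ + x * (P * δ t - 1ℤ)) (δ-∤ ¬e)) (cong (_+_ 1ℤ) (*-zeroˡ (P * δ t - 1ℤ)))))
      ... | yes e = trans (∑-cong rng (λ w → δ-per _ t (∣-resp (lemma₁ t z w) (∣m⇒∣m*n (- (z + + 2 * w)) e))))
                      (trans (∑-const p (δ t)) (sym (trans (cong (λ x → 1ℤ + x * (P * δ t - 1ℤ)) (δ-∣ e)) (lemma₂ (P * δ t)))))
        where
        lemma₁ : ∀ t z w → z * - (z + + 2 * w) ≡ t - z * z - + 2 * z * w - t
        lemma₁ = solve-∀
        lemma₂ : ∀ x → 1ℤ + 1ℤ * (x - 1ℤ) ≡ x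
        lemma₂ = solve-∀
      count : ∀ t → at (⊞∑ rng (λ z → ⊞∑ rng (λ w → [ z * z ] ⊛ [ w * w ] ᵒ))) t ≡ at (κ P ⊞ κ (P - 1ℤ) ⊛ 𝐙) t
      count t = begin
        at (⊞∑ rng (λ z → ⊞∑ rng (λ w → [ z * z ] ⊛ [ w * w ] ᵒ))) t
          ≡⟨ trans (⊞∑-at rng _ t) (∑-cong rng (λ z → trans (⊞∑-at rng _ t) (∑-cong rng (λ w → term t z w)))) ⟩
        ∑ rng (λ z → ∑ rng (λ w → δ (t - (z * z - w * w))))
          ≡⟨ ∑-swap rng rng _ ⟩
        ∑ rng (λ w → ∑ rng (λ z → δ (t - (z * z - w * w))))
          ≡⟨ ∑-cong rng (λ w → sym (∑-shift (square-per t w) w)) ⟩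
        ∑ rng (λ w → ∑ rng (λ z → δ (t - ((z + w) * (z + w) - w * w))))
          ≡⟨ ∑-cong rng (λ w → ∑-cong rng (λ z → cong δ (shifted t z w))) ⟩
        ∑ rng (λ w → ∑ rng (λ z → δ (t - z * z - + 2 * z * w)))
          ≡⟨ ∑-swap rng rng _ ⟩
        ∑ rng (λ z → ∑ rng (λ w → δ (t - z * z - + 2 * z * w)))
          ≡⟨ ∑-cong rng (linear t) ⟩
        ∑ rng (λ z → 1ℤ + δ z * (P * δ t - 1ℤ))
          ≡⟨ ∑-+ rng (λ _ → 1ℤ) (λ z → δ z * (P * δ t - 1ℤ)) ⟩
        ∑ rng (λ _ → 1ℤ) + ∑ rng (λ z → δ z * (P * δ t - 1ℤ))
          ≡⟨ cong₂ _+_ (∑-const p 1ℤ) (trans (∑-*ʳ rng δ (P * δ t - 1ℤ)) (cong (_* (P * δ t - 1ℤ)) ∑-δ)) ⟩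
        P * 1ℤ + 1ℤ * (P * δ t - 1ℤ)
          ≡⟨ lemma P (P * δ t) ⟩
        P * δ t + (P - 1ℤ)
          ≡⟨ sym (trans (⊞-at (κ P) _ t) (cong₂ _+_ (κ-at P t) (cst-at (P - 1ℤ) t))) ⟩
        at (κ P ⊞ κ (P - 1ℤ) ⊛ 𝐙) t ∎
        where
        open ≡-Reasoning
        lemma : ∀ P x → P * 1ℤ + 1ℤ * (x - 1ℤ) ≡ x + (P - 1ℤ)
        lemma = solve-∀

    τ-g : τ g ≡ P
    τ-g = trans (trans (τ-at g) (∑-cong rng (⊞∑-at rng (λ z → [ z * z ]))))
      (trans (∑-swap rng rng (λ v z → at [ z * z ] v)) (trans (∑-cong rng (λ z → trans (sym (τ-at [ z * z ])) (τ-[] (z * z))))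
        (trans (∑-const p 1ℤ) (*-identityʳ P))))

    -- Nonzero roots come in pairs ±z, so every coefficient of g is even except the one at 0, where
    -- z = 0 stands alone.
    g-parity : g ≋ κ 1ℤ [ + 2 ]
    g-parity = md (λ v → ∣-resp (sym (cong₂ _-_ (eq v) (trans (κ-at 1ℤ v) (trans (*-identityˡ _) (cong δ (sym (+-identityʳ v)))))))
        (∑-symmetric-parity h (λ z → δ (v - z * z)) (λ z → cong (λ x → δ (v - x)) (neg-square z))))
      where
      neg-square : ∀ z → (- z) * (- z) ≡ z * z
      neg-square = solve-∀
      square-per : ∀ v → Per (λ z → δ (v - z * z))
      square-per v z z' e = δ-per _ _ (∣-resp (lemma v z z') (∣m⇒∣m*n (- (z + z')) e))
        where
        lemma : ∀ t z z' → (z - z') * - (z + z') ≡ t - z * z - (t - z' * z')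
        lemma = solve-∀
      eq : ∀ v → at g v ≡ ∑ (range (suc (h ℕ.+ h))) (λ z → δ (v - (z - + h) * (z - + h)))
      eq v = trans (trans (⊞∑-at rng _ v) (∑-cong rng (λ z → []-at (z * z) v)))
        (trans (sym (∑-shift (square-per v) (- + h))) (cong (λ n → ∑ (range n) (λ z → δ (v - (z - + h) * (z - + h)))) p-odd))

    -- Division by a Gauss sum modulo 𝐙.

    gᵒ-norm : g ᵒ ⊛ g ᵒ ᵒ ≈ κ P ⊞ κ (P - 1ℤ) ⊛ 𝐙
    gᵒ-norm = ≈-trans (≈-sym (ᵒ-⊛ g (g ᵒ))) (≈-trans (ᵒ-cong g-norm) (≈-trans (ᵒ-⊞ (κ P) _)
      (⊞-cong (ᵒ-κ P) (≈-trans (ᵒ-⊛ (κ (P - 1ℤ)) 𝐙) (⊛-cong (ᵒ-κ (P - 1ℤ)) ᵒ-𝐙)))))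

    κP≋0 : ∀ a c → κ (P * a) ⊞ κ c ⊛ 𝐙 ≋ κ c ⊛ 𝐙 [ P ]
    κP≋0 a c = ≋-trans (≈⇒≋ (≈-trans (⊞-cong (κ-* P a) ≈-refl) (⊞-comm (κ P ⊛ κ a) (κ c ⊛ 𝐙)))) (≋-multiple (κ c ⊛ 𝐙) (κ a))

    cst-ᵒ : ∀ c → (κ c ⊛ 𝐙) ᵒ ≈ κ c ⊛ 𝐙
    cst-ᵒ c = ≈-trans (ᵒ-⊛ (κ c) 𝐙) (⊛-cong (ᵒ-κ c) ᵒ-𝐙)

    𝐙-⊛ : ∀ f → 𝐙 ⊛ f ≈ κ (τ f) ⊛ 𝐙
    𝐙-⊛ f = ≈-trans (⊛-comm 𝐙 f) (⊛-𝐙 f)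

    -- B is the quotient AG/p modulo 𝐙; c and c' are the multiples of 𝐙 left open by the division.
    record Divided (A G : El) (a : ℤ) : Set where
      field
        B       : El
        c c'    : ℤ
        norm    : B ⊛ B ᵒ ≈ κ a ⊞ κ c ⊛ 𝐙
        recover : A ≈ B ⊛ G ᵒ ⊞ κ c' ⊛ 𝐙

    -- Modulo 𝐙 the norm of G is p and pB = AG. Hence p²BB* ≡ (AA*)(GG*) ≡ p²a and pA ≡ AGG* ≡ pBG*,
    -- and the factors p² and p cancel.
    divide-by : ∀ A G a c → G ⊛ G ᵒ ≈ κ P ⊞ κ (P - 1ℤ) ⊛ 𝐙 → A ⊛ A ᵒ ≈ κ (P * a) ⊞ κ c ⊛ 𝐙 →
      ∀ B s → A ⊛ G ≈ κ s ⊛ 𝐙 ⊞ κ P ⊛ B → Divided A G a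
    divide-by A G a c GG AA B s eq = record { B = B ; c = at N 0ℤ ; c' = at A' 0ℤ ; norm = norm ; recover = recover }
      where
      X = A ⊛ G
      N = B ⊛ B ᵒ ⊞ ⊟ κ a
      A' = A ⊞ ⊟ (B ⊛ G ᵒ)
      PB : κ P ⊛ B ≈ X ⊞ ⊟ (κ s ⊛ 𝐙)
      PB = ≈-trans (S.solve 2 (λ y z → y := z :+ y :- z) ≈-refl (κ P ⊛ B) (κ s ⊛ 𝐙)) (⊞-cong (≈-sym eq) ≈-refl)
      PBᵒ : κ P ⊛ B ᵒ ≈ X ᵒ ⊞ ⊟ (κ s ⊛ 𝐙)
      PBᵒ = ≈-trans (⊛-cong (≈-sym (ᵒ-κ P)) ≈-refl) (≈-trans (≈-sym (ᵒ-⊛ (κ P) B)) (≈-trans (ᵒ-cong PB)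
        (≈-trans (ᵒ-⊞ X (⊟ (κ s ⊛ 𝐙))) (⊞-cong ≈-refl (≈-trans (ᵒ-⊟ (κ s ⊛ 𝐙)) (⊟-cong (cst-ᵒ s)))))))
      XX : X ⊛ X ᵒ ≈ (κ P ⊛ κ a ⊞ κ c ⊛ 𝐙) ⊛ (κ P ⊞ κ (P - 1ℤ) ⊛ 𝐙)
      XX = ≈-trans (⊛-cong ≈-refl (ᵒ-⊛ A G)) (≈-trans
        (S.solve 4 (λ a g a' g' → (a :* g) :* (a' :* g') := (a :* a') :* (g :* g')) ≈-refl A G (A ᵒ) (G ᵒ))
        (⊛-cong (≈-trans AA (⊞-cong (κ-* P a) ≈-refl)) GG))
      -- The cofactor of 𝐙 in the expansion of p²(BB* - a); only its augmentation survives
      -- multiplication by 𝐙.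
      E = κ c ⊛ (κ P ⊞ κ (P - 1ℤ) ⊛ 𝐙) ⊞ κ P ⊛ κ a ⊛ κ (P - 1ℤ) ⊞ (κ s ⊛ (κ s ⊛ 𝐙 ⊞ ⊟ (X ⊞ X ᵒ)))
      norm : B ⊛ B ᵒ ≈ κ a ⊞ κ (at N 0ℤ) ⊛ 𝐙
      norm = ≈-trans (S.solve 2 (λ x y → x := y :+ (x :- y)) ≈-refl (B ⊛ B ᵒ) (κ a)) (⊞-cong ≈-refl (div-const PP≢0 (begin
          κ (P * P) ⊛ N
            ≈⟨ ⊛-cong (κ-* P P) ≈-refl ⟩
          κ P ⊛ κ P ⊛ N
            ≈⟨ S.solve 4 (λ p b b' a → p :* p :* (b :* b' :- a) := (p :* b) :* (p :* b') :- p :* p :* a) ≈-refl (κ P) B (B ᵒ) (κ a) ⟩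
          (κ P ⊛ B) ⊛ (κ P ⊛ B ᵒ) ⊞ ⊟ (κ P ⊛ κ P ⊛ κ a)
            ≈⟨ ⊞-cong (⊛-cong PB PBᵒ) ≈-refl ⟩
          (X ⊞ ⊟ (κ s ⊛ 𝐙)) ⊛ (X ᵒ ⊞ ⊟ (κ s ⊛ 𝐙)) ⊞ ⊟ (κ P ⊛ κ P ⊛ κ a)
            ≈⟨ S.solve 5 (λ x x' s z y → (x :- s :* z) :* (x' :- s :* z) :- y
                 := x :* x' :+ z :* (s :* (s :* z :- (x :+ x'))) :- y) ≈-refl X (X ᵒ) (κ s) 𝐙 (κ P ⊛ κ P ⊛ κ a) ⟩
          X ⊛ X ᵒ ⊞ 𝐙 ⊛ (κ s ⊛ (κ s ⊛ 𝐙 ⊞ ⊟ (X ⊞ X ᵒ))) ⊞ ⊟ (κ P ⊛ κ P ⊛ κ a)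
            ≈⟨ ⊞-cong (⊞-cong XX ≈-refl) ≈-refl ⟩
          (κ P ⊛ κ a ⊞ κ c ⊛ 𝐙) ⊛ (κ P ⊞ κ (P - 1ℤ) ⊛ 𝐙) ⊞ 𝐙 ⊛ (κ s ⊛ (κ s ⊛ 𝐙 ⊞ ⊟ (X ⊞ X ᵒ))) ⊞ ⊟ (κ P ⊛ κ P ⊛ κ a)
            ≈⟨ S.solve 6 (λ p a c p1 z y → (p :* a :+ c :* z) :* (p :+ p1 :* z) :+ z :* y :- p :* p :* a
                 := z :* (c :* (p :+ p1 :* z) :+ p :* a :* p1 :+ y)) ≈-refl (κ P) (κ a) (κ c) (κ (P - 1ℤ)) 𝐙 (κ s ⊛ (κ s ⊛ 𝐙 ⊞ ⊟ (X ⊞ X ᵒ))) ⟩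
          𝐙 ⊛ E
            ≈⟨ 𝐙-⊛ E ⟩
          κ (τ E) ⊛ 𝐙 ∎)))
        where
        open import Relation.Binary.Reasoning.Setoid GR.setoid
        PP≢0 : P * P ≢ 0ℤ
        PP≢0 e = P≢0 (square≡0 P e)
      E' = κ s ⊛ G ᵒ ⊞ ⊟ (κ (P - 1ℤ) ⊛ A)
      recover : A ≈ B ⊛ G ᵒ ⊞ κ (at A' 0ℤ) ⊛ 𝐙
      recover = ≈-trans (S.solve 2 (λ x y → x := y :+ (x :- y)) ≈-refl A (B ⊛ G ᵒ)) (⊞-cong ≈-refl (div-const P≢0 (begin
          κ P ⊛ A'
            ≈⟨ S.solve 4 (λ p b g' a → p :* (a :- b :* g') := p :* a :- (p :* b) :* g') ≈-refl (κ P) B (G ᵒ) A ⟩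
          κ P ⊛ A ⊞ ⊟ ((κ P ⊛ B) ⊛ G ᵒ)
            ≈⟨ ⊞-cong ≈-refl (⊟-cong (⊛-cong PB ≈-refl)) ⟩
          κ P ⊛ A ⊞ ⊟ ((A ⊛ G ⊞ ⊟ (κ s ⊛ 𝐙)) ⊛ G ᵒ)
            ≈⟨ S.solve 6 (λ p a g g' s z → p :* a :- (a :* g :- s :* z) :* g' := p :* a :- a :* (g :* g') :+ s :* z :* g') ≈-refl (κ P) A G (G ᵒ) (κ s) 𝐙 ⟩
          κ P ⊛ A ⊞ ⊟ (A ⊛ (G ⊛ G ᵒ)) ⊞ κ s ⊛ 𝐙 ⊛ G ᵒ
            ≈⟨ ⊞-cong (⊞-cong ≈-refl (⊟-cong (⊛-cong ≈-refl GG))) ≈-refl ⟩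
          κ P ⊛ A ⊞ ⊟ (A ⊛ (κ P ⊞ κ (P - 1ℤ) ⊛ 𝐙)) ⊞ κ s ⊛ 𝐙 ⊛ G ᵒ
            ≈⟨ S.solve 6 (λ p p1 a g' s z → p :* a :- a :* (p :+ p1 :* z) :+ s :* z :* g' := z :* (s :* g' :- p1 :* a)) ≈-refl (κ P) (κ (P - 1ℤ)) A (G ᵒ) (κ s) 𝐙 ⟩
          𝐙 ⊛ E'
            ≈⟨ 𝐙-⊛ E' ⟩
          κ (τ E') ⊛ 𝐙 ∎)))
        where
        open import Relation.Binary.Reasoning.Setoid GR.setoid

    -- The parameter a is needed for two sizes: a = 4 for elements of norm 4p, and a = 4p for the
    -- element of norm 4p² built from U and V.
    gauss-divide : ∀ A G a c → G ⊛ G ᵒ ≈ κ P ⊞ κ (P - 1ℤ) ⊛ 𝐙 → A ⊛ A ᵒ ≈ κ (P * a) ⊞ κ c ⊛ 𝐙 → Divided A G a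
    gauss-divide A G a c GG AA = go (product-const A G c (P - 1ℤ)
        (≋-trans (≈⇒≋ AA) (κP≋0 a c))
        (≋-trans (≈⇒≋ (≈-trans GG (⊞-cong (κ-cong (sym (*-identityʳ P))) ≈-refl))) (κP≋0 1ℤ (P - 1ℤ))))
      where
      go : ∃[ B ] ∃[ s ] A ⊛ G ≈ κ s ⊛ 𝐙 ⊞ κ P ⊛ B → Divided A G a
      go (B , s , eq) = divide-by A G a c GG AA B s eq

    -- Elements of norm 4

    sq : El → ℤ
    sq f = ∑ rng (λ v → at f v * at f v)

    norm⇒sq : ∀ {f k} → f ⊛ f ᵒ ≈ κ k → sq f ≡ k
    norm⇒sq {f} {k} e = trans (sym (norm-at-0 f)) (trans (pt e 0ℤ) (trans (κ-at k 0ℤ) (trans (cong (k *_) δ0) (*-identityʳ k))))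

    sq-at : ∀ f v → at f v * at f v ≤ sq f
    sq-at f v = go (residue v)
      where
      go : ∃[ i ] (i ℕ.< p × P ∣ v - + i) → at f v * at f v ≤ sq f
      go (i , i<p , e) = subst (_≤ sq f) (sym (cong (λ x → x * x) (per f v (+ i) e)))
        (term≤∑ {f = λ v → at f v * at f v} (λ v → square-nonneg (at f v)) (∈-range⁺ i<p))

    sq≡0 : ∀ f → sq f ≡ 0ℤ → f ≈ κ 0ℤ
    sq≡0 f eq = pw (λ v → trans (square≡0 (at f v) (≤-antisym (subst (at f v * at f v ≤_) eq (sq-at f v)) (square-nonneg (at f v)))) (sym (κ-0 v)))

    sq≢0 : ∀ f → sq f ≢ 0ℤ → ∃[ j ] at f j ≢ 0ℤ
    sq≢0 f ne = go (∑≢0⇒∃ rng (λ v → at f v * at f v) ne)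
      where
      go : ∃[ j ] (j ∈ rng × at f j * at f j ≢ 0ℤ) → ∃[ j ] at f j ≢ 0ℤ
      go (j , _ , ne') = j , λ e → ne' (cong (λ x → x * x) e)

    -- Deletes the coefficient at j, which lowers the sum of squares by its square. Elements of
    -- small norm are taken apart in this way, one point of the support at a time.
    peel : El → ℤ → El
    peel f j = f ⊞ ⊟ (κ (at f j) ⊛ [ j ])

    peel-at : ∀ f j v → at (peel f j) v ≡ at f v - at f j * δ (v - j)
    peel-at f j v = trans (⊞-at f _ v) (cong (_+_ (at f v)) (trans (⊟-at _ v)
      (cong -_ (trans (κ-scale (at f j) [ j ] v) (cong (at f j *_) ([]-at j v))))))

    peel-∣ : ∀ f j v → P ∣ v - j → at (peel f j) v ≡ 0ℤ
    peel-∣ f j v e = trans (peel-at f j v) (trans (cong₂ (λ x y → x - at f j * y) (per f v j e) (δ-∣ e)) (lemma (at f j)))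
      where
      lemma : ∀ x → x - x * 1ℤ ≡ 0ℤ
      lemma = solve-∀

    peel-∤ : ∀ f j v → ¬ P ∣ v - j → at (peel f j) v ≡ at f v
    peel-∤ f j v e = trans (peel-at f j v) (trans (cong (λ y → at f v - at f j * y) (δ-∤ e)) (lemma (at f v) (at f j)))
      where
      lemma : ∀ x y → x - y * 0ℤ ≡ x
      lemma = solve-∀

    sq-peel : ∀ f j → sq (peel f j) ≡ sq f - at f j * at f j
    sq-peel f j = trans (∑-cong rng term) (trans (∑-- rng _ _) (cong (_-_ (sq f)) (∑-δ-pick (*-per (per f) (per f)) j)))
      where
      term : ∀ v → at (peel f j) v * at (peel f j) v ≡ at f v * at f v - δ (v - j) * (at f v * at f v)
      term v with P ∣? (v - j)
      ... | yes e = trans (cong (λ x → x * x) (peel-∣ f j v e)) (sym (trans (cong (λ y → at f v * at f v - y * (at f v * at f v)) (δ-∣ e)) (lemma (at f v * at f v))))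
        where
        lemma : ∀ x → x - 1ℤ * x ≡ 0ℤ
        lemma = solve-∀
      ... | no ¬e = trans (cong (λ x → x * x) (peel-∤ f j v ¬e)) (sym (trans (cong (λ y → at f v * at f v - y * (at f v * at f v)) (δ-∤ ¬e)) (lemma (at f v * at f v))))
        where
        lemma : ∀ x → x - 0ℤ * x ≡ x
        lemma = solve-∀

    peel-unit : ∀ f j {k} → sq f ≡ k → at f j * at f j ≡ 1ℤ → sq (peel f j) ≡ k - 1ℤ
    peel-unit f j e₁ e₂ = trans (sq-peel f j) (cong₂ _-_ e₁ e₂)

    norm1⇒unit : ∀ f → f ⊛ f ᵒ ≈ κ 1ℤ → ∃[ j ] ∃[ β ] (β * β ≡ 1ℤ × f ≈ κ β ⊛ [ j ])
    norm1⇒unit f e = go (sq≢0 f (λ z → 1≢0 (trans (sym sq1) z)))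
      where
      sq1 : sq f ≡ 1ℤ
      sq1 = norm⇒sq e
      1≢0 : 1ℤ ≢ 0ℤ
      1≢0 ()
      go : ∃[ j ] at f j ≢ 0ℤ → ∃[ j ] ∃[ β ] (β * β ≡ 1ℤ × f ≈ κ β ⊛ [ j ])
      go (j , ne) = j , at f j , β² , ≈-trans (S.solve 2 (λ x y → x := (x :- y) :+ y) ≈-refl f (κ (at f j) ⊛ [ j ]))
          (≈-trans (⊞-cong (sq≡0 (peel f j) (peel-unit f j sq1 β²)) ≈-refl) (S.solve 1 (λ x → con 0ℤ :+ x := x) ≈-refl (κ (at f j) ⊛ [ j ])))
        where
        β² : at f j * at f j ≡ 1ℤ
        β² = square≤3⇒1 (at f j) ne (≤-trans (subst (at f j * at f j ≤_) sq1 (sq-at f j)) (+≤+ (ℕ.s≤s ℕ.z≤n)))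

    even? : ∀ f → f ≋ κ 0ℤ [ + 2 ] ⊎ ∃[ a ] ¬ (+ 2 ∣ at f a)
    even? f = go (search-∈ (λ v → + 2 ∣? at f v) rng)
      where
      go : (∀ v → v ∈ rng → + 2 ∣ at f v) ⊎ (∃[ a ] (a ∈ rng × ¬ (+ 2 ∣ at f a))) → f ≋ κ 0ℤ [ + 2 ] ⊎ ∃[ a ] ¬ (+ 2 ∣ at f a)
      go (inj₂ (a , _ , odd)) = inj₂ (a , odd)
      go (inj₁ all) = inj₁ (md (λ v → ∣-resp (sym (trans (cong (_-_ (at f v)) (κ-0 v)) (+-identityʳ _))) (go' v (residue v))))
        where
        go' : ∀ v → ∃[ i ] (i ℕ.< p × P ∣ v - + i) → + 2 ∣ at f v
        go' v (i , i<p , e) = ∣-resp (sym (per f v (+ i) e)) (all (+ i) (∈-range⁺ i<p))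

    even-at : ∀ {f} → f ≋ κ 0ℤ [ + 2 ] → ∀ v → + 2 ∣ at f v
    even-at {f} e v = ∣-resp (trans (cong (_-_ (at f v)) (κ-0 v)) (+-identityʳ _)) (dv e v)

    halve : ∀ {f} → f ≋ κ 0ℤ [ + 2 ] → ∃[ K ] f ≈ κ (+ 2) ⊛ K
    halve {f} e = go (≋-lift (λ ()) e)
      where
      go : ∃[ K ] f ≈ κ 0ℤ ⊞ κ (+ 2) ⊛ K → ∃[ K ] f ≈ κ (+ 2) ⊛ K
      go (K , eq) = K , ≈-trans eq (S.solve 1 (λ x → con 0ℤ :+ x := x) ≈-refl (κ (+ 2) ⊛ K))

    κ-cancel : ∀ k {f f'} → k ≢ 0ℤ → κ k ⊛ f ≈ κ k ⊛ f' → f ≈ f'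
    κ-cancel k {f} {f'} ne e = pw (λ v → *-cancelˡ k ne (trans (sym (κ-scale k f v)) (trans (pt e v) (κ-scale k f' v))))

    -- Half of f has norm 1, so a single coefficient ±1 is left.
    even-norm4 : ∀ f → f ≋ κ 0ℤ [ + 2 ] → f ⊛ f ᵒ ≈ κ (+ 4) → ∃[ j ] ∃[ β ] (β * β ≡ 1ℤ × f ≈ κ (+ 2) ⊛ (κ β ⊛ [ j ]))
    even-norm4 f ev e = go (halve ev)
      where
      go : ∃[ K ] f ≈ κ (+ 2) ⊛ K → ∃[ j ] ∃[ β ] (β * β ≡ 1ℤ × f ≈ κ (+ 2) ⊛ (κ β ⊛ [ j ]))
      go (K , eq) = finish (norm1⇒unit K (κ-cancel (+ 4) (λ ()) (≈-trans
          (S.solve 2 (λ k k' → con (+ 4) :* (k :* k') := (con (+ 2) :* k) :* (con (+ 2) :* k')) ≈-refl K (K ᵒ))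
          (≈-trans (⊛-cong (≈-sym eq) (≈-sym (≈-trans (ᵒ-cong eq) (≈-trans (ᵒ-⊛ (κ (+ 2)) K) (⊛-cong (ᵒ-κ (+ 2)) ≈-refl)))))
            (≈-trans e (S.solve 0 (con (+ 4) := con (+ 4) :* con 1ℤ) ≈-refl))))))
        where
        finish : ∃[ j ] ∃[ β ] (β * β ≡ 1ℤ × K ≈ κ β ⊛ [ j ]) → ∃[ j ] ∃[ β ] (β * β ≡ 1ℤ × f ≈ κ (+ 2) ⊛ (κ β ⊛ [ j ]))
        finish (j , β , β² , eK) = j , β , β² , ≈-trans eq (⊛-cong ≈-refl eK)

    record Normal (A G : El) : Set where
      field
        B       : El
        ε c     : ℤ
        ε²      : ε * ε ≡ 1ℤ
        τB      : τ B ≡ + 2 * ε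
        norm    : B ⊛ B ᵒ ≈ κ (+ 4)
        recover : A ≈ B ⊛ G ᵒ ⊞ κ c ⊛ 𝐙

    τ-cst : ∀ k → τ (κ k ⊛ 𝐙) ≡ k * P
    τ-cst k = trans (τ-⊛ (κ k) 𝐙) (cong₂ _*_ (τ-κ k) τ-𝐙)

    -- Adding a multiple of 𝐙 makes the augmentation exactly ±2, and then the norm exactly 4.
    normalise : ∀ A G → Divided A G (+ 4) → Normal A G
    normalise A G D = go (euclid (τ B - + 2) (τ B + + 2) (divides c (begin
        (τ B - + 2) * (τ B + + 2)    ≡⟨ lemma₁ (τ B) ⟩
        τ B * τ B - + 4              ≡⟨ cong (_- + 4) τ² ⟩
        + 4 + c * P - + 4            ≡⟨ lemma₂ (c * P) ⟩
        c * P                        ∎)))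
      where
      open ≡-Reasoning
      open Divided D
      lemma₁ : ∀ x → (x - + 2) * (x + + 2) ≡ x * x - + 4
      lemma₁ = solve-∀
      lemma₂ : ∀ x → + 4 + x - + 4 ≡ x
      lemma₂ = solve-∀
      -- The augmentation of the norm equation; it makes p divide (τB - 2)(τB + 2).
      τ² : τ B * τ B ≡ + 4 + c * P
      τ² = trans (cong (τ B *_) (sym (τ-ᵒ B))) (trans (sym (τ-⊛ B (B ᵒ))) (trans (τ-cong norm)
        (trans (τ-⊞ (κ (+ 4)) (κ c ⊛ 𝐙)) (cong₂ _+_ (τ-κ (+ 4)) (τ-cst c)))))
      shift : ∀ ε k → ε * ε ≡ 1ℤ → τ B ≡ + 2 * ε + k * P → Normal A G
      shift ε k ε² τ-eq = record
        { B = B₁ ; ε = ε ; c = τ E₂ ; ε² = ε² ; τB = τB₁ ; norm = norm₁ ; recover = recover₁ }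
        where
        B₁ = B ⊞ ⊟ (κ k ⊛ 𝐙)
        lemma₃ : ∀ x y → x + y + - y ≡ x
        lemma₃ = solve-∀
        τB₁ : τ B₁ ≡ + 2 * ε
        τB₁ = trans (τ-⊞ B (⊟ (κ k ⊛ 𝐙))) (trans (cong₂ _+_ τ-eq (trans (τ-⊟ (κ k ⊛ 𝐙)) (cong -_ (τ-cst k)))) (lemma₃ (+ 2 * ε) (k * P)))
        E₁ = κ c ⊞ κ k ⊛ (κ k ⊛ 𝐙 ⊞ ⊟ (B ⊞ B ᵒ))
        norm' : B₁ ⊛ B₁ ᵒ ≈ κ (+ 4) ⊞ κ (τ E₁) ⊛ 𝐙
        norm' = ≈-trans (⊛-cong ≈-refl (≈-trans (ᵒ-⊞ B _) (⊞-cong ≈-refl (≈-trans (ᵒ-⊟ _) (⊟-cong (cst-ᵒ k))))))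
          (≈-trans (S.solve 4 (λ b b' k z → (b :- k :* z) :* (b' :- k :* z) := b :* b' :+ z :* (k :* (k :* z :- (b :+ b')))) ≈-refl B (B ᵒ) (κ k) 𝐙)
            (≈-trans (⊞-cong norm ≈-refl) (≈-trans
              (S.solve 3 (λ c z e → (con (+ 4) :+ c :* z) :+ z :* e := con (+ 4) :+ z :* (c :+ e)) ≈-refl (κ c) 𝐙 (κ k ⊛ (κ k ⊛ 𝐙 ⊞ ⊟ (B ⊞ B ᵒ))))
              (⊞-cong ≈-refl (𝐙-⊛ E₁)))))
        -- The new norm is 4 + τ(E₁)𝐙 and has augmentation (2ε)² = 4, so no multiple of 𝐙 is left.
        τE₁ : τ E₁ ≡ 0ℤ
        τE₁ = *-cancelˡ P P≢0 (begin
          P * τ E₁                           ≡⟨ lemma₄ P (τ E₁) ⟩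
          + 4 + τ E₁ * P - + 4               ≡⟨ cong (_- + 4) (sym (trans (τ-⊞ (κ (+ 4)) _) (cong₂ _+_ (τ-κ (+ 4)) (τ-cst (τ E₁))))) ⟩
          τ (κ (+ 4) ⊞ κ (τ E₁) ⊛ 𝐙) - + 4   ≡⟨ cong (_- + 4) (sym (τ-cong norm')) ⟩
          τ (B₁ ⊛ B₁ ᵒ) - + 4                ≡⟨ cong (_- + 4) (trans (τ-⊛ B₁ (B₁ ᵒ)) (cong₂ _*_ τB₁ (trans (τ-ᵒ B₁) τB₁))) ⟩
          + 2 * ε * (+ 2 * ε) - + 4          ≡⟨ lemma₅ ε ⟩
          + 4 * (ε * ε) - + 4                ≡⟨ cong (λ x → + 4 * x - + 4) ε² ⟩
          0ℤ                                 ≡⟨ sym (*-zeroʳ P) ⟩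
          P * 0ℤ                             ∎)
          where
          lemma₄ : ∀ P x → P * x ≡ + 4 + x * P - + 4
          lemma₄ = solve-∀
          lemma₅ : ∀ ε → + 2 * ε * (+ 2 * ε) - + 4 ≡ + 4 * (ε * ε) - + 4
          lemma₅ = solve-∀
        norm₁ : B₁ ⊛ B₁ ᵒ ≈ κ (+ 4)
        norm₁ = ≈-trans norm' (≈-trans (⊞-cong ≈-refl (⊛-cong (κ-cong τE₁) ≈-refl))
          (S.solve 1 (λ z → con (+ 4) :+ con 0ℤ :* z := con (+ 4)) ≈-refl 𝐙))
        E₂ = κ k ⊛ G ᵒ ⊞ κ c'
        recover₁ : A ≈ B₁ ⊛ G ᵒ ⊞ κ (τ E₂) ⊛ 𝐙
        recover₁ = ≈-trans recover (≈-trans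
          (S.solve 5 (λ b g k z c → b :* g :+ c :* z := (b :- k :* z) :* g :+ z :* (k :* g :+ c)) ≈-refl B (G ᵒ) (κ k) 𝐙 (κ c'))
          (⊞-cong ≈-refl (𝐙-⊛ E₂)))
      go : P ∣ τ B - + 2 ⊎ P ∣ τ B + + 2 → Normal A G
      go (inj₁ (divides k e)) = shift 1ℤ k refl (trans (lemma (τ B)) (cong (_+_ (+ 2)) e))
        where
        lemma : ∀ x → x ≡ + 2 + (x - + 2)
        lemma = solve-∀
      go (inj₂ (divides k e)) = shift -1ℤ k refl (trans (lemma (τ B)) (cong (_+_ (- + 2)) e))
        where
        lemma : ∀ x → x ≡ - + 2 + (x + + 2)
        lemma = solve-∀

    gauss-normal : ∀ A G c → G ⊛ G ᵒ ≈ κ P ⊞ κ (P - 1ℤ) ⊛ 𝐙 → A ⊛ A ᵒ ≈ κ (P * + 4) ⊞ κ c ⊛ 𝐙 → Normal A G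
    gauss-normal A G c GG AA = normalise A G (gauss-divide A G (+ 4) c GG AA)

    -- Moments of the differences occurring in a norm.

    ∣-combine : ∀ {m x y z} → m ∣ x → m ∣ y → x + y ≡ z → m ∣ z
    ∣-combine d₁ d₂ refl = ∣m∣n⇒∣m+n d₁ d₂

    module Moment (φ : ℤ → ℤ) (φ-per : ∀ v w → P ∣ v - w → P ∣ φ v - φ w) where

      -- φ is periodic only modulo p, as powers of v are. Therefore L takes [ a ] to φ a only up to
      -- multiples of p, and all evaluations are recorded by the relation `_↦_`.
      L : El → ℤ
      L f = ∑ rng (λ v → at f v * φ v)

      infix 4 _↦_
      _↦_ : El → ℤ → Set
      f ↦ m = P ∣ L f - m

      ↦-cong : ∀ {f f' m} → f ≈ f' → f ↦ m → f' ↦ m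
      ↦-cong {m = m} e d = ∣-resp (cong (_- m) (∑-cong rng (λ v → cong (_* φ v) (pt e v)))) d

      ↦-⊞ : ∀ {f f' m m'} → f ↦ m → f' ↦ m' → f ⊞ f' ↦ m + m'
      ↦-⊞ {f} {f'} {m} {m'} d d' = ∣-combine d d' (trans (lemma (L f) (L f') m m') (cong (_- (m + m'))
        (sym (trans (∑-cong rng (λ v → trans (cong (_* φ v) (⊞-at f f' v)) (*-distribʳ-+ (φ v) (at f v) (at f' v)))) (∑-+ rng _ _)))))
        where
        lemma : ∀ a b c d → a - c + (b - d) ≡ a + b - (c + d)
        lemma = solve-∀

      ↦-⊟ : ∀ {f m} → f ↦ m → ⊟ f ↦ - m
      ↦-⊟ {f} {m} d = ∣-resp (trans (lemma (L f) m) (cong (_- - m)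
        (sym (trans (∑-cong rng (λ v → trans (cong (_* φ v) (⊟-at f v)) (sym (neg-distribˡ-* (at f v) (φ v))))) (∑-neg rng _))))) (∣m⇒∣-m d)
        where
        lemma : ∀ a b → - (a - b) ≡ - a - - b
        lemma = solve-∀

      ↦-[] : ∀ a → [ a ] ↦ φ a
      ↦-[] a = ∣-resp eq (∣∑ rng (λ v → term v))
        where
        term : ∀ v → P ∣ δ (v - a) * (φ v - φ a)
        term v with P ∣? (v - a)
        ... | yes e = ∣n⇒∣m*n (δ (v - a)) (φ-per v a e)
        ... | no ¬e = divides 0ℤ (cong (_* (φ v - φ a)) (δ-∤ ¬e))
        lemma : ∀ d x y → d * (x - y) ≡ d * x - d * y
        lemma = solve-∀
        eq : ∑ rng (λ v → δ (v - a) * (φ v - φ a)) ≡ L [ a ] - φ a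
        eq = trans (∑-cong rng (λ v → lemma (δ (v - a)) (φ v) (φ a))) (trans (∑-- rng _ _)
          (cong₂ _-_ (∑-cong rng (λ v → cong (_* φ v) (sym ([]-at a v))))
            (trans (∑-*ʳ rng (λ v → δ (v - a)) (φ a)) (trans (cong (_* φ a) (trans (∑-shift δ-per (- a)) ∑-δ)) (*-identityˡ _)))))

      ↦-pair : ∀ a b → [ a ] ⊛ [ b ] ᵒ ↦ φ (a - b)
      ↦-pair a b = ↦-cong (≈-sym (≈-trans (⊛-cong ≈-refl (ᵒ-[] b)) ([]-+ a (- b)))) (↦-[] (a - b))

      ↦-0 : ∀ {m} → κ 0ℤ ↦ m → P ∣ m
      ↦-0 {m} d = ∣-resp (trans (cong (λ x → - (x - m)) L0) (lemma m)) (∣m⇒∣-m d)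
        where
        L0 : L (κ 0ℤ) ≡ 0ℤ
        L0 = trans (∑-cong rng (λ v → trans (cong (_* φ v) (κ-0 v)) (*-zeroˡ (φ v)))) (∑-0 rng)
        lemma : ∀ m → - (0ℤ - m) ≡ m
        lemma = solve-∀

    four : ℤ → ℤ → ℤ → ℤ → El
    four a b c d = [ a ] ⊞ [ b ] ⊞ [ c ] ⊞ ⊟ [ d ]

    four-ᵒ : ∀ a b c d → (four a b c d) ᵒ ≈ [ a ] ᵒ ⊞ [ b ] ᵒ ⊞ [ c ] ᵒ ⊞ ⊟ [ d ] ᵒ
    four-ᵒ a b c d = ≈-trans (ᵒ-⊞ _ _) (⊞-cong (≈-trans (ᵒ-⊞ _ _) (⊞-cong (ᵒ-⊞ _ _) ≈-refl)) (ᵒ-⊟ [ d ]))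

    []-unit : ∀ a → [ a ] ⊛ [ a ] ᵒ ≈ κ 1ℤ
    []-unit a = ≈-trans (⊛-cong ≈-refl (ᵒ-[] a)) (≈-trans ([]-+ a (- a)) (≈-trans ([]-cong (divides 0ℤ (lemma a))) [0]))
      where
      lemma : ∀ a → a + - a - 0ℤ ≡ 0ℤ
      lemma = solve-∀

    -- The four diagonal products equal 1 and already make up the norm 4, so the mixed products
    -- cancel.
    off-diagonal : ∀ a b c d → four a b c d ⊛ four a b c d ᵒ ≈ κ (+ 4) →
      let _·_ = λ x y → [ x ] ⊛ [ y ] ᵒ in
      ((a · b ⊞ b · a) ⊞ (a · c ⊞ c · a) ⊞ (b · c ⊞ c · b)) ⊞ (⊟ (a · d ⊞ d · a) ⊞ ⊟ (b · d ⊞ d · b) ⊞ ⊟ (c · d ⊞ d · c)) ≈ κ 0ℤ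
    off-diagonal a b c d e = ≈-trans
      (S.solve 8 (λ a b c d a' b' c' d' →
        ((a :* b' :+ b :* a') :+ (a :* c' :+ c :* a') :+ (b :* c' :+ c :* b'))
          :+ (:- (a :* d' :+ d :* a') :+ :- (b :* d' :+ d :* b') :+ :- (c :* d' :+ d :* c'))
        := (a :+ b :+ c :- d) :* (a' :+ b' :+ c' :- d') :- (a :* a' :+ b :* b' :+ c :* c' :+ d :* d')) ≈-refl
        [ a ] [ b ] [ c ] [ d ] ([ a ] ᵒ) ([ b ] ᵒ) ([ c ] ᵒ) ([ d ] ᵒ))
      (≈-trans (⊞-cong (≈-trans (⊛-cong ≈-refl (≈-sym (four-ᵒ a b c d))) e)
          (⊟-cong (⊞-cong (⊞-cong (⊞-cong ([]-unit a) ([]-unit b)) ([]-unit c)) ([]-unit d))))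
        (S.solve 0 (con (+ 4) :- (con 1ℤ :+ con 1ℤ :+ con 1ℤ :+ con 1ℤ) := con 0ℤ) ≈-refl))

    -- An even φ is applied to the cancelling mixed products. Every difference occurs with both
    -- signs, hence the factor 2, which is invertible modulo p.
    moment : ∀ a b c d → four a b c d ⊛ four a b c d ᵒ ≈ κ (+ 4) →
      ∀ φ → (∀ v w → P ∣ v - w → P ∣ φ v - φ w) → (∀ v → φ (- v) ≡ φ v) → P ∣ Δ[ φ ] (a - d) (b - d) (c - d)
    moment a b c d e φ φ-per φ-even = P∣2* (Δ[ φ ] (a - d) (b - d) (c - d)) (∣-resp collect (↦-0 (↦-cong (off-diagonal a b c d e)
        (↦-⊞ (↦-⊞ (↦-⊞ (both a b) (both a c)) (both b c))
             (↦-⊞ (↦-⊞ (↦-⊟ (both a d)) (↦-⊟ (both b d))) (↦-⊟ (both c d)))))))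
      where
      open Moment φ φ-per
      flip : ∀ x y → φ (y - x) ≡ φ (x - y)
      flip x y = trans (cong φ (lemma x y)) (φ-even (x - y))
        where
        lemma : ∀ x y → y - x ≡ - (x - y)
        lemma = solve-∀
      both : ∀ x y → [ x ] ⊛ [ y ] ᵒ ⊞ [ y ] ⊛ [ x ] ᵒ ↦ + 2 * φ (x - y)
      both x y = ∣-resp (cong (_-_ (L ([ x ] ⊛ [ y ] ᵒ ⊞ [ y ] ⊛ [ x ] ᵒ)))
          (trans (cong (_+_ (φ (x - y))) (flip x y)) (lemma (φ (x - y))))) (↦-⊞ (↦-pair x y) (↦-pair y x))
        where
        lemma : ∀ x → x + x ≡ + 2 * x
        lemma = solve-∀
      diff : ∀ x y d → x - y ≡ x - d - (y - d)
      diff = solve-∀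
      collect : + 2 * φ (a - b) + + 2 * φ (a - c) + + 2 * φ (b - c) + (- (+ 2 * φ (a - d)) + - (+ 2 * φ (b - d)) + - (+ 2 * φ (c - d)))
        ≡ + 2 * Δ[ φ ] (a - d) (b - d) (c - d)
      collect rewrite diff a b d | diff a c d | diff b c d = lemma (φ (a - d - (b - d))) (φ (a - d - (c - d))) (φ (b - d - (c - d))) (φ (a - d)) (φ (b - d)) (φ (c - d))
        where
        lemma : ∀ x y z u v w → + 2 * x + + 2 * y + + 2 * z + (- (+ 2 * u) + - (+ 2 * v) + - (+ 2 * w)) ≡ + 2 * (x + y + z - u - v - w)
        lemma = solve-∀

    sq₂-per : ∀ v w → P ∣ v - w → P ∣ sq₂ v - sq₂ w
    sq₂-per v w e = ∣-resp (lemma v w) (∣m⇒∣m*n (v + w) e)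
      where
      lemma : ∀ v w → (v - w) * (v + w) ≡ v * v - w * w
      lemma = solve-∀

    mul-per : ∀ x y z w → P ∣ x - y → P ∣ z - w → P ∣ x * z - y * w
    mul-per x y z w e₁ e₂ = ∣-combine (∣m⇒∣m*n z e₁) (∣n⇒∣m*n y e₂) (lemma x y z w)
      where
      lemma : ∀ x y z w → (x - y) * z + y * (z - w) ≡ x * z - y * w
      lemma = solve-∀

    sq₄-per : ∀ v w → P ∣ v - w → P ∣ sq₄ v - sq₄ w
    sq₄-per v w e = mul-per (sq₂ v) (sq₂ w) (sq₂ v) (sq₂ w) (sq₂-per v w e) (sq₂-per v w e)

    sq₆-per : ∀ v w → P ∣ v - w → P ∣ sq₆ v - sq₆ w
    sq₆-per v w e = mul-per (sq₄ v) (sq₄ w) (sq₂ v) (sq₂ w) (sq₄-per v w e) (sq₂-per v w e)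

    sq₂-even : ∀ v → sq₂ (- v) ≡ sq₂ v
    sq₂-even = lemma
      where
      lemma : ∀ v → (- v) * (- v) ≡ v * v
      lemma = solve-∀

    cancel∣ : ∀ x y → ¬ P ∣ x → P ∣ x * y → P ∣ y
    cancel∣ x y ¬x d with euclid x y d
    ... | inj₁ e = contradiction e ¬x
    ... | inj₂ e = e

    ¬∣-* : ∀ {x y} → ¬ P ∣ x → ¬ P ∣ y → ¬ P ∣ x * y
    ¬∣-* {x} {y} ¬x ¬y d = ¬y (cancel∣ x y ¬x d)

    record Distinct (a b c d : ℤ) : Set where
      field
        a≢d : ¬ P ∣ a - d
        b≢d : ¬ P ∣ b - d
        c≢d : ¬ P ∣ c - d
        a≢b : ¬ P ∣ a - b
        a≢c : ¬ P ∣ a - c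
        b≢c : ¬ P ∣ b - c

    -- The second and fourth moments give e₁ ≡ e₂ ≡ 0 for x, y, z, so that these are cube roots of a
    -- common residue and z ≡ -x-y. The sixth moment then says 84x⁶ ≡ 0. Since x is prime to p, p
    -- divides 84 = 4·3·7, and 2 and 3 are excluded.
    four-norm4 : ∀ a b c d → Distinct a b c d → four a b c d ⊛ four a b c d ᵒ ≈ κ (+ 4) →
      P ∣ (a - d) + (b - d) + (c - d) × P ∣ (a - d) * (a - d) + (a - d) * (b - d) + (b - d) * (b - d) × P ∣ + 7
    four-norm4 a b c d D e = P∣e₁ , P∣q , P∣7 (euclid (+ 3) (+ 28) P∣84)
      where
      open Distinct D
      x = a - d
      y = b - d
      z = c - d
      q = x * x + x * y + y * y
      m₂ : P ∣ Δ[ sq₂ ] x y z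
      m₂ = moment a b c d e sq₂ sq₂-per sq₂-even
      m₄ : P ∣ Δ[ sq₄ ] x y z
      m₄ = moment a b c d e sq₄ sq₄-per (λ v → cong (λ t → t * t) (sq₂-even v))
      m₆ : P ∣ Δ[ sq₆ ] x y z
      m₆ = moment a b c d e sq₆ sq₆-per (λ v → cong (λ t → t * t * t) (sq₂-even v))
      P∣4* : ∀ t → P ∣ + 4 * t → P ∣ t
      P∣4* t e = P∣2* t (P∣2* (+ 2 * t) (∣-resp (lemma t) e))
        where
        lemma : ∀ t → + 4 * t ≡ + 2 * (+ 2 * t)
        lemma = solve-∀
      P∣e₁ : P ∣ x + y + z
      P∣e₁ = cancel∣ (x * y * z) (x + y + z) (¬∣-* (¬∣-* a≢d b≢d) c≢d)
        (∣-resp (*-comm (x + y + z) (x * y * z)) (P∣4* _ (∣-combine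
          (∣m⇒∣m*n K₄ m₂) (∣m⇒∣-m m₄)
          (trans (cong (λ t → Δ[ sq₂ ] x y z * K₄ + - t) (Δ₄-identity x y z))
            (lemma (Δ[ sq₂ ] x y z * K₄) (+ 4 * ((x + y + z) * (x * y * z))))))))
        where
        K₄ = + 2 * (x * x + y * y + z * z) - Δ[ sq₂ ] x y z - + 4 * (x * y + x * z + y * z)
        lemma : ∀ s t → s + - (s - t) ≡ t
        lemma = solve-∀
      P∣e₂ : P ∣ x * y + x * z + y * z
      P∣e₂ = P∣4* _ (∣-combine (∣m⇒∣m*n (x + y + z) P∣e₁) (∣m⇒∣-m m₂)
        (trans (cong (λ t → (x + y + z) * (x + y + z) + - t) (Δ₂-identity x y z)) (lemma ((x + y + z) * (x + y + z)) (+ 4 * (x * y + x * z + y * z)))))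
        where
        lemma : ∀ s t → s + - (s - t) ≡ t
        lemma = solve-∀
      P∣q : P ∣ q
      P∣q = ∣-combine (∣m⇒∣m*n (x + y) P∣e₁) (∣m⇒∣-m P∣e₂) (lemma x y z)
        where
        lemma : ∀ x y z → (x + y + z) * (x + y) + - (x * y + x * z + y * z) ≡ x * x + x * y + y * y
        lemma = solve-∀
      z≡ : P ∣ z - (- x - y)
      z≡ = ∣-resp (lemma x y z) P∣e₁
        where
        lemma : ∀ x y z → x + y + z ≡ z - (- x - y)
        lemma = solve-∀
      m₆' : P ∣ Δ[ sq₆ ] x y (- x - y)
      m₆' = ∣-combine m₆ (∣m⇒∣-m (∣-combine (∣-combine (sq₆-per (x - z) (x - (- x - y)) (∣-resp (l x z (- x - y)) (∣m⇒∣-m z≡)))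
          (sq₆-per (y - z) (y - (- x - y)) (∣-resp (l y z (- x - y)) (∣m⇒∣-m z≡))) refl) (∣m⇒∣-m (sq₆-per z (- x - y) z≡)) refl))
        (lemma (sq₆ (x - y)) (sq₆ (x - z)) (sq₆ (y - z)) (sq₆ x) (sq₆ y) (sq₆ z) (sq₆ (x - (- x - y))) (sq₆ (y - (- x - y))) (sq₆ (- x - y)))
        where
        l : ∀ x z w → - (z - w) ≡ x - z - (x - w)
        l = solve-∀
        lemma : ∀ a b c x y z b' c' z' → a + b + c - x - y - z + - (b - b' + (c - c') + - (z - z')) ≡ a + b' + c' - x - y - z'
        lemma = solve-∀
      P∣84 : P ∣ + 84
      P∣84 = cancel∣ (sq₆ x) (+ 84) (¬∣-* (¬∣-* (¬∣-* a≢d a≢d) (¬∣-* a≢d a≢d)) (¬∣-* a≢d a≢d))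
        (∣-combine (∣m⇒∣m*n (Δ₆-cofactor x y) P∣q) (∣m⇒∣-m m₆') (trans (cong (λ t → q * Δ₆-cofactor x y + - t) (Δ₆-identity x y)) (lemma (q * Δ₆-cofactor x y) (sq₆ x))))
        where
        lemma : ∀ s t → s + - (s - + 84 * t) ≡ t * + 84
        lemma = solve-∀
      P∣7 : P ∣ + 3 ⊎ P ∣ + 28 → P ∣ + 7
      P∣7 (inj₂ e28) = P∣4* (+ 7) e28
      -- Modulo 3 the form x² + xy + y² is the square (x-y)², so a and b would coincide.
      P∣7 (inj₁ e3)  = contradiction (∣-resp (diff a b d) (euclid-square (x - y) (∣-combine P∣q (∣m⇒∣-m (∣m⇒∣m*n (x * y) e3)) (lemma x y)))) a≢b
        where
        lemma : ∀ x y → x * x + x * y + y * y + - (+ 3 * (x * y)) ≡ (x - y) * (x - y)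
        lemma = solve-∀
        diff : ∀ x y d → x - d - (y - d) ≡ x - y
        diff = solve-∀

    -- Elements of norm 4 with an odd coefficient.

    peel-zero : ∀ f j v → at f v ≡ 0ℤ → at (peel f j) v ≡ 0ℤ
    peel-zero f j v z with P ∣? (v - j)
    ... | yes e = peel-∣ f j v e
    ... | no ¬e = trans (peel-∤ f j v ¬e) z

    peel-sum : ∀ f j → f ≈ κ (at f j) ⊛ [ j ] ⊞ peel f j
    peel-sum f j = S.solve 2 (λ x y → x := y :+ (x :- y)) ≈-refl f (κ (at f j) ⊛ [ j ])

    record FourUnits (f : El) (a b c d : ℤ) : Set where
      field
        s₁ s₂ s₃ s₄ : ℤ
        s₁² : s₁ * s₁ ≡ 1ℤ
        s₂² : s₂ * s₂ ≡ 1ℤ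
        s₃² : s₃ * s₃ ≡ 1ℤ
        s₄² : s₄ * s₄ ≡ 1ℤ
        sum : f ≈ κ s₁ ⊛ [ a ] ⊞ κ s₂ ⊛ [ b ] ⊞ κ s₃ ⊛ [ c ] ⊞ κ s₄ ⊛ [ d ]

    sq-bound : ∀ f j {k} → sq f ≡ k → at f j * at f j ≤ k
    sq-bound f j refl = sq-at f j

    four-units : ∀ f a b c d → sq f ≡ + 4 → at f a * at f a ≡ 1ℤ → at (peel f a) b ≢ 0ℤ → at (peel (peel f a) b) c ≢ 0ℤ →
      at (peel (peel (peel f a) b) c) d ≢ 0ℤ → FourUnits f a b c d
    four-units f a b c d q a² b≢0 c≢0 d≢0 = record
      { s₁ = at f a ; s₂ = at f₁ b ; s₃ = at f₂ c ; s₄ = at f₃ d ; s₁² = a² ; s₂² = b² ; s₃² = c² ; s₄² = d²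
      ; sum = ≈-trans (peel-sum f a) (≈-trans (⊞-cong ≈-refl (≈-trans (peel-sum f₁ b) (⊞-cong ≈-refl (≈-trans (peel-sum f₂ c)
          (⊞-cong ≈-refl (≈-trans (peel-sum f₃ d) (⊞-cong ≈-refl (sq≡0 (peel f₃ d) (peel-unit f₃ d q₃ d²)))))))))
          (S.solve 4 (λ x y z w → x :+ (y :+ (z :+ (w :+ con 0ℤ))) := x :+ y :+ z :+ w) ≈-refl
            (κ (at f a) ⊛ [ a ]) (κ (at f₁ b) ⊛ [ b ]) (κ (at f₂ c) ⊛ [ c ]) (κ (at f₃ d) ⊛ [ d ]))) }
      where
      f₁ = peel f a
      f₂ = peel f₁ b
      f₃ = peel f₂ c
      q₁ : sq f₁ ≡ + 3
      q₁ = peel-unit f a q a²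
      b² : at f₁ b * at f₁ b ≡ 1ℤ
      b² = square≤3⇒1 (at f₁ b) b≢0 (sq-bound f₁ b q₁)
      q₂ : sq f₂ ≡ + 2
      q₂ = peel-unit f₁ b q₁ b²
      c² : at f₂ c * at f₂ c ≡ 1ℤ
      c² = square≤3⇒1 (at f₂ c) c≢0 (≤-trans (sq-bound f₂ c q₂) (+≤+ (ℕ.s≤s (ℕ.s≤s ℕ.z≤n))))
      q₃ : sq f₃ ≡ + 1
      q₃ = peel-unit f₂ c q₂ c²
      d² : at f₃ d * at f₃ d ≡ 1ℤ
      d² = square≤3⇒1 (at f₃ d) d≢0 (≤-trans (sq-bound f₃ d q₃) (+≤+ (ℕ.s≤s ℕ.z≤n)))

    ¬∣-sym : ∀ v w → ¬ P ∣ v - w → ¬ P ∣ w - v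
    ¬∣-sym v w ¬e e = ¬e (∣-diff-sym w v e)

    four-at : ∀ a b c d v → at (four a b c d) v ≡ δ (v - a) + δ (v - b) + δ (v - c) - δ (v - d)
    four-at a b c d v = trans (⊞-at _ _ v) (cong₂ _+_ (trans (⊞-at _ _ v) (cong₂ _+_ (trans (⊞-at _ _ v) (cong₂ _+_ ([]-at a v) ([]-at b v))) ([]-at c v)))
      (trans (⊟-at _ v) (cong -_ ([]-at d v))))

    -- An odd coefficient with square at most 4 is ±1. This leaves sums of squares 3, 2, 1, and a
    -- nonzero coefficient with square at most 3 is again ±1. Peeled points carry 0, so the four
    -- points differ.
    find-four : ∀ f → sq f ≡ + 4 → ∃[ a ] ¬ (+ 2 ∣ at f a) → ∃[ a ] ∃[ b ] ∃[ c ] ∃[ d ] (Distinct a b c d × FourUnits f a b c d)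
    find-four f q (a , odd) = step₁ (sq≢0 f₁ (λ z → contradiction (trans (sym q₁) z) λ ()))
      where
      Goal = ∃[ a ] ∃[ b ] ∃[ c ] ∃[ d ] (Distinct a b c d × FourUnits f a b c d)
      a² : at f a * at f a ≡ 1ℤ
      a² = odd-square≤4⇒1 (at f a) odd (sq-bound f a q)
      f₁ = peel f a
      q₁ : sq f₁ ≡ + 3
      q₁ = peel-unit f a q a²
      step₁ : ∃[ b ] at f₁ b ≢ 0ℤ → Goal
      step₁ (b , b≢0) = step₂ (sq≢0 f₂ (λ z → contradiction (trans (sym q₂) z) λ ()))
        where
        f₂ = peel f₁ b
        q₂ : sq f₂ ≡ + 2
        q₂ = peel-unit f₁ b q₁ (square≤3⇒1 (at f₁ b) b≢0 (sq-bound f₁ b q₁))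
        step₂ : ∃[ c ] at f₂ c ≢ 0ℤ → Goal
        step₂ (c , c≢0) = step₃ (sq≢0 f₃ (λ z → contradiction (trans (sym q₃) z) λ ()))
          where
          f₃ = peel f₂ c
          q₃ : sq f₃ ≡ + 1
          q₃ = peel-unit f₂ c q₂ (square≤3⇒1 (at f₂ c) c≢0 (≤-trans (sq-bound f₂ c q₂) (+≤+ (ℕ.s≤s (ℕ.s≤s ℕ.z≤n)))))
          step₃ : ∃[ d ] at f₃ d ≢ 0ℤ → Goal
          step₃ (d , d≢0) = a , b , c , d , record
            { a≢d = ¬∣-sym d a (λ e → d≢0 (peel-zero f₂ c d (peel-zero f₁ b d (peel-∣ f a d e))))
            ; b≢d = ¬∣-sym d b (λ e → d≢0 (peel-zero f₂ c d (peel-∣ f₁ b d e)))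
            ; c≢d = ¬∣-sym d c (λ e → d≢0 (peel-∣ f₂ c d e))
            ; a≢b = ¬∣-sym b a (λ e → b≢0 (peel-∣ f a b e))
            ; a≢c = ¬∣-sym c a (λ e → c≢0 (peel-zero f₁ b c (peel-∣ f a c e)))
            ; b≢c = ¬∣-sym c b (λ e → c≢0 (peel-∣ f₁ b c e)) }
            , four-units f a b c d q a² b≢0 c≢0 d≢0

    -- The same decomposition at prescribed points. It serves the second multiplier, whose odd
    -- coefficients are known from its congruence with the first one modulo 2.
    odd-four : ∀ f a b c d → Distinct a b c d → sq f ≡ + 4 → ¬ (+ 2 ∣ at f a) → ¬ (+ 2 ∣ at f b) → ¬ (+ 2 ∣ at f c) → ¬ (+ 2 ∣ at f d) →
      FourUnits f a b c d
    odd-four f a b c d D q oa ob oc od = four-units f a b c d q (odd-square≤4⇒1 (at f a) oa (sq-bound f a q))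
        (λ z → nz ob (trans (sym b-eq) z)) (λ z → nz oc (trans (sym c-eq) z)) (λ z → nz od (trans (sym d-eq) z))
      where
      open Distinct D
      nz : ∀ {x} → ¬ (+ 2 ∣ x) → x ≢ 0ℤ
      nz o refl = o (divides 0ℤ refl)
      b-eq : at (peel f a) b ≡ at f b
      b-eq = peel-∤ f a b (¬∣-sym a b a≢b)
      c-eq : at (peel (peel f a) b) c ≡ at f c
      c-eq = trans (peel-∤ (peel f a) b c (¬∣-sym b c b≢c)) (peel-∤ f a c (¬∣-sym a c a≢c))
      d-eq : at (peel (peel (peel f a) b) c) d ≡ at f d
      d-eq = trans (peel-∤ _ c d (¬∣-sym c d c≢d)) (trans (peel-∤ (peel f a) b d (¬∣-sym b d b≢d)) (peel-∤ f a d (¬∣-sym a d a≢d)))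

    τ-units : ∀ {f a b c d} (F : FourUnits f a b c d) → let open FourUnits F in τ f ≡ s₁ + s₂ + s₃ + s₄
    τ-units {a = a} {b} {c} {d} F = trans (τ-cong sum) (trans (τ-⊞ _ _) (cong₂ _+_ (trans (τ-⊞ _ _) (cong₂ _+_
        (trans (τ-⊞ _ _) (cong₂ _+_ (one s₁ a) (one s₂ b))) (one s₃ c))) (one s₄ d)))
      where
      open FourUnits F
      one : ∀ s x → τ (κ s ⊛ [ x ]) ≡ s
      one s x = trans (τ-⊛ (κ s) [ x ]) (trans (cong₂ _*_ (τ-κ s) (τ-[] x)) (*-identityʳ s))

    -- Exactly one of the four signs disagrees with ε; it is listed last in `four`.
    four-signs : ∀ {f a b c d} ε → ε * ε ≡ 1ℤ → τ f ≡ + 2 * ε → FourUnits f a b c d →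
      f ≈ κ ε ⊛ four a b c d ⊎ f ≈ κ ε ⊛ four a b d c ⊎ f ≈ κ ε ⊛ four a d c b ⊎ f ≈ κ ε ⊛ four d b c a
    four-signs {f} {a} {b} {c} {d} ε ε² τf F = go (signs ε s₁ s₂ s₃ s₄ ε² s₁² s₂² s₃² s₄² (trans (sym (τ-units F)) τf))
      where
      open FourUnits F
      rearr : ∀ {t₁ t₂ t₃ t₄} → s₁ ≡ t₁ → s₂ ≡ t₂ → s₃ ≡ t₃ → s₄ ≡ t₄ → f ≈ κ t₁ ⊛ [ a ] ⊞ κ t₂ ⊛ [ b ] ⊞ κ t₃ ⊛ [ c ] ⊞ κ t₄ ⊛ [ d ]
      rearr refl refl refl refl = sum
      go : _ → f ≈ κ ε ⊛ four a b c d ⊎ f ≈ κ ε ⊛ four a b d c ⊎ f ≈ κ ε ⊛ four a d c b ⊎ f ≈ κ ε ⊛ four d b c a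
      go (inj₁ (e₁ , e₂ , e₃ , e₄)) = inj₁ (≈-trans (rearr e₁ e₂ e₃ e₄) (≈-trans (⊞-cong ≈-refl (⊛-cong (κ-neg ε) ≈-refl))
        (S.solve 5 (λ e a b c d → e :* a :+ e :* b :+ e :* c :+ (:- e) :* d := e :* (a :+ b :+ c :- d)) ≈-refl (κ ε) [ a ] [ b ] [ c ] [ d ])))
      go (inj₂ (inj₁ (e₁ , e₂ , e₃ , e₄))) = inj₂ (inj₁ (≈-trans (rearr e₁ e₂ e₃ e₄) (≈-trans (⊞-cong (⊞-cong ≈-refl (⊛-cong (κ-neg ε) ≈-refl)) ≈-refl)
        (S.solve 5 (λ e a b c d → e :* a :+ e :* b :+ (:- e) :* c :+ e :* d := e :* (a :+ b :+ d :- c)) ≈-refl (κ ε) [ a ] [ b ] [ c ] [ d ]))))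
      go (inj₂ (inj₂ (inj₁ (e₁ , e₂ , e₃ , e₄)))) = inj₂ (inj₂ (inj₁ (≈-trans (rearr e₁ e₂ e₃ e₄) (≈-trans (⊞-cong (⊞-cong (⊞-cong ≈-refl (⊛-cong (κ-neg ε) ≈-refl)) ≈-refl) ≈-refl)
        (S.solve 5 (λ e a b c d → e :* a :+ (:- e) :* b :+ e :* c :+ e :* d := e :* (a :+ d :+ c :- b)) ≈-refl (κ ε) [ a ] [ b ] [ c ] [ d ])))))
      go (inj₂ (inj₂ (inj₂ (e₁ , e₂ , e₃ , e₄)))) = inj₂ (inj₂ (inj₂ (≈-trans (rearr e₁ e₂ e₃ e₄) (≈-trans (⊞-cong (⊞-cong (⊞-cong (⊛-cong (κ-neg ε) ≈-refl) ≈-refl) ≈-refl) ≈-refl)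
        (S.solve 5 (λ e a b c d → (:- e) :* a :+ e :* b :+ e :* c :+ e :* d := e :* (d :+ b :+ c :- a)) ≈-refl (κ ε) [ a ] [ b ] [ c ] [ d ])))))

    -- The case p = 7

    g-at : ∀ v → at g v ≡ γ[ p ] v
    g-at v = trans (⊞∑-at rng _ v) (trans (∑-cong rng (λ z → []-at (z * z) v)) (γ-def p v))

    shift-g : ∀ a v → at ([ a ] ⊛ g ᵒ) v ≡ γ[ p ] (a - v)
    shift-g a v = trans ([]-⊛ a (g ᵒ) v) (trans (ᵒ-at g (v - a)) (trans (cong (at g) (lemma v a)) (g-at (a - v))))
      where
      lemma : ∀ v a → - (v - a) ≡ a - v
      lemma = solve-∀

    four-g : ∀ a b c d v → at (four a b c d ⊛ g ᵒ) v ≡ γ[ p ] (a - v) + γ[ p ] (b - v) + γ[ p ] (c - v) - γ[ p ] (d - v)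
    four-g a b c d v = trans
      (pt (S.solve 5 (λ a b c d g → (a :+ b :+ c :- d) :* g := a :* g :+ b :* g :+ c :* g :- d :* g) ≈-refl [ a ] [ b ] [ c ] [ d ] (g ᵒ)) v)
      (trans (⊞-at _ _ v) (cong₂ _+_ (trans (⊞-at _ _ v) (cong₂ _+_ (trans (⊞-at _ _ v) (cong₂ _+_ (shift-g a v) (shift-g b v))) (shift-g c v)))
        (trans (⊟-at _ v) (cong -_ (shift-g d v)))))

    profile-per : ∀ ε A A' t → P ∣ A - A' → profile γ[ p ] ε A t ≡ profile γ[ p ] ε A' t
    profile-per ε A A' t e = profile-cong γ[ p ] γ[ p ] ε A A' t
        (λ k → γ-per p ((k - t) * A) ((k - t) * A') (∣-resp (lemma (k - t) A A') (∣n⇒∣m*n (k - t) e)))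
      where
      lemma : ∀ k A A' → k * (A - A') ≡ k * A - k * A'
      lemma = solve-∀

    ∑-affine : ∀ {F} → Per F → ∀ d A → ¬ P ∣ A → ∑ rng (λ t → F (d + t * A)) ≡ ∑ rng F
    ∑-affine {F} per d A ¬A = trans (∑-cong rng (λ t → cong F (lemma d t A))) (trans (∑-scale (per-shift d per) A ¬A) (∑-shift per d))
      where
      lemma : ∀ d t A → d + t * A ≡ A * t + d
      lemma = solve-∀

    -- Since g ≡ 1 (mod 2), the Gauss sum is invisible modulo 2 and the multiplier can be read off.
    recover-≋ : ∀ {A B c} → A ≈ B ⊛ g ᵒ ⊞ κ c ⊛ 𝐙 → + 2 ∣ c → A ≋ B [ + 2 ]
    recover-≋ {A} {B} {c} e 2∣c = ≋-trans (≈⇒≋ e) (≋-trans (≋-⊞ (≋-⊛ (≈⇒≋ (≈-refl {B})) (≋-ᵒ g-parity))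
        (md (λ v → ∣-resp (sym (trans (cong₂ _-_ (cst-at c v) (κ-0 v)) (+-identityʳ c))) 2∣c)))
      (≈⇒≋ (≈-trans (⊞-cong (⊛-cong ≈-refl (ᵒ-κ 1ℤ)) ≈-refl) (S.solve 1 (λ b → b :* con 1ℤ :+ con 0ℤ := b) ≈-refl B))))

    -- The counts n₁ + n₃ = 2 make Σ(n₁-n₃)² divisible by 8, while the values of n₀ + n₂ are
    -- 5, 3, 3, 3, 0, 0, 0, so that Σ(n₀-n₂)² ≡ 4 (mod 8); but the two sums add up to 24.
    seven-impossible : p ≡ 7 → ∀ a b c d ε → ε * ε ≡ 1ℤ → Distinct a b c d →
      P ∣ (b - d) - + 2 * (a - d) → P ∣ (c - d) - + 4 * (a - d) → ∀ B n₀ n₁ n₂ n₃ →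
      B ≈ κ ε ⊛ four a b c d → (∀ v → 0ℤ ≤ at n₀ v) → (∀ v → 0ℤ ≤ at n₂ v) → τ n₁ ≡ P →
      n₀ ⊞ n₂ ≈ B ⊛ g ᵒ ⊞ κ (+ 2 - + 2 * ε) ⊛ 𝐙 → n₁ ⊞ n₃ ≈ κ (+ 2) ⊛ 𝐙 →
      (n₀ ⊞ ⊟ n₂) ⊛ (n₀ ⊞ ⊟ n₂) ᵒ ⊞ (n₁ ⊞ ⊟ n₃) ⊛ (n₁ ⊞ ⊟ n₃) ᵒ ≈ κ (P * + 4) ⊞ κ (- + 4) ⊛ 𝐙 → ⊥
    seven-impossible p≡7 a b c d ε ε² D eb ec B n₀ n₁ n₂ n₃ eB nn₀ nn₂ τ₁ ex ey eN = go (residue A)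
      where
      open Distinct D
      A = a - d
      U = n₀ ⊞ ⊟ n₂
      V = n₁ ⊞ ⊟ n₃
      x-at : ∀ t → at n₀ (d + t * A) + at n₂ (d + t * A) ≡ profile γ[ p ] ε A t
      x-at t = trans (sym (⊞-at n₀ n₂ v)) (trans (pt ex v) (trans (⊞-at _ _ v) (cong₂ _+_
          (trans (pt (≈-trans (⊛-cong eB ≈-refl) (⊛-assoc (κ ε) (four a b c d) (g ᵒ))) v) (trans (κ-scale ε _ v) (cong (ε *_) (trans (four-g a b c d v)
            (cong₂ _-_ (cong₂ _+_ (cong₂ _+_ (cong γ[ p ] (l₁ a d t)) (γ-per p (b - v) ((+ 2 - t) * A) (∣-resp (l₂ (+ 2) b a d t) eb))) (γ-per p (c - v) ((+ 4 - t) * A) (∣-resp (l₂ (+ 4) c a d t) ec)))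
               (cong γ[ p ] (l₃ a d t)))))))
          (cst-at (+ 2 - + 2 * ε) v))))
        where
        v = d + t * A
        l₁ : ∀ a d t → a - (d + t * (a - d)) ≡ (1ℤ - t) * (a - d)
        l₁ = solve-∀
        l₂ : ∀ k b a d t → (b - d) - k * (a - d) ≡ b - (d + t * (a - d)) - (k - t) * (a - d)
        l₂ = solve-∀
        l₃ : ∀ a d t → d - (d + t * (a - d)) ≡ (0ℤ - t) * (a - d)
        l₃ = solve-∀
      u : ℤ → ℤ
      u t = at U (d + t * A)
      u-at : ∀ v → at U v ≡ at n₀ v - at n₂ v
      u-at v = trans (⊞-at n₀ (⊟ n₂) v) (cong (_+_ (at n₀ v)) (⊟-at n₂ v))
      u-zero : ∀ t → profile γ[ p ] ε A t ≡ 0ℤ → u t ≡ 0ℤ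
      u-zero t e = trans (u-at v) (cong₂ _-_ z₀ z₂)
        where
        v = d + t * A
        s : at n₀ v + at n₂ v ≡ 0ℤ
        s = trans (x-at t) e
        z₀ : at n₀ v ≡ 0ℤ
        z₀ = ≤-antisym (subst₂ _≤_ (+-identityʳ (at n₀ v)) s (+-monoʳ-≤ (at n₀ v) (nn₂ v))) (nn₀ v)
        z₂ : at n₂ v ≡ 0ℤ
        z₂ = ≤-antisym (subst₂ _≤_ (+-identityˡ (at n₂ v)) s (+-monoˡ-≤ (at n₂ v) (nn₀ v))) (nn₂ v)
      x≋B : n₀ ⊞ n₂ ≋ B [ + 2 ]
      x≋B = recover-≋ ex (divides (1ℤ - ε) (lemma ε))
        where
        lemma : ∀ ε → + 2 - + 2 * ε ≡ (1ℤ - ε) * + 2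
        lemma = solve-∀
      B-at : ∀ v → at B v ≡ ε * (δ (v - a) + δ (v - b) + δ (v - c) - δ (v - d))
      B-at v = trans (pt eB v) (trans (κ-scale ε _ v) (cong (ε *_) (four-at a b c d v)))
      self : ∀ x → P ∣ x - x
      self x = divides 0ℤ (+-inverseʳ x)
      odd-unit : ∀ v s → s * s ≡ 1ℤ → at B v ≡ ε * s → ¬ (+ 2 ∣ at B v)
      odd-unit v s s² e = square1⇒odd (at B v) (trans (cong (λ y → y * y) e) (trans (lemma ε s) (cong₂ _*_ ε² s²)))
        where
        lemma : ∀ ε s → ε * s * (ε * s) ≡ ε * ε * (s * s)
        lemma = solve-∀
      δ4 : ∀ v {i j k l} → δ (v - a) ≡ i → δ (v - b) ≡ j → δ (v - c) ≡ k → δ (v - d) ≡ l → at B v ≡ ε * (i + j + k - l)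
      δ4 v refl refl refl refl = B-at v
      -- U = n₀ - n₂ ≡ n₀ + n₂ ≡ B (mod 2), and B is ±1 at a, b, c, d.
      U-odd : ∀ v → ¬ (+ 2 ∣ at B v) → ¬ (+ 2 ∣ at U v)
      U-odd v odd e = odd (∣-resp (lemma (at n₀ v) (at n₂ v) (at B v)) (∣m∣n⇒∣m-n (∣m∣n⇒∣m+n (∣-resp (u-at v) e) (divides (at n₂ v) refl))
          (∣-resp (cong (_- at B v) (⊞-at n₀ n₂ v)) (dv x≋B v))))
        where
        lemma : ∀ x y b → x - y + y * + 2 - (x + y - b) ≡ b
        lemma = solve-∀
      odd₁ : ¬ (+ 2 ∣ u 1ℤ)
      odd₁ = subst (λ v → ¬ (+ 2 ∣ at U v)) (l a d) (U-odd a (odd-unit a 1ℤ refl (δ4 a (δ-∣ (self a)) (δ-∤ a≢b) (δ-∤ a≢c) (δ-∤ a≢d))))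
        where
        l : ∀ a d → a ≡ d + 1ℤ * (a - d)
        l = solve-∀
      odd₂ : ¬ (+ 2 ∣ u (+ 2))
      odd₂ = subst (λ y → ¬ (+ 2 ∣ y)) (per U b _ (∣-resp (l b a d) eb))
          (U-odd b (odd-unit b 1ℤ refl (δ4 b (δ-∤ (¬∣-sym a b a≢b)) (δ-∣ (self b)) (δ-∤ b≢c) (δ-∤ b≢d))))
        where
        l : ∀ b a d → (b - d) - + 2 * (a - d) ≡ b - (d + + 2 * (a - d))
        l = solve-∀
      odd₄ : ¬ (+ 2 ∣ u (+ 4))
      odd₄ = subst (λ y → ¬ (+ 2 ∣ y)) (per U c _ (∣-resp (l c a d) ec))
          (U-odd c (odd-unit c 1ℤ refl (δ4 c (δ-∤ (¬∣-sym a c a≢c)) (δ-∤ (¬∣-sym b c b≢c)) (δ-∣ (self c)) (δ-∤ c≢d))))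
        where
        l : ∀ b a d → (b - d) - + 4 * (a - d) ≡ b - (d + + 4 * (a - d))
        l = solve-∀
      odd₀ : ¬ (+ 2 ∣ u 0ℤ)
      odd₀ = subst (λ v → ¬ (+ 2 ∣ at U v)) (l a d) (U-odd d (odd-unit d -1ℤ refl (δ4 d (δ-∤ (¬∣-sym a d a≢d)) (δ-∤ (¬∣-sym b d b≢d)) (δ-∤ (¬∣-sym c d c≢d)) (δ-∣ (self d)))))
        where
        l : ∀ a d → d ≡ d + 0ℤ * (a - d)
        l = solve-∀
      sqU : sq U ≡ ∑ (range 7) (λ t → u t * u t)
      sqU = trans (sym (∑-affine (*-per (per U) (per U)) d A a≢d)) (cong (λ n → ∑ (range n) (λ t → u t * u t)) p≡7)
      v-at : ∀ v → at V v ≡ + 2 * (at n₁ v - 1ℤ)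
      v-at v = trans (⊞-at n₁ (⊟ n₃) v) (trans (cong (_+_ (at n₁ v)) (⊟-at n₃ v)) (lemma (at n₁ v) (at n₃ v) (trans (sym (⊞-at n₁ n₃ v)) (trans (pt ey v) (cst-at (+ 2) v)))))
        where
        l : ∀ x y → x + - y ≡ + 2 * x - (x + y)
        l = solve-∀
        l' : ∀ x → + 2 * x - + 2 ≡ + 2 * (x - 1ℤ)
        l' = solve-∀
        lemma : ∀ x y → x + y ≡ + 2 → x + - y ≡ + 2 * (x - 1ℤ)
        lemma x y e = trans (l x y) (trans (cong (_-_ (+ 2 * x)) e) (l' x))
      w : ℤ → ℤ
      w v = at n₁ v - 1ℤ
      ∑w : ∑ rng w ≡ 0ℤ
      ∑w = trans (∑-- rng (at n₁) (λ _ → 1ℤ)) (trans (cong₂ _-_ (trans (sym (τ-at n₁)) τ₁) (trans (∑-const p 1ℤ) (*-identityʳ P))) (+-inverseʳ P))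
      -- V = 2w with w = n₁ - 1, and Σ w² ≡ Σ w = τ(n₁) - p = 0 (mod 2).
      8∣sqV : + 8 ∣ sq V
      8∣sqV = ∣-resp (sym eq) (*-monoʳ-∣ (+ 4) {+ 2} 2∣)
        where
        2∣ : + 2 ∣ ∑ rng (λ v → w v * w v)
        2∣ = ∣-resp (trans (∑-- rng (λ v → w v * w v) w) (trans (cong (_-_ (∑ rng (λ v → w v * w v))) ∑w) (+-identityʳ (∑ rng (λ v → w v * w v))))) (∣∑ rng (λ v → 2∣w²-w (w v)))
        lemma : ∀ w → + 2 * w * (+ 2 * w) ≡ + 4 * (w * w)
        lemma = solve-∀
        eq : sq V ≡ + 4 * ∑ rng (λ v → w v * w v)
        eq = trans (∑-cong rng (λ v → trans (cong (λ y → y * y) (v-at v)) (lemma (w v)))) (∑-*ˡ rng (+ 4) _)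
      -- The coefficient of 4p - 4𝐙 at 0 for p = 7.
      total : sq U + sq V ≡ + 24
      total = trans (cong₂ _+_ (sym (norm-at-0 U)) (sym (norm-at-0 V))) (trans (sym (⊞-at _ _ 0ℤ)) (trans (pt eN 0ℤ)
        (trans (⊞-at _ _ 0ℤ) (trans (cong₂ _+_ (trans (κ-at (P * + 4) 0ℤ) (cong (P * + 4 *_) δ0)) (cst-at (- + 4) 0ℤ)) (cong (λ n → + n * + 4 * 1ℤ + - + 4) p≡7)))))
      go : ∃[ i ] (i ℕ.< p × P ∣ A - + i) → ⊥
      go (zero  , _   , e) = a≢d (∣-resp (+-identityʳ A) e)
      go (suc i , i<p , e) = decide (subst (λ n → Profile₇ γ[ n ] ε (+ suc i)) (sym p≡7) (profile₇ ε ε² (suc i) (ℕ.s≤s ℕ.z≤n) (subst (suc i ℕ.<_) p≡7 i<p)))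
        where
        decide : Profile₇ γ[ p ] ε (+ suc i) → ⊥
        decide (inj₁ neg) = contradiction (subst (0ℤ ≤_) (trans (x-at 0ℤ) (trans (profile-per ε A (+ suc i) 0ℤ e) neg)) (+-mono-≤ (nn₀ (d + 0ℤ * A)) (nn₂ (d + 0ℤ * A)))) λ ()
        decide (inj₂ (e₃ , e₅ , e₆)) = contradiction 8∣20 (from-no (+ 8 ∣? + 20))
          where
          z : ∀ t → profile γ[ p ] ε (+ suc i) t ≡ 0ℤ → u t ≡ 0ℤ
          z t e' = u-zero t (trans (profile-per ε A (+ suc i) t e) e')
          collapse : ∀ {u₃ u₅ u₆} → u₃ ≡ 0ℤ → u₅ ≡ 0ℤ → u₆ ≡ 0ℤ → ∀ u₀ u₁ u₂ u₄ →
            u₆ * u₆ + (u₅ * u₅ + (u₄ * u₄ + (u₃ * u₃ + (u₂ * u₂ + (u₁ * u₁ + (u₀ * u₀ + 0ℤ))))))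
              ≡ (u₀ * u₀ - 1ℤ) + (u₁ * u₁ - 1ℤ) + (u₂ * u₂ - 1ℤ) + (u₄ * u₄ - 1ℤ) + + 4
          collapse refl refl refl = l
            where
            l : ∀ u₀ u₁ u₂ u₄ → 0ℤ * 0ℤ + (0ℤ * 0ℤ + (u₄ * u₄ + (0ℤ * 0ℤ + (u₂ * u₂ + (u₁ * u₁ + (u₀ * u₀ + 0ℤ))))))
              ≡ (u₀ * u₀ - 1ℤ) + (u₁ * u₁ - 1ℤ) + (u₂ * u₂ - 1ℤ) + (u₄ * u₄ - 1ℤ) + + 4
            l = solve-∀
          8∣sqU-4 : + 8 ∣ sq U - + 4
          8∣sqU-4 = ∣-resp (sym (trans (cong (_- + 4) (trans sqU (collapse {u (+ 3)} {u (+ 5)} {u (+ 6)} (z (+ 3) e₃) (z (+ 5) e₅) (z (+ 6) e₆) (u 0ℤ) (u 1ℤ) (u (+ 2)) (u (+ 4))))) (l _)))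
            (∣m∣n⇒∣m+n (∣m∣n⇒∣m+n (∣m∣n⇒∣m+n (odd-square (u 0ℤ) odd₀) (odd-square (u 1ℤ) odd₁)) (odd-square (u (+ 2)) odd₂)) (odd-square (u (+ 4)) odd₄))
            where
            l : ∀ x → x + + 4 - + 4 ≡ x
            l = solve-∀
          8∣20 : + 8 ∣ + 20
          8∣20 = ∣-resp (trans (l (sq U) (sq V)) (cong (_- + 4) total)) (∣m∣n⇒∣m+n 8∣sqU-4 8∣sqV)
            where
            l : ∀ x y → x - + 4 + y ≡ x + y - + 4
            l = solve-∀

    -- The class counts along one functional

    record Correlations (n₀ n₁ n₂ n₃ : El) : Set where
      field
        nn₀ : ∀ v → 0ℤ ≤ at n₀ v
        nn₁ : ∀ v → 0ℤ ≤ at n₁ v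
        nn₂ : ∀ v → 0ℤ ≤ at n₂ v
        nn₃ : ∀ v → 0ℤ ≤ at n₃ v
        c₀ : n₀ ⊛ n₀ ᵒ ⊞ n₁ ⊛ n₁ ᵒ ⊞ n₂ ⊛ n₂ ᵒ ⊞ n₃ ⊛ n₃ ᵒ ≈ κ (+ 4) ⊛ κ P ⊞ (κ (+ 4) ⊛ κ P ⊞ ⊟ κ (+ 4)) ⊛ 𝐙
        c₁ : n₁ ⊛ n₀ ᵒ ⊞ n₂ ⊛ n₁ ᵒ ⊞ n₃ ⊛ n₂ ᵒ ⊞ n₀ ⊛ n₃ ᵒ ≈ κ (+ 4) ⊛ κ P ⊛ 𝐙
        c₂ : n₂ ⊛ n₀ ᵒ ⊞ n₃ ⊛ n₁ ᵒ ⊞ n₀ ⊛ n₂ ᵒ ⊞ n₁ ⊛ n₃ ᵒ ≈ κ (+ 4) ⊛ κ P ⊛ 𝐙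
        c₃ : n₃ ⊛ n₀ ᵒ ⊞ n₀ ⊛ n₁ ᵒ ⊞ n₁ ⊛ n₂ ᵒ ⊞ n₂ ⊛ n₃ ᵒ ≈ κ (+ 4) ⊛ κ P ⊛ 𝐙

    ᵒ-diff : ∀ f k → (f ⊞ ⊟ k) ᵒ ≈ f ᵒ ⊞ ⊟ k ᵒ
    ᵒ-diff f k = ≈-trans (ᵒ-⊞ f (⊟ k)) (⊞-cong ≈-refl (ᵒ-⊟ k))

    τ-diff : ∀ f k → τ (f ⊞ ⊟ k) ≡ τ f - τ k
    τ-diff f k = trans (τ-⊞ f (⊟ k)) (cong (_+_ (τ f)) (τ-⊟ k))

    -- Since τ g = p, augmentation gives tp = 2εp + cp. The value of t is 4 for n and 0 for m.
    recover-const : ∀ {A B c ε} t → A ≈ B ⊛ g ᵒ ⊞ κ c ⊛ 𝐙 → τ A ≡ t * P → τ B ≡ + 2 * ε → c ≡ t - + 2 * ε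
    recover-const {A} {B} {c} {ε} t e τA τB = *-cancelˡ P P≢0 (begin
      P * c                        ≡⟨ l₁ P c (+ 2 * ε) ⟩
      (+ 2 * ε * P + c * P) - + 2 * ε * P
        ≡⟨ cong (_- + 2 * ε * P) (sym (trans (sym τA) (trans (τ-cong e) (trans (τ-⊞ (B ⊛ g ᵒ) (κ c ⊛ 𝐙))
             (cong₂ _+_ (trans (τ-⊛ B (g ᵒ)) (cong₂ _*_ τB (trans (τ-ᵒ g) τ-g))) (τ-cst c)))))) ⟩
      t * P - + 2 * ε * P          ≡⟨ l₂ t P (+ 2 * ε) ⟩
      P * (t - + 2 * ε)            ∎)
      where
      open ≡-Reasoning
      l₁ : ∀ P c e → P * c ≡ (e * P + c * P) - e * P
      l₁ = solve-∀
      l₂ : ∀ t P e → t * P - e * P ≡ P * (t - e)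
      l₂ = solve-∀

    unit-norm : ∀ {B F ε} → ε * ε ≡ 1ℤ → B ≈ κ ε ⊛ F → B ⊛ B ᵒ ≈ κ (+ 4) → F ⊛ F ᵒ ≈ κ (+ 4)
    unit-norm {B} {F} {ε} ε² e N = ≈-trans (≈-sym (≈-trans (⊛-cong ≈-refl ≈-refl)
        (≈-trans (⊛-cong (≈-trans (≈-sym (κ-* ε ε)) (κ-cong ε²)) ≈-refl) (⊛-identityˡ (F ⊛ F ᵒ)))))
      (≈-trans (S.solve 3 (λ e f f' → e :* e :* (f :* f') := (e :* f) :* (e :* f')) ≈-refl (κ ε) F (F ᵒ))
        (≈-trans (⊛-cong (≈-sym e) (≈-sym (≈-trans (ᵒ-cong e) (≈-trans (ᵒ-⊛ (κ ε) F) (⊛-cong (ᵒ-κ ε) ≈-refl))))) N))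

    module _ {a b c d : ℤ} (D : Distinct a b c d) where
      open Distinct D

      swap-cd : Distinct a b d c
      swap-cd = record { a≢d = a≢c ; b≢d = b≢c ; c≢d = ¬∣-sym c d c≢d ; a≢b = a≢b ; a≢c = a≢d ; b≢c = b≢d }

      swap-bd : Distinct a d c b
      swap-bd = record { a≢d = a≢b ; b≢d = ¬∣-sym b d b≢d ; c≢d = ¬∣-sym b c b≢c ; a≢b = a≢d ; a≢c = a≢c ; b≢c = ¬∣-sym c d c≢d }

      swap-ad : Distinct d b c a
      swap-ad = record { a≢d = ¬∣-sym a d a≢d ; b≢d = ¬∣-sym a b a≢b ; c≢d = ¬∣-sym a c a≢c ; a≢b = ¬∣-sym b d b≢d ; a≢c = ¬∣-sym c d c≢d ; b≢c = b≢c }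

      swap-bc : Distinct a c b d
      swap-bc = record { a≢d = a≢d ; b≢d = c≢d ; c≢d = b≢d ; a≢b = a≢c ; a≢c = a≢b ; b≢c = ¬∣-sym b c b≢c }

    P∣7⇒p≡7 : P ∣ + 7 → p ≡ 7
    P∣7⇒p≡7 e = go (prime⇒irreducible prime-7 (∣⇒∣ᵤ e))
      where
      go : p ≡ 1 ⊎ p ≡ 7 → p ≡ 7
      go (inj₁ p≡1) = contradiction (sym p≡1) (ℕₚ.<⇒≢ 1<p)
      go (inj₂ p≡7) = p≡7

    -- Numbers of equal parity have squares congruent modulo 4. This lets information modulo 2
    -- contradict an exact norm.
    sq-mod4 : ∀ {f r} → f ≋ r [ + 2 ] → + 4 ∣ sq f - sq r
    sq-mod4 {f} {r} e = ∣-resp (∑-- rng (λ v → at f v * at f v) (λ v → at r v * at r v)) (∣∑ rng term)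
      where
      lemma : ∀ x y k → x - y ≡ k * + 2 → x * x - y * y ≡ k * (y + k) * + 4
      lemma x y k e = trans (l₁ x y) (trans (cong₂ _*_ e (cong (_+ + 2 * y) e)) (l₂ y k))
        where
        l₁ : ∀ x y → x * x - y * y ≡ (x - y) * (x - y + + 2 * y)
        l₁ = solve-∀
        l₂ : ∀ y k → k * + 2 * (k * + 2 + + 2 * y) ≡ k * (y + k) * + 4
        l₂ = solve-∀
      term : ∀ v → + 4 ∣ at f v * at f v - at r v * at r v
      term v = divides (quotient (dv e v) * (at r v + quotient (dv e v))) (lemma (at f v) (at r v) (quotient (dv e v)) (_∣_.equality (dv e v)))

    sq-pair : ∀ a b → ¬ P ∣ a - b → sq ([ a ] ⊞ [ b ]) ≡ + 2
    sq-pair a b ¬e = trans (∑-cong rng term) (trans (∑-+ rng (λ v → δ (v - a)) (λ v → δ (v - b)))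
        (cong₂ _+_ (trans (∑-shift δ-per (- a)) ∑-δ) (trans (∑-shift δ-per (- b)) ∑-δ)))
      where
      idem : ∀ i j → i * i ≡ i → j * j ≡ j → i * j ≡ 0ℤ → (i + j) * (i + j) ≡ i + j
      idem i j ei ej ij = trans (l i j) (trans (cong₂ (λ x y → x + y + + 2 * (i * j)) ei ej) (trans (cong (λ x → i + j + + 2 * x) ij) (+-identityʳ (i + j))))
        where
        l : ∀ i j → (i + j) * (i + j) ≡ i * i + j * j + + 2 * (i * j)
        l = solve-∀
      δ² : ∀ v → δ v * δ v ≡ δ v
      δ² v with P ∣? v
      ... | yes e = trans (cong₂ _*_ (δ-∣ e) (δ-∣ e)) (sym (δ-∣ e))
      ... | no ¬e = trans (cong₂ _*_ (δ-∤ ¬e) (δ-∤ ¬e)) (sym (δ-∤ ¬e))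
      disjoint : ∀ v → δ (v - a) * δ (v - b) ≡ 0ℤ
      disjoint v with P ∣? (v - a)
      ... | no ¬e' = trans (cong (_* δ (v - b)) (δ-∤ ¬e')) (*-zeroˡ (δ (v - b)))
      ... | yes e' = trans (cong (δ (v - a) *_) (δ-∤ (λ e'' → ¬e (∣-resp (l v a b) (∣m∣n⇒∣m-n e'' e'))))) (*-zeroʳ (δ (v - a)))
        where
        l : ∀ v a b → v - b - (v - a) ≡ a - b
        l = solve-∀
      term : ∀ v → at ([ a ] ⊞ [ b ]) v * at ([ a ] ⊞ [ b ]) v ≡ δ (v - a) + δ (v - b)
      term v = trans (cong (λ x → x * x) (trans (⊞-at [ a ] [ b ] v) (cong₂ _+_ ([]-at a v) ([]-at b v))))
        (idem (δ (v - a)) (δ (v - b)) (δ² (v - a)) (δ² (v - b)) (disjoint v))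

    2∣ε-ε' : ∀ {ε ε'} → ε * ε ≡ 1ℤ → ε' * ε' ≡ 1ℤ → + 2 ∣ ε - ε'
    2∣ε-ε' {ε} {ε'} e e' with square≡1 ε e | square≡1 ε' e'
    ... | inj₁ refl | inj₁ refl = divides 0ℤ refl
    ... | inj₁ refl | inj₂ refl = divides 1ℤ refl
    ... | inj₂ refl | inj₁ refl = divides -1ℤ refl
    ... | inj₂ refl | inj₂ refl = divides 0ℤ refl

    module Counts (n₀ n₁ n₂ n₃ : El) (Co : Correlations n₀ n₁ n₂ n₃) where
      open Correlations Co
      -- n and m belong to the trivial and the quadratic character of ℤ₄; U and V are the two parts
      -- of the value under a character of order 4.
      n m x y U V : El
      x = n₀ ⊞ n₂
      y = n₁ ⊞ n₃
      n = x ⊞ y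
      m = x ⊞ ⊟ y
      U = n₀ ⊞ ⊟ n₂
      V = n₁ ⊞ ⊟ n₃

      -- By the augmentations of c₀ and c₁, both Σ Nᵢ² and Σ NᵢNᵢ₊₁ are 4p², so Σ (Nᵢ₊₁ - Nᵢ)² = 0.
      -- The four sizes therefore agree, and 4N² = 4p² with N nonnegative.
      totals : τ n₀ ≡ P × τ n₁ ≡ P × τ n₂ ≡ P × τ n₃ ≡ P
      totals = N₀≡P , trans N₁≡N₀ N₀≡P , trans N₂≡N₁ (trans N₁≡N₀ N₀≡P) , trans (sym N₀≡N₃) N₀≡P
        where
        N₀ = τ n₀
        N₁ = τ n₁
        N₂ = τ n₂
        N₃ = τ n₃
        τ4 : ∀ a b c d a' b' c' d' → τ (a ⊛ a' ᵒ ⊞ b ⊛ b' ᵒ ⊞ c ⊛ c' ᵒ ⊞ d ⊛ d' ᵒ) ≡ τ a * τ a' + τ b * τ b' + τ c * τ c' + τ d * τ d'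
        τ4 a b c d a' b' c' d' = trans (τ-⊞ _ _) (cong₂ _+_ (trans (τ-⊞ _ _) (cong₂ _+_ (trans (τ-⊞ _ _) (cong₂ _+_ (f a a') (f b b'))) (f c c'))) (f d d'))
          where
          f : ∀ a a' → τ (a ⊛ a' ᵒ) ≡ τ a * τ a'
          f a a' = trans (τ-⊛ a (a' ᵒ)) (cong (τ a *_) (τ-ᵒ a'))
        τ4P : τ (κ (+ 4) ⊛ κ P) ≡ + 4 * P
        τ4P = trans (τ-⊛ (κ (+ 4)) (κ P)) (cong₂ _*_ (τ-κ (+ 4)) (τ-κ P))
        e₀ : N₀ * N₀ + N₁ * N₁ + N₂ * N₂ + N₃ * N₃ ≡ + 4 * P + (+ 4 * P - + 4) * P
        e₀ = trans (sym (τ4 n₀ n₁ n₂ n₃ n₀ n₁ n₂ n₃)) (trans (τ-cong c₀) (trans (τ-⊞ _ _) (cong₂ _+_ τ4P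
          (trans (τ-⊛ _ 𝐙) (cong₂ _*_ (trans (τ-diff _ _) (cong₂ _-_ τ4P (τ-κ (+ 4)))) τ-𝐙)))))
        e₁ : N₁ * N₀ + N₂ * N₁ + N₃ * N₂ + N₀ * N₃ ≡ + 4 * P * P
        e₁ = trans (sym (τ4 n₁ n₂ n₃ n₀ n₀ n₁ n₂ n₃)) (trans (τ-cong c₁) (trans (τ-⊛ _ 𝐙) (cong₂ _*_ τ4P τ-𝐙)))
        diffs : List ℤ
        diffs = N₁ - N₀ ∷ N₂ - N₁ ∷ N₃ - N₂ ∷ N₀ - N₃ ∷ []
        squares : ∑ diffs (λ x → x * x) ≡ 0ℤ
        squares = trans (l N₀ N₁ N₂ N₃) (trans (cong₂ (λ s t → + 2 * s - + 2 * t) e₀ e₁) (l' P))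
          where
          l : ∀ a b c d → (b - a) * (b - a) + ((c - b) * (c - b) + ((d - c) * (d - c) + ((a - d) * (a - d) + 0ℤ)))
            ≡ + 2 * (a * a + b * b + c * c + d * d) - + 2 * (b * a + c * b + d * c + a * d)
          l = solve-∀
          l' : ∀ P → + 2 * (+ 4 * P + (+ 4 * P - + 4) * P) - + 2 * (+ 4 * P * P) ≡ 0ℤ
          l' = solve-∀
        equal : ∀ {a b} → a - b ∈ diffs → a ≡ b
        equal {a} {b} i = i-j≡0⇒i≡j a b (∑-square≡0 diffs (λ x → x) squares i)
        N₁≡N₀ : N₁ ≡ N₀
        N₁≡N₀ = equal (here refl)
        N₂≡N₁ : N₂ ≡ N₁
        N₂≡N₁ = equal (there (here refl))
        N₀≡N₃ : N₀ ≡ N₃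
        N₀≡N₃ = equal (there (there (there (here refl))))
        nonneg : 0ℤ ≤ N₀
        nonneg = subst (0ℤ ≤_) (sym (τ-at n₀)) (∑-nonneg rng nn₀)
        product : (N₀ - P) * (N₀ + P) ≡ 0ℤ
        product = *-cancelˡ (+ 4) (λ ()) (trans (l N₀ P) (trans (cong (_- + 4 * P * P) (trans (sym (subs N₁≡N₀ (trans N₂≡N₁ N₁≡N₀) (sym N₀≡N₃))) e₁)) (+-inverseʳ (+ 4 * P * P))))
          where
          subs : ∀ {a b c} → a ≡ N₀ → b ≡ N₀ → c ≡ N₀ → a * N₀ + b * a + c * b + N₀ * c ≡ N₀ * N₀ + N₀ * N₀ + N₀ * N₀ + N₀ * N₀
          subs refl refl refl = refl
          l : ∀ N P → + 4 * ((N - P) * (N + P)) ≡ N * N + N * N + N * N + N * N - + 4 * P * P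
          l = solve-∀
        N₀≡P : N₀ ≡ P
        N₀≡P = go (i*j≡0⇒i≡0∨j≡0 (N₀ - P) product)
          where
          go : N₀ - P ≡ 0ℤ ⊎ N₀ + P ≡ 0ℤ → N₀ ≡ P
          go (inj₁ e) = i-j≡0⇒i≡j N₀ P e
          go (inj₂ e) = contradiction (≤-antisym (subst (P ≤_) e (subst (_≤ N₀ + P) (+-identityˡ P) (+-monoˡ-≤ P nonneg))) (+≤+ ℕ.z≤n)) P≢0

      τU : τ U ≡ 0ℤ
      τU = trans (τ-diff n₀ n₂) (trans (cong₂ _-_ (proj₁ totals) (proj₁ (proj₂ (proj₂ totals)))) (+-inverseʳ P))

      τV : τ V ≡ 0ℤ
      τV = trans (τ-diff n₁ n₃) (trans (cong₂ _-_ (proj₁ (proj₂ totals)) (proj₂ (proj₂ (proj₂ totals)))) (+-inverseʳ P))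

      τx : τ x ≡ P + P
      τx = trans (τ-⊞ n₀ n₂) (cong₂ _+_ (proj₁ totals) (proj₁ (proj₂ (proj₂ totals))))

      τy : τ y ≡ P + P
      τy = trans (τ-⊞ n₁ n₃) (cong₂ _+_ (proj₁ (proj₂ totals)) (proj₂ (proj₂ (proj₂ totals))))

      κP4 : κ (P * + 4) ≈ κ (+ 4) ⊛ κ P
      κP4 = ≈-trans (κ-* P (+ 4)) (⊛-comm (κ P) (κ (+ 4)))

      UV-norm : U ⊛ U ᵒ ⊞ V ⊛ V ᵒ ≈ κ (P * + 4) ⊞ κ (- + 4) ⊛ 𝐙
      UV-norm = ≈-trans (⊞-cong (⊛-cong ≈-refl (ᵒ-diff n₀ n₂)) (⊛-cong ≈-refl (ᵒ-diff n₁ n₃)))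
        (≈-trans (S.solve 8 (λ a b c d a' b' c' d' → (a :- c) :* (a' :- c') :+ (b :- d) :* (b' :- d')
            := (a :* a' :+ b :* b' :+ c :* c' :+ d :* d') :- (c :* a' :+ d :* b' :+ a :* c' :+ b :* d')) ≈-refl n₀ n₁ n₂ n₃ (n₀ ᵒ) (n₁ ᵒ) (n₂ ᵒ) (n₃ ᵒ))
          (≈-trans (⊞-cong c₀ (⊟-cong c₂)) (≈-trans
            (S.solve 2 (λ p z → (con (+ 4) :* p :+ (con (+ 4) :* p :- con (+ 4)) :* z) :- con (+ 4) :* p :* z := con (+ 4) :* p :+ con (- + 4) :* z) ≈-refl (κ P) 𝐙)
            (⊞-cong (≈-sym κP4) ≈-refl))))

      -- The imaginary part of |U + iV|², while `UV-norm` is the real part; it vanishes because c₁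
      -- and c₃ have the same right-hand side.
      UV-symmetric : U ⊛ V ᵒ ⊞ ⊟ (V ⊛ U ᵒ) ≈ κ 0ℤ
      UV-symmetric = ≈-trans (⊞-cong (⊛-cong ≈-refl (ᵒ-diff n₁ n₃)) (⊟-cong (⊛-cong ≈-refl (ᵒ-diff n₀ n₂))))
        (≈-trans (S.solve 8 (λ a b c d a' b' c' d' → (a :- c) :* (b' :- d') :- (b :- d) :* (a' :- c')
            := (d :* a' :+ a :* b' :+ b :* c' :+ c :* d') :- (b :* a' :+ c :* b' :+ d :* c' :+ a :* d')) ≈-refl n₀ n₁ n₂ n₃ (n₀ ᵒ) (n₁ ᵒ) (n₂ ᵒ) (n₃ ᵒ))
          (≈-trans (⊞-cong c₃ (⊟-cong c₁)) (S.solve 1 (λ t → t :- t := con 0ℤ) ≈-refl (κ (+ 4) ⊛ κ P ⊛ 𝐙))))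

      ᵒ-x : x ᵒ ≈ n₀ ᵒ ⊞ n₂ ᵒ
      ᵒ-x = ᵒ-⊞ n₀ n₂

      ᵒ-y : y ᵒ ≈ n₁ ᵒ ⊞ n₃ ᵒ
      ᵒ-y = ᵒ-⊞ n₁ n₃

      En Em : El
      En = κ (+ 4) ⊛ κ P ⊞ ⊟ κ (+ 4) ⊞ κ (+ 12) ⊛ κ P
      Em = ⊟ κ (+ 4)

      n-norm : n ⊛ n ᵒ ≈ κ (P * + 4) ⊞ κ (τ En) ⊛ 𝐙
      n-norm = ≈-trans (⊛-cong ≈-refl (≈-trans (ᵒ-⊞ x y) (⊞-cong ᵒ-x ᵒ-y)))
        (≈-trans (S.solve 8 (λ a b c d a' b' c' d' → ((a :+ c) :+ (b :+ d)) :* ((a' :+ c') :+ (b' :+ d'))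
            := (a :* a' :+ b :* b' :+ c :* c' :+ d :* d') :+ (b :* a' :+ c :* b' :+ d :* c' :+ a :* d')
               :+ (c :* a' :+ d :* b' :+ a :* c' :+ b :* d') :+ (d :* a' :+ a :* b' :+ b :* c' :+ c :* d')) ≈-refl n₀ n₁ n₂ n₃ (n₀ ᵒ) (n₁ ᵒ) (n₂ ᵒ) (n₃ ᵒ))
          (≈-trans (⊞-cong (⊞-cong (⊞-cong c₀ c₁) c₂) c₃) (≈-trans
            (S.solve 2 (λ p z → (con (+ 4) :* p :+ (con (+ 4) :* p :- con (+ 4)) :* z) :+ con (+ 4) :* p :* z :+ con (+ 4) :* p :* z :+ con (+ 4) :* p :* z
                := con (+ 4) :* p :+ (con (+ 4) :* p :- con (+ 4) :+ con (+ 12) :* p) :* z) ≈-refl (κ P) 𝐙)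
            (⊞-cong (≈-sym κP4) (⊛-𝐙 En)))))

      m-norm : m ⊛ m ᵒ ≈ κ (P * + 4) ⊞ κ (τ Em) ⊛ 𝐙
      m-norm = ≈-trans (⊛-cong ≈-refl (≈-trans (ᵒ-diff x y) (⊞-cong ᵒ-x (⊟-cong ᵒ-y))))
        (≈-trans (S.solve 8 (λ a b c d a' b' c' d' → ((a :+ c) :- (b :+ d)) :* ((a' :+ c') :- (b' :+ d'))
            := (a :* a' :+ b :* b' :+ c :* c' :+ d :* d') :- (b :* a' :+ c :* b' :+ d :* c' :+ a :* d')
               :+ (c :* a' :+ d :* b' :+ a :* c' :+ b :* d') :- (d :* a' :+ a :* b' :+ b :* c' :+ c :* d')) ≈-refl n₀ n₁ n₂ n₃ (n₀ ᵒ) (n₁ ᵒ) (n₂ ᵒ) (n₃ ᵒ))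
          (≈-trans (⊞-cong (⊞-cong (⊞-cong c₀ (⊟-cong c₁)) c₂) (⊟-cong c₃)) (≈-trans
            (S.solve 2 (λ p z → (con (+ 4) :* p :+ (con (+ 4) :* p :- con (+ 4)) :* z) :- con (+ 4) :* p :* z :+ con (+ 4) :* p :* z :- con (+ 4) :* p :* z
                := con (+ 4) :* p :+ (:- con (+ 4)) :* z) ≈-refl (κ P) 𝐙)
            (⊞-cong (≈-sym κP4) (⊛-𝐙 Em)))))

    -- Excluding multipliers with an odd coefficient.

    module _ (n₀ n₁ n₂ n₃ : El) (Co : Correlations n₀ n₁ n₂ n₃) where
      open Counts n₀ n₁ n₂ n₃ Co
      open Correlations Co

      module OddCase (ε ε' : ℤ) (ε² : ε * ε ≡ 1ℤ) (ε'² : ε' * ε' ≡ 1ℤ) (B C : El)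
          (B-norm : B ⊛ B ᵒ ≈ κ (+ 4)) (C-norm : C ⊛ C ᵒ ≈ κ (+ 4)) (τC : τ C ≡ + 2 * ε')
          (n≈ : n ≈ B ⊛ g ᵒ ⊞ κ (+ 4 - + 2 * ε) ⊛ 𝐙) (m≈ : m ≈ C ⊛ g ᵒ ⊞ κ (0ℤ - + 2 * ε') ⊛ 𝐙) (C≋B : C ≋ B [ + 2 ]) where

        constants : κ (+ 4 - + 2 * ε) ≈ κ (+ 2 - + 2 * ε) ⊞ κ (+ 2)
        constants = ≈-trans (κ-cong (l ε)) (κ-+ (+ 2 - + 2 * ε) (+ 2))
          where
          l : ∀ ε → + 4 - + 2 * ε ≡ + 2 - + 2 * ε + + 2
          l = solve-∀

        rest : ∀ {z w} → z ≈ κ (+ 2) ⊛ 𝐙 → n ≈ w ⊞ z → w ≈ B ⊛ g ᵒ ⊞ κ (+ 2 - + 2 * ε) ⊛ 𝐙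
        rest {z} {w} ez e = ≈-trans (S.solve 2 (λ w z → w := (w :+ z) :- z) ≈-refl w z) (≈-trans (⊞-cong (≈-trans (≈-sym e) (≈-trans n≈
            (⊞-cong ≈-refl (⊛-cong constants ≈-refl)))) (⊟-cong ez))
          (S.solve 3 (λ b k z → (b :+ (k :+ con (+ 2)) :* z) :- con (+ 2) :* z := b :+ k :* z) ≈-refl (B ⊛ g ᵒ) (κ (+ 2 - + 2 * ε)) 𝐙))

        half-constant : ∀ {z B' k} → κ (+ 2) ⊛ z ≈ B' ⊛ g ᵒ ⊞ κ k ⊛ 𝐙 → B' ≈ κ 0ℤ → k ≡ + 4 → z ≈ κ (+ 2) ⊛ 𝐙
        half-constant {z} {B'} e eB refl = κ-cancel (+ 2) (λ ()) (≈-trans e (≈-trans (⊞-cong (⊛-cong eB ≈-refl) ≈-refl)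
          (S.solve 2 (λ g z → con 0ℤ :* g :+ con (+ 4) :* z := con (+ 2) :* (con (+ 2) :* z)) ≈-refl (g ᵒ) 𝐙)))

        -- B and C are ± the same element. If the signs agree, the Gauss sum cancels in n - m = 2y
        -- and y is the constant 2; if they differ, it cancels in n + m = 2x and the classes 0, 2
        -- change roles with 1, 3.
        final : ∀ a b c d → p ≡ 7 → Distinct a b c d → P ∣ (b - d) - + 2 * (a - d) → P ∣ (c - d) - + 4 * (a - d) →
          B ≈ κ ε ⊛ four a b c d → C ≈ κ ε' ⊛ four a b c d → ⊥
        final a b c d p≡7 D eb ec eB eC = go (square≡1 (ε * ε') (trans (l ε ε') (cong₂ _*_ ε² ε'²)))
          where
          l : ∀ ε ε' → ε * ε' * (ε * ε') ≡ ε * ε * (ε' * ε')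
          l = solve-∀
          F = four a b c d
          ε'≡ : ∀ s → ε * ε' ≡ s → ε' ≡ ε * s
          ε'≡ s e = trans (sym (trans (cong (_* ε') ε²) (*-identityˡ ε'))) (trans (*-assoc ε ε ε') (cong (ε *_) e))
          go : ε * ε' ≡ 1ℤ ⊎ ε * ε' ≡ -1ℤ → ⊥
          go (inj₁ e) = seven-impossible p≡7 a b c d ε ε² D eb ec B n₀ n₁ n₂ n₃ eB nn₀ nn₂ (proj₁ (proj₂ totals)) (rest y≈ ≈-refl) y≈ UV-norm
            where
            y≈ : y ≈ κ (+ 2) ⊛ 𝐙
            y≈ = half-constant {y} {B ⊞ ⊟ C} {+ 4 - + 2 * ε - (0ℤ - + 2 * ε')} (≈-trans
                (S.solve 2 (λ x y → con (+ 2) :* y := (x :+ y) :- (x :- y)) ≈-refl x y) (≈-trans (⊞-cong n≈ (⊟-cong m≈)) (≈-trans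
                  (S.solve 6 (λ b c g k k' z → (b :* g :+ k :* z) :- (c :* g :+ k' :* z) := (b :- c) :* g :+ (k :- k') :* z) ≈-refl B C (g ᵒ) (κ (+ 4 - + 2 * ε)) (κ (0ℤ - + 2 * ε')) 𝐙)
                  (⊞-cong ≈-refl (⊛-cong (≈-sym (≈-trans (κ-+ (+ 4 - + 2 * ε) (- (0ℤ - + 2 * ε'))) (⊞-cong ≈-refl (κ-neg (0ℤ - + 2 * ε'))))) ≈-refl)))))
              (≈-trans (⊞-cong eB (⊟-cong (≈-trans eC (⊛-cong (κ-cong (trans (ε'≡ 1ℤ e) (*-identityʳ ε))) ≈-refl))))
                (S.solve 1 (λ t → t :- t := con 0ℤ) ≈-refl (κ ε ⊛ F)))
              (trans (cong (λ t → + 4 - + 2 * ε - (0ℤ - + 2 * t)) (trans (ε'≡ 1ℤ e) (*-identityʳ ε))) (l' ε))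
              where
              l' : ∀ ε → + 4 - + 2 * ε - (0ℤ - + 2 * ε) ≡ + 4
              l' = solve-∀
          go (inj₂ e) = seven-impossible p≡7 a b c d ε ε² D eb ec B n₁ n₀ n₃ n₂ eB nn₁ nn₃ (proj₁ totals) (rest x≈ (⊞-comm x y)) x≈
              (≈-trans (⊞-comm (V ⊛ V ᵒ) (U ⊛ U ᵒ)) UV-norm)
            where
            ε'≡-ε : ε' ≡ - ε
            ε'≡-ε = trans (ε'≡ -1ℤ e) (l'' ε)
              where
              l'' : ∀ ε → ε * -1ℤ ≡ - ε
              l'' = solve-∀
            x≈ : x ≈ κ (+ 2) ⊛ 𝐙
            x≈ = half-constant {x} {B ⊞ C} {+ 4 - + 2 * ε + (0ℤ - + 2 * ε')} (≈-trans
                (S.solve 2 (λ x y → con (+ 2) :* x := (x :+ y) :+ (x :- y)) ≈-refl x y) (≈-trans (⊞-cong n≈ m≈) (≈-trans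
                  (S.solve 6 (λ b c g k k' z → (b :* g :+ k :* z) :+ (c :* g :+ k' :* z) := (b :+ c) :* g :+ (k :+ k') :* z) ≈-refl B C (g ᵒ) (κ (+ 4 - + 2 * ε)) (κ (0ℤ - + 2 * ε')) 𝐙)
                  (⊞-cong ≈-refl (⊛-cong (≈-sym (κ-+ (+ 4 - + 2 * ε) (0ℤ - + 2 * ε'))) ≈-refl)))))
              (≈-trans (⊞-cong eB (≈-trans eC (⊛-cong (≈-trans (κ-cong ε'≡-ε) (κ-neg ε)) ≈-refl)))
                (S.solve 2 (λ t f → t :* f :+ (:- t) :* f := con 0ℤ) ≈-refl (κ ε) F))
              (trans (cong (λ t → + 4 - + 2 * ε + (0ℤ - + 2 * t)) ε'≡-ε) (l' ε))
              where
              l' : ∀ ε → + 4 - + 2 * ε + (0ℤ - + 2 * - ε) ≡ + 4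
              l' = solve-∀

        C-odd : ∀ v s → s * s ≡ 1ℤ → at B v ≡ ε * s → ¬ (+ 2 ∣ at C v)
        C-odd v s s² e d = square1⇒odd (at B v) (trans (cong (λ t → t * t) e) (trans (l ε s) (cong₂ _*_ ε² s²)))
            (∣-resp (l' (at C v) (at B v)) (∣m∣n⇒∣m-n d (dv C≋B v)))
          where
          l : ∀ ε s → ε * s * (ε * s) ≡ ε * ε * (s * s)
          l = solve-∀
          l' : ∀ c b → c - (c - b) ≡ b
          l' = solve-∀

        -- C is odd at the same four points as B. The negated point must also be the same: e₁ ≡ 0
        -- relative to d and relative to another of the points gives 4 times their difference ≡ 0.
        impossible : ∀ a b c d → Distinct a b c d → B ≈ κ ε ⊛ four a b c d → ⊥
        impossible a b c d D eB = arrange (four-signs ε' ε'² τC units)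
          where
          open Distinct D
          self : ∀ x → P ∣ x - x
          self x = divides 0ℤ (+-inverseʳ x)
          val : ∀ v {i j k l} → δ (v - a) ≡ i → δ (v - b) ≡ j → δ (v - c) ≡ k → δ (v - d) ≡ l → at B v ≡ ε * (i + j + k - l)
          val v refl refl refl refl = trans (pt eB v) (trans (κ-scale ε (four a b c d) v) (cong (ε *_) (four-at a b c d v)))
          units : FourUnits C a b c d
          units = odd-four C a b c d D (norm⇒sq C-norm)
            (C-odd a 1ℤ refl (val a (δ-∣ (self a)) (δ-∤ a≢b) (δ-∤ a≢c) (δ-∤ a≢d)))
            (C-odd b 1ℤ refl (val b (δ-∤ (¬∣-sym a b a≢b)) (δ-∣ (self b)) (δ-∤ b≢c) (δ-∤ b≢d)))
            (C-odd c 1ℤ refl (val c (δ-∤ (¬∣-sym a c a≢c)) (δ-∤ (¬∣-sym b c b≢c)) (δ-∣ (self c)) (δ-∤ c≢d)))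
            (C-odd d -1ℤ refl (val d (δ-∤ (¬∣-sym a d a≢d)) (δ-∤ (¬∣-sym b d b≢d)) (δ-∤ (¬∣-sym c d c≢d)) (δ-∣ (self d))))
          info : P ∣ (a - d) + (b - d) + (c - d) × P ∣ (a - d) * (a - d) + (a - d) * (b - d) + (b - d) * (b - d) × P ∣ + 7
          info = four-norm4 a b c d D (unit-norm ε² eB B-norm)
          e₁ = proj₁ info
          p≡7 : p ≡ 7
          p≡7 = P∣7⇒p≡7 (proj₂ (proj₂ info))
          ¬4* : ∀ t → ¬ P ∣ t → ¬ P ∣ + 2 * (+ 2 * t)
          ¬4* t ¬t e = ¬t (P∣2* t (P∣2* (+ 2 * t) e))
          arrange : C ≈ κ ε' ⊛ four a b c d ⊎ C ≈ κ ε' ⊛ four a b d c ⊎ C ≈ κ ε' ⊛ four a d c b ⊎ C ≈ κ ε' ⊛ four d b c a → ⊥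
          arrange (inj₁ eC) = choose (euclid ((b - d) - + 2 * (a - d)) ((b - d) - + 4 * (a - d)) (∣-combine (proj₁ (proj₂ info))
              (∣m⇒∣m*n ((a - d) * (a - d) - (a - d) * (b - d)) (proj₂ (proj₂ info))) (l (a - d) (b - d))))
            where
            -- Modulo 7 the form x² + xy + y² splits, with slopes 2 and 4, the primitive cube roots
            -- of unity. One of b-d, c-d is 2(a-d) and the other 4(a-d).
            l : ∀ x y → x * x + x * y + y * y + + 7 * (x * x - x * y) ≡ (y - + 2 * x) * (y - + 4 * x)
            l = solve-∀
            third : ∀ k k' → (∀ x y z → x + y + z + - (y - k * x) + - (+ 7 * x) ≡ z - k' * x) →
              P ∣ (b - d) - k * (a - d) → P ∣ (c - d) - k' * (a - d)
            third k k' l' e = ∣-combine (∣-combine e₁ (∣m⇒∣-m e) refl) (∣m⇒∣-m (∣m⇒∣m*n (a - d) (proj₂ (proj₂ info)))) (l' (a - d) (b - d) (c - d))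
            choose : P ∣ (b - d) - + 2 * (a - d) ⊎ P ∣ (b - d) - + 4 * (a - d) → ⊥
            choose (inj₁ e) = final a b c d p≡7 D e (third (+ 2) (+ 4) l' e) eB eC
              where
              l' : ∀ x y z → x + y + z + - (y - + 2 * x) + - (+ 7 * x) ≡ z - + 4 * x
              l' = solve-∀
            choose (inj₂ e) = final a c b d p≡7 (swap-bc D) (third (+ 4) (+ 2) l' e) e (≈-trans eB (⊛-cong ≈-refl sw)) (≈-trans eC (⊛-cong ≈-refl sw))
              where
              l' : ∀ x y z → x + y + z + - (y - + 4 * x) + - (+ 7 * x) ≡ z - + 2 * x
              l' = solve-∀
              sw : four a b c d ≈ four a c b d
              sw = S.solve 4 (λ a b c d → a :+ b :+ c :- d := a :+ c :+ b :- d) ≈-refl [ a ] [ b ] [ c ] [ d ]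
          arrange (inj₂ (inj₁ eC)) = ¬4* (d - c) (¬∣-sym c d c≢d) (∣-resp (l a b c d)
              (∣m∣n⇒∣m-n (proj₁ (four-norm4 a b d c (swap-cd D) (unit-norm ε'² eC C-norm))) e₁))
            where
            l : ∀ a b c d → (a - c) + (b - c) + (d - c) - ((a - d) + (b - d) + (c - d)) ≡ + 2 * (+ 2 * (d - c))
            l = solve-∀
          arrange (inj₂ (inj₂ (inj₁ eC))) = ¬4* (d - b) (¬∣-sym b d b≢d) (∣-resp (l a b c d)
              (∣m∣n⇒∣m-n (proj₁ (four-norm4 a d c b (swap-bd D) (unit-norm ε'² eC C-norm))) e₁))
            where
            l : ∀ a b c d → (a - b) + (d - b) + (c - b) - ((a - d) + (b - d) + (c - d)) ≡ + 2 * (+ 2 * (d - b))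
            l = solve-∀
          arrange (inj₂ (inj₂ (inj₂ eC))) = ¬4* (d - a) (¬∣-sym a d a≢d) (∣-resp (l a b c d)
              (∣m∣n⇒∣m-n (proj₁ (four-norm4 d b c a (swap-ad D) (unit-norm ε'² eC C-norm))) e₁))
            where
            l : ∀ a b c d → (d - a) + (b - a) + (c - a) - ((a - d) + (b - d) + (c - d)) ≡ + 2 * (+ 2 * (d - a))
            l = solve-∀

        contradict : τ B ≡ + 2 * ε → ∃[ a ] ¬ (+ 2 ∣ at B a) → ⊥
        contradict τB odd = go (find-four B (norm⇒sq B-norm) odd)
          where
          go : ∃[ a ] ∃[ b ] ∃[ c ] ∃[ d ] (Distinct a b c d × FourUnits B a b c d) → ⊥
          go (a , b , c , d , D , F) = arrange (four-signs ε ε² τB F)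
            where
            arrange : B ≈ κ ε ⊛ four a b c d ⊎ B ≈ κ ε ⊛ four a b d c ⊎ B ≈ κ ε ⊛ four a d c b ⊎ B ≈ κ ε ⊛ four d b c a → ⊥
            arrange (inj₁ e)               = impossible a b c d D e
            arrange (inj₂ (inj₁ e))        = impossible a b d c (swap-cd D) e
            arrange (inj₂ (inj₂ (inj₁ e))) = impossible a d c b (swap-bd D) e
            arrange (inj₂ (inj₂ (inj₂ e))) = impossible d b c a (swap-ad D) e

    -- Even multipliers and the characters of order four.

    P-odd : P ≡ 1ℤ + + h * + 2
    P-odd = trans (cong +_ p-odd) (l (+ h))
      where
      l : ∀ h → 1ℤ + (h + h) ≡ 1ℤ + h * + 2
      l = solve-∀

    module _ (n₀ n₁ n₂ n₃ : El) (Co : Correlations n₀ n₁ n₂ n₃) where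
      open Counts n₀ n₁ n₂ n₃ Co

      module EvenCase (ε ε' β γ j j' : ℤ) (ε² : ε * ε ≡ 1ℤ) (ε'² : ε' * ε' ≡ 1ℤ) (β² : β * β ≡ 1ℤ) (γ² : γ * γ ≡ 1ℤ)
          (n≈ : n ≈ κ (+ 2) ⊛ (κ β ⊛ [ j ]) ⊛ g ᵒ ⊞ κ (+ 4 - + 2 * ε) ⊛ 𝐙)
          (m≈ : m ≈ κ (+ 2) ⊛ (κ γ ⊛ [ j' ]) ⊛ g ᵒ ⊞ κ (0ℤ - + 2 * ε') ⊛ 𝐙) where

        -- n' is half of n, X is (U+V)/2 and Y is (V-U)/2. Then X² + Y² is an integral expression
        -- for (U² + V²)/2. F is the multiplier of y = n₁ + n₃.
        F n' X Y Z' : El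
        F = κ β ⊛ [ j ] ⊞ ⊟ (κ γ ⊛ [ j' ])
        n' = κ β ⊛ [ j ] ⊛ g ᵒ ⊞ κ (+ 2 - ε) ⊛ 𝐙
        X = n' ⊞ ⊟ (n₂ ⊞ n₃)
        Y = V ⊞ ⊟ X
        Z' = X ⊛ X ⊞ Y ⊛ Y

        halve-κ : ∀ {k l} → k ≡ + 2 * l → κ k ≈ κ (+ 2) ⊛ κ l
        halve-κ {k} {l} e = ≈-trans (κ-cong e) (κ-* (+ 2) l)

        n≈2n' : n ≈ κ (+ 2) ⊛ n'
        n≈2n' = ≈-trans n≈ (≈-trans (⊞-cong ≈-refl (⊛-cong (halve-κ (l ε)) ≈-refl))
          (S.solve 4 (λ b g k z → con (+ 2) :* b :* g :+ con (+ 2) :* k :* z := con (+ 2) :* (b :* g :+ k :* z)) ≈-refl (κ β ⊛ [ j ]) (g ᵒ) (κ (+ 2 - ε)) 𝐙))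
          where
          l : ∀ ε → + 4 - + 2 * ε ≡ + 2 * (+ 2 - ε)
          l = solve-∀

        y≈ : y ≈ F ⊛ g ᵒ ⊞ κ (+ 2 - ε + ε') ⊛ 𝐙
        y≈ = κ-cancel (+ 2) (λ ()) (≈-trans (S.solve 2 (λ x y → con (+ 2) :* y := (x :+ y) :- (x :- y)) ≈-refl x y) (≈-trans (⊞-cong n≈ (⊟-cong m≈))
          (≈-trans (S.solve 6 (λ b c g k k' z → (con (+ 2) :* b :* g :+ k :* z) :- (con (+ 2) :* c :* g :+ k' :* z)
                := con (+ 2) :* ((b :- c) :* g) :+ (k :- k') :* z) ≈-refl (κ β ⊛ [ j ]) (κ γ ⊛ [ j' ]) (g ᵒ) (κ (+ 4 - + 2 * ε)) (κ (0ℤ - + 2 * ε')) 𝐙)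
            (≈-trans (⊞-cong ≈-refl (⊛-cong (≈-trans (≈-sym (≈-trans (κ-+ (+ 4 - + 2 * ε) (- (0ℤ - + 2 * ε'))) (⊞-cong ≈-refl (κ-neg (0ℤ - + 2 * ε')))))
                (halve-κ (l ε ε'))) ≈-refl))
              (S.solve 3 (λ f k z → con (+ 2) :* f :+ con (+ 2) :* k :* z := con (+ 2) :* (f :+ k :* z)) ≈-refl (F ⊛ g ᵒ) (κ (+ 2 - ε + ε')) 𝐙)))))
          where
          l : ∀ ε ε' → + 4 - + 2 * ε - (0ℤ - + 2 * ε') ≡ + 2 * (+ 2 - ε + ε')
          l = solve-∀

        V≋F : V ≋ F [ + 2 ]
        V≋F = ≋-trans (≋-trans (≈⇒≋ (S.solve 2 (λ a b → a :- b := (a :+ b) :+ con (+ 2) :* (:- b)) ≈-refl n₁ n₃)) (≋-multiple y (⊟ n₃)))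
          (recover-≋ y≈ (∣-resp (l ε ε') (∣m∣n⇒∣m-n (divides 1ℤ refl) (2∣ε-ε' {ε} {ε'} ε² ε'²))))
          where
          l : ∀ ε ε' → + 2 - (ε - ε') ≡ + 2 - ε + ε'
          l = solve-∀

        U+V : U ⊞ V ≈ κ (+ 2) ⊛ X
        U+V = ≈-trans (S.solve 4 (λ a b c d → (a :- c) :+ (b :- d) := ((a :+ c) :+ (b :+ d)) :- con (+ 2) :* (c :+ d)) ≈-refl n₀ n₁ n₂ n₃)
          (≈-trans (⊞-cong n≈2n' ≈-refl) (S.solve 2 (λ n c → con (+ 2) :* n :- con (+ 2) :* c := con (+ 2) :* (n :- c)) ≈-refl n' (n₂ ⊞ n₃)))

        U≈ : U ≈ κ (+ 2) ⊛ X ⊞ ⊟ V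
        U≈ = ≈-trans (S.solve 2 (λ u v → u := (u :+ v) :- v) ≈-refl U V) (⊞-cong U+V ≈-refl)

        2Z' : κ (+ 2) ⊛ Z' ≈ U ⊛ U ⊞ V ⊛ V
        2Z' = ≈-trans (S.solve 2 (λ x v → con (+ 2) :* (x :* x :+ (v :- x) :* (v :- x)) := (con (+ 2) :* x :- v) :* (con (+ 2) :* x :- v) :+ v :* v) ≈-refl X V)
          (⊞-cong (⊛-cong (≈-sym U≈) (≈-sym U≈)) ≈-refl)

        2Z'ᵒ : κ (+ 2) ⊛ Z' ᵒ ≈ U ᵒ ⊛ U ᵒ ⊞ V ᵒ ⊛ V ᵒ
        2Z'ᵒ = ≈-trans (⊛-cong (≈-sym (ᵒ-κ (+ 2))) ≈-refl) (≈-trans (≈-sym (ᵒ-⊛ (κ (+ 2)) Z')) (≈-trans (ᵒ-cong 2Z')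
          (≈-trans (ᵒ-⊞ (U ⊛ U) (V ⊛ V)) (⊞-cong (ᵒ-⊛ U U) (ᵒ-⊛ V V)))))

        E : El
        E = κ (+ 4) ⊛ 𝐙 ⊞ ⊟ (κ (+ 8) ⊛ κ P)

        -- |U² + V²|² = (|U|² + |V|²)² + (U Vᵒ - V Uᵒ)².
        Z'-norm : Z' ⊛ Z' ᵒ ≈ κ (P * (P * + 4)) ⊞ κ (τ E) ⊛ 𝐙
        Z'-norm = κ-cancel (+ 4) (λ ()) (≈-trans
          (S.solve 2 (λ z z' → con (+ 4) :* (z :* z') := (con (+ 2) :* z) :* (con (+ 2) :* z')) ≈-refl Z' (Z' ᵒ)) (≈-trans (⊛-cong 2Z' 2Z'ᵒ) (≈-trans
          (S.solve 4 (λ u v u' v' → (u :* u :+ v :* v) :* (u' :* u' :+ v' :* v')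
             := (u :* u' :+ v :* v') :* (u :* u' :+ v :* v') :+ (u :* v' :- v :* u') :* (u :* v' :- v :* u')) ≈-refl U V (U ᵒ) (V ᵒ)) (≈-trans
          (⊞-cong (⊛-cong UV-norm UV-norm) (⊛-cong UV-symmetric UV-symmetric)) (≈-trans
          (⊞-cong (⊛-cong (⊞-cong κP4 ≈-refl) (⊞-cong κP4 ≈-refl)) ≈-refl) (≈-trans
          (S.solve 2 (λ p z → (con (+ 4) :* p :+ con (- + 4) :* z) :* (con (+ 4) :* p :+ con (- + 4) :* z) :+ con 0ℤ :* con 0ℤ
             := con (+ 4) :* (p :* (con (+ 4) :* p) :+ (con (+ 4) :* z :- con (+ 8) :* p) :* z)) ≈-refl (κ P) 𝐙)
          (⊛-cong ≈-refl (⊞-cong (≈-sym (≈-trans (κ-* P (P * + 4)) (⊛-cong ≈-refl κP4))) (⊛-𝐙 E)))))))))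

        τZ' : τ Z' ≡ 0ℤ
        τZ' = *-cancelˡ (+ 2) (λ ()) (trans (trans (cong (_* τ Z') (sym (τ-κ (+ 2)))) (sym (τ-⊛ (κ (+ 2)) Z'))) (trans (τ-cong 2Z')
          (trans (τ-⊞ (U ⊛ U) (V ⊛ V)) (cong₂ _+_ (trans (τ-⊛ U U) (cong₂ _*_ τU τU)) (trans (τ-⊛ V V) (cong₂ _*_ τV τV))))))

        -- One Gauss sum is removed at a time: dividing by g* brings the norm from 4p² to 4p,
        -- dividing by g from 4p to 4. As gg* is p modulo 𝐙, together they exhibit Z' as pW up to a
        -- multiple of 𝐙.
        D₁ : Divided Z' (g ᵒ) (P * + 4)
        D₁ = gauss-divide Z' (g ᵒ) (P * + 4) (τ E) gᵒ-norm Z'-norm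

        D₂ : Normal (Divided.B D₁) g
        D₂ = gauss-normal (Divided.B D₁) g (Divided.c D₁) g-norm (Divided.norm D₁)

        W : El
        W = Normal.B D₂
        ω : ℤ
        ω = Normal.ε D₂

        E₂ : El
        E₂ = κ (P - 1ℤ) ⊛ W ⊞ κ (Normal.c D₂) ⊛ g ⊞ κ (Divided.c' D₁)

        Z'≈ : Z' ≈ κ P ⊛ W ⊞ κ (τ E₂) ⊛ 𝐙
        Z'≈ = ≈-trans (Divided.recover D₁) (≈-trans (⊞-cong (⊛-cong (Normal.recover D₂) (ᵒᵒ g)) ≈-refl) (≈-trans
          (S.solve 6 (λ w g g' c z c' → (w :* g' :+ c :* z) :* g :+ c' :* z := w :* (g :* g') :+ z :* (c :* g :+ c')) ≈-refl
             W g (g ᵒ) (κ (Normal.c D₂)) 𝐙 (κ (Divided.c' D₁))) (≈-trans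
          (⊞-cong (⊛-cong ≈-refl g-norm) ≈-refl) (≈-trans
          (S.solve 6 (λ w p q z c c' → w :* (p :+ q :* z) :+ z :* (c :+ c') := p :* w :+ (q :* w :+ c :+ c') :* z) ≈-refl
             W (κ P) (κ (P - 1ℤ)) 𝐙 (κ (Normal.c D₂) ⊛ g) (κ (Divided.c' D₁)))
          (⊞-cong ≈-refl (⊛-𝐙 E₂))))))

        -- Z' has augmentation 0 and W has augmentation 2ω, so the multiple of 𝐙 in Z' is -2ω.
        s-even : + 2 ∣ τ E₂
        s-even = divides (- ω) (*-cancelˡ P P≢0 (trans (l₁ P (+ 2 * ω) (τ E₂)) (trans (cong (_- P * (+ 2 * ω))
            (trans (sym (trans (τ-cong Z'≈) (trans (τ-⊞ (κ P ⊛ W) (κ (τ E₂) ⊛ 𝐙)) (cong₂ _+_ (trans (τ-⊛ (κ P) W) (cong₂ _*_ (τ-κ P) (Normal.τB D₂))) (τ-cst (τ E₂)))))) τZ')) (l₂ P ω))))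
          where
          l₁ : ∀ P a s → P * s ≡ (P * a + s * P) - P * a
          l₁ = solve-∀
          l₂ : ∀ P ω → 0ℤ - P * (+ 2 * ω) ≡ P * (- ω * + 2)
          l₂ = solve-∀

        Z'≋W : Z' ≋ W [ + 2 ]
        Z'≋W = ≋-trans (≈⇒≋ Z'≈) (md (λ v → ∣-resp (sym (cong (_- at W v) (trans (⊞-at (κ P ⊛ W) (κ (τ E₂) ⊛ 𝐙) v)
            (cong₂ _+_ (trans (κ-scale P W v) (cong (_* at W v) P-odd)) (cst-at (τ E₂) v)))))
            (∣-resp (l (at W v) (+ h) (τ E₂)) (∣m∣n⇒∣m+n (divides (at W v * + h) refl) s-even))))
          where
          l : ∀ w h s → w * h * + 2 + s ≡ (1ℤ + h * + 2) * w + s - w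
          l = solve-∀

        W≋pair : W ≋ [ j + j ] ⊞ [ j' + j' ] [ + 2 ]
        W≋pair = ≋-trans (≋-sym Z'≋W) (≋-trans (≋-trans (≈⇒≋ (S.solve 2 (λ x v → x :* x :+ (v :- x) :* (v :- x)
              := v :* v :+ con (+ 2) :* (:- (x :* (v :- x)))) ≈-refl X V)) (≋-multiple (V ⊛ V) (⊟ (X ⊛ Y))))
          (≋-trans (≋-⊛ V≋F V≋F) (≋-trans (≈⇒≋ (S.solve 4 (λ b c a a' → (b :* a :- c :* a') :* (b :* a :- c :* a')
              := (b :* b) :* (a :* a) :+ (c :* c) :* (a' :* a') :+ con (+ 2) :* (:- (b :* a :* (c :* a')))) ≈-refl (κ β) (κ γ) [ j ] [ j' ]))
            (≋-trans (≋-multiple _ (⊟ (κ β ⊛ [ j ] ⊛ (κ γ ⊛ [ j' ])))) (≈⇒≋ (⊞-cong (unit β² j) (unit γ² j')))))))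
          where
          unit : ∀ {s} → s * s ≡ 1ℤ → ∀ i → κ s ⊛ κ s ⊛ ([ i ] ⊛ [ i ]) ≈ [ i + i ]
          unit {s} s² i = ≈-trans (⊛-cong (≈-trans (≈-sym (κ-* s s)) (κ-cong s²)) ([]-+ i i)) (⊛-identityˡ [ i + i ])

        -- For distinct classes of 2j and 2j' the sum ζ^(2j) + ζ^(2j') has sum of squares 2, while
        -- W, congruent to it modulo 2, has 4; these differ modulo 4.
        j≡j' : P ∣ j - j'
        j≡j' = go (P ∣? (j + j - (j' + j')))
          where
          l : ∀ j j' → j + j - (j' + j') ≡ + 2 * (j - j')
          l = solve-∀
          go : Dec (P ∣ j + j - (j' + j')) → P ∣ j - j'
          go (yes e) = P∣2* (j - j') (∣-resp (l j j') e)
          go (no ¬e) = contradiction (∣-resp (cong₂ _-_ (norm⇒sq {W} (Normal.norm D₂)) (sq-pair (j + j) (j' + j') ¬e)) (sq-mod4 W≋pair)) (from-no (+ 4 ∣? + 2))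

        V-even : V ≋ κ 0ℤ [ + 2 ]
        V-even = ≋-trans V≋F (≋-trans (≈⇒≋ (≈-trans (⊞-cong (⊛-cong ≈-refl ([]-cong j≡j')) ≈-refl)
            (≈-trans (S.solve 3 (λ b c a → b :* a :- c :* a := (b :- c) :* a) ≈-refl (κ β) (κ γ) [ j' ])
              (⊛-cong (≈-sym (≈-trans (κ-+ β (- γ)) (⊞-cong ≈-refl (κ-neg γ)))) ≈-refl))))
          (md (λ v → ∣-resp (sym (trans (cong₂ _-_ (κ-scale (β - γ) [ j' ] v) (κ-0 v)) (+-identityʳ ((β - γ) * at [ j' ] v)))) (∣m⇒∣m*n (at [ j' ] v) (2∣ε-ε' {β} {γ} β² γ²)))))

        U-even : U ≋ κ 0ℤ [ + 2 ]
        U-even = ≋-trans (≈⇒≋ (≈-trans U≈ (S.solve 2 (λ x v → con (+ 2) :* x :- v := v :+ con (+ 2) :* (x :- v)) ≈-refl X V)))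
          (≋-trans (≋-multiple V (X ⊞ ⊟ V)) V-even)

      differences-even : U ≋ κ 0ℤ [ + 2 ] × V ≋ κ 0ℤ [ + 2 ]
      differences-even = cases (even? B)
        where
        Nn : Normal n g
        Nn = gauss-normal n g (τ En) g-norm n-norm
        Nm : Normal m g
        Nm = gauss-normal m g (τ Em) g-norm m-norm
        open Normal Nn using (B; ε; ε²; τB; norm)
        open Normal Nm using () renaming (B to C; ε to ε'; ε² to ε'²; τB to τC; norm to C-norm)
        cn : Normal.c Nn ≡ + 4 - + 2 * ε
        cn = recover-const (+ 4) (Normal.recover Nn) (trans (τ-⊞ x y) (trans (cong₂ _+_ τx τy) (l P))) τB
          where
          l : ∀ P → P + P + (P + P) ≡ + 4 * P
          l = solve-∀
        cm : Normal.c Nm ≡ 0ℤ - + 2 * ε'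
        cm = recover-const 0ℤ (Normal.recover Nm) (trans (τ-diff x y) (trans (cong₂ _-_ τx τy) (l P))) τC
          where
          l : ∀ P → P + P - (P + P) ≡ 0ℤ * P
          l = solve-∀
        n≈ : n ≈ B ⊛ g ᵒ ⊞ κ (+ 4 - + 2 * ε) ⊛ 𝐙
        n≈ = ≈-trans (Normal.recover Nn) (⊞-cong ≈-refl (⊛-cong (κ-cong cn) ≈-refl))
        m≈ : m ≈ C ⊛ g ᵒ ⊞ κ (0ℤ - + 2 * ε') ⊛ 𝐙
        m≈ = ≈-trans (Normal.recover Nm) (⊞-cong ≈-refl (⊛-cong (κ-cong cm) ≈-refl))
        n≋B : n ≋ B [ + 2 ]
        n≋B = recover-≋ n≈ (divides (+ 2 - ε) (l ε))
          where
          l : ∀ ε → + 4 - + 2 * ε ≡ (+ 2 - ε) * + 2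
          l = solve-∀
        m≋C : m ≋ C [ + 2 ]
        m≋C = recover-≋ m≈ (divides (- ε') (l ε'))
          where
          l : ∀ ε → 0ℤ - + 2 * ε ≡ - ε * + 2
          l = solve-∀
        C≋B : C ≋ B [ + 2 ]
        C≋B = ≋-trans (≋-sym m≋C) (≋-trans (≋-trans (≈⇒≋ (S.solve 2 (λ x y → x :- y := (x :+ y) :+ con (+ 2) :* (:- y)) ≈-refl x y)) (≋-multiple n (⊟ y))) n≋B)
        cases : B ≋ κ 0ℤ [ + 2 ] ⊎ (∃[ a ] ¬ (+ 2 ∣ at B a)) → U ≋ κ 0ℤ [ + 2 ] × V ≋ κ 0ℤ [ + 2 ]
        cases (inj₂ odd) = ⊥-elim (OddCase.contradict n₀ n₁ n₂ n₃ Co ε ε' ε² ε'² B C norm C-norm τC n≈ m≈ C≋B τB odd)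
        cases (inj₁ ev)  = go (even-norm4 B ev norm) (even-norm4 C (≋-trans C≋B ev) C-norm)
          where
          go : ∃[ j ] ∃[ β ] (β * β ≡ 1ℤ × B ≈ κ (+ 2) ⊛ (κ β ⊛ [ j ])) → ∃[ j ] ∃[ β ] (β * β ≡ 1ℤ × C ≈ κ (+ 2) ⊛ (κ β ⊛ [ j ])) →
            U ≋ κ 0ℤ [ + 2 ] × V ≋ κ 0ℤ [ + 2 ]
          go (j , β , β² , eB) (j' , γ , γ² , eC) = EC.U-even , EC.V-even
            where
            module EC = EvenCase ε ε' β γ j j' ε² ε'² β² γ² (≈-trans n≈ (⊞-cong (⊛-cong eB ≈-refl) ≈-refl)) (≈-trans m≈ (⊞-cong (⊛-cong eC ≈-refl) ≈-refl))

  -- Projecting the relative difference set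

  open import Defs renaming (e to e₀)

  ∑-++ : ∀ {A : Set} (xs ys : List A) (f : A → ℤ) → ∑ (xs ++ ys) f ≡ ∑ xs f + ∑ ys f
  ∑-++ []       ys f = sym (+-identityˡ _)
  ∑-++ (x ∷ xs) ys f = trans (cong (_+_ (f x)) (∑-++ xs ys f)) (sym (+-assoc (f x) _ _))

  ∑-map : ∀ {A B : Set} (k : A → B) xs f → ∑ (map k xs) f ≡ ∑ xs (λ x → f (k x))
  ∑-map k []       f = refl
  ∑-map k (x ∷ xs) f = cong (_+_ (f (k x))) (∑-map k xs f)

  ∑-cartesianProduct : ∀ {A B : Set} (xs : List A) (ys : List B) f →
    ∑ (cartesianProduct xs ys) f ≡ ∑ xs (λ x → ∑ ys (λ y → f (x , y)))
  ∑-cartesianProduct []       ys f = refl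
  ∑-cartesianProduct (x ∷ xs) ys f = trans (∑-++ (map (x ,_) ys) (cartesianProduct xs ys) f)
    (cong₂ _+_ (∑-map (x ,_) ys f) (∑-cartesianProduct xs ys f))

  ∑-tabulate : ∀ {A : Set} n (k : Fin n → A) f H → (∀ i → f (k i) ≡ H (+ toℕ i)) → ∑ (tabulate k) f ≡ ∑ (range n) H
  ∑-tabulate zero    k f H eq = refl
  ∑-tabulate (suc n) k f H eq = trans
    (cong₂ _+_ (eq Fin.zero) (∑-tabulate n (λ i → k (Fin.suc i)) f (λ v → H (v + 1ℤ)) (λ i → trans (eq (Fin.suc i)) (cong H (+-comm 1ℤ (+ toℕ i))))))
    (trans (+-comm (H 0ℤ) _) (sym (∑-front n H)))

  ∑-length : ∀ {A : Set} (xs : List A) → ∑ xs (λ _ → 1ℤ) ≡ + length xs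
  ∑-length []       = refl
  ∑-length (x ∷ xs) = cong (_+_ 1ℤ) (∑-length xs)

  length-filter≡∑ : ∀ {A : Set} {Q : A → Set} (Q? : ∀ x → Dec (Q x)) xs → + length (filter Q? xs) ≡ ∑ xs (λ x → 𝟙 (Q? x))
  length-filter≡∑ Q? []       = refl
  length-filter≡∑ Q? (x ∷ xs) with Q? x
  ... | yes _ = cong (_+_ 1ℤ) (length-filter≡∑ Q? xs)
  ... | no  _ = trans (length-filter≡∑ Q? xs) (sym (+-identityˡ _))

  module Pick {A : Set} (_≟_ : DecidableEquality A) where

    pick-∉ : ∀ {x} xs (f : A → ℤ) → x ∉ xs → ∑ xs (λ y → 𝟙 (x ≟ y) * f y) ≡ 0ℤ
    pick-∉ []       f x∉ = refl
    pick-∉ {x} (y ∷ ys) f x∉ = cong₂ _+_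
      (trans (cong (_* f y) (𝟙-no (x ≟ y) (λ e → x∉ (here e)))) (*-zeroˡ (f y)))
      (pick-∉ ys f (λ i → x∉ (there i)))

    pick : ∀ {x xs} → Unique xs → x ∈ xs → ∀ (f : A → ℤ) → ∑ xs (λ y → 𝟙 (x ≟ y) * f y) ≡ f x
    pick {x} {y ∷ ys} (y≢ ∷ u) (here refl) f = trans (cong₂ _+_
      (trans (cong (_* f x) (𝟙-yes (x ≟ x) refl)) (*-identityˡ (f x)))
      (pick-∉ ys f (λ i → All.lookup y≢ i refl))) (+-identityʳ (f x))
    pick {x} {y ∷ ys} (y≢ ∷ u) (there x∈) f = trans (cong₂ _+_
      (trans (cong (_* f y) (𝟙-no (x ≟ y) (λ { refl → All.lookup y≢ x∈ refl }))) (*-zeroˡ (f y)))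
      (pick u x∈ f)) (+-identityˡ (f x))

    count : List A → A → ℤ
    count xs x = ∑ xs (λ y → 𝟙 (x ≟ y))

    count≡ : ∀ xs x → count xs x ≡ ∑ xs (λ y → 𝟙 (x ≟ y) * 1ℤ)
    count≡ xs x = ∑-cong xs (λ y → sym (*-identityʳ (𝟙 (x ≟ y))))

    count-∈ : ∀ {x xs} → Unique xs → x ∈ xs → count xs x ≡ 1ℤ
    count-∈ {x} {xs} u i = trans (count≡ xs x) (pick u i (λ _ → 1ℤ))

    count-∉ : ∀ {x} xs → x ∉ xs → count xs x ≡ 0ℤ
    count-∉ {x} xs i = trans (count≡ xs x) (pick-∉ xs (λ _ → 1ℤ) i)

  -- Arithmetic in the coordinates of the group.

  module Coordinates (p : ℕ) .{{nz : ℕ.NonZero p}} (pr : Prime p) where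
    open Residues p pr

    -- Identities in Fin p are proved as congruences between these representatives, where they
    -- become integer identities.
    ι : Fin p → ℤ
    ι a = + toℕ a

    ι-mod : ∀ m → P ∣ ι (m ℕ/.mod p) - + m
    ι-mod m = divides (- + (m ℕ/./ p)) (begin
      ι (m ℕ/.mod p) - + m                             ≡⟨ cong₂ (λ a b → + a - + b) (Finₚ.toℕ-fromℕ< (ℕ/.m%n<n m p)) (ℕ/.m≡m%n+[m/n]*n m p) ⟩
      + (m ℕ/.% p) - (+ (m ℕ/.% p) + + (m ℕ/./ p ℕ.* p)) ≡⟨ cong (λ t → + (m ℕ/.% p) - (+ (m ℕ/.% p) + t)) (pos-* (m ℕ/./ p) p) ⟩
      + (m ℕ/.% p) - (+ (m ℕ/.% p) + + (m ℕ/./ p) * P)  ≡⟨ l (+ (m ℕ/.% p)) (+ (m ℕ/./ p)) P ⟩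
      - + (m ℕ/./ p) * P                               ∎)
      where
      open ≡-Reasoning
      l : ∀ r q P → r - (r + q * P) ≡ - q * P
      l = solve-∀

    ι-+ : ∀ a b → P ∣ ι (a +ₙ b) - (ι a + ι b)
    ι-+ a b = ι-mod (toℕ a ℕ.+ toℕ b)

    ι-neg : ∀ a → P ∣ ι (-ₙ a) + ι a
    ι-neg a = ∣-resp (l (ι (-ₙ a)) (+ (p ℕ.∸ toℕ a)) (ι a) P (cong +_ (ℕₚ.m∸n+n≡m (ℕₚ.<⇒≤ (Finₚ.toℕ<n a)))))
        (∣m∣n⇒∣m+n (ι-mod (p ℕ.∸ toℕ a)) (divides 1ℤ (sym (*-identityˡ P))))
      where
      l : ∀ x m a P → m + a ≡ P → x - m + P ≡ x + a
      l x m a _ refl = l' x m a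
        where
        l' : ∀ x m a → x - m + (m + a) ≡ x + a
        l' = solve-∀

    ι-0 : P ∣ ι 0ₙ
    ι-0 = ∣-resp (+-identityʳ _) (ι-mod 0)

    ι-inj : ∀ a b → P ∣ ι a - ι b → a ≡ b
    ι-inj a b d = Finₚ.toℕ-injective (go (ℕₚ.<-cmp (toℕ a) (toℕ b)))
      where
      open import Relation.Binary.Definitions using (Tri; tri<; tri≈; tri>)
      diff : ∀ {m n} → m ℕ.< n → n ℕ.< p → ¬ P ∣ + n - + m
      diff {m} {n} m<n n<p e = P∤small (ℕₚ.m<n⇒0<n∸m m<n) (ℕₚ.≤-<-trans (ℕₚ.m∸n≤m n m) n<p)
        (∣-resp (trans (m-n≡m⊖n n m) (⊖-≥ (ℕₚ.<⇒≤ m<n))) e)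
      go : Tri (toℕ a ℕ.< toℕ b) (toℕ a ≡ toℕ b) (toℕ b ℕ.< toℕ a) → toℕ a ≡ toℕ b
      go (tri< lt _ _) = contradiction (∣-diff-sym (ι a) (ι b) d) (diff lt (Finₚ.toℕ<n b))
      go (tri≈ _ eq _) = eq
      go (tri> _ _ gt) = contradiction d (diff gt (Finₚ.toℕ<n a))

    ∣-tr : ∀ x y z → P ∣ x - y → P ∣ y - z → P ∣ x - z
    ∣-tr x y z d₁ d₂ = ∣-resp (l x y z) (∣m∣n⇒∣m+n d₁ d₂)
      where
      l : ∀ x y z → x - y + (y - z) ≡ x - z
      l = solve-∀

    ι-- : ∀ a b → P ∣ ι (a +ₙ (-ₙ b)) - (ι a - ι b)
    ι-- a b = ∣-resp (l (ι (a +ₙ (-ₙ b))) (ι a) (ι (-ₙ b)) (ι b)) (∣m∣n⇒∣m+n (ι-+ a (-ₙ b)) (ι-neg b))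
      where
      l : ∀ x a n b → x - (a + n) + (n + b) ≡ x - (a - b)
      l = solve-∀

    sub-unique : ∀ x y c → P ∣ ι x - ι y - ι c → x +ₙ (-ₙ y) ≡ c
    sub-unique x y c d = ι-inj (x +ₙ (-ₙ y)) c (∣-tr (ι (x +ₙ (-ₙ y))) (ι x - ι y) (ι c) (ι-- x y) d)

    +-sub : ∀ x y → (x +ₙ y) +ₙ (-ₙ y) ≡ x
    +-sub x y = sub-unique (x +ₙ y) y x (∣-resp (l (ι (x +ₙ y)) (ι x) (ι y)) (ι-+ x y))
      where
      l : ∀ s x y → s - (x + y) ≡ s - y - x
      l = solve-∀

    sub-+ : ∀ x y → (x +ₙ (-ₙ y)) +ₙ y ≡ x
    sub-+ x y = ι-inj _ x (∣-tr (ι ((x +ₙ (-ₙ y)) +ₙ y)) (ι (x +ₙ (-ₙ y)) + ι y) (ι x) (ι-+ (x +ₙ (-ₙ y)) y)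
        (∣-resp (l (ι (x +ₙ (-ₙ y))) (ι x) (ι y)) (ι-- x y)))
      where
      l : ∀ s x y → s - (x - y) ≡ s + y - x
      l = solve-∀

    sub-self : ∀ x → x +ₙ (-ₙ x) ≡ 0ₙ
    sub-self x = ι-inj _ _ (∣-tr (ι (x +ₙ (-ₙ x))) (ι x - ι x) (ι 0ₙ) (ι-- x x) (∣-resp (l (ι x) (ι 0ₙ)) (∣m⇒∣-m ι-0)))
      where
      l : ∀ x z → - z ≡ x - x - z
      l = solve-∀

    sub-0 : ∀ x y → x +ₙ (-ₙ y) ≡ 0ₙ → x ≡ y
    sub-0 x y e = ι-inj x y (∣-resp (l (ι (x +ₙ (-ₙ y))) (ι x - ι y)) (∣m∣n⇒∣m+n (∣m⇒∣-m (ι-- x y)) (subst (λ t → P ∣ ι t) (sym e) ι-0)))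
      where
      l : ∀ s t → - (s - t) + s ≡ t
      l = solve-∀

  opaque
    +4-sub : ∀ (a b : Fin 4) → (a +ₙ b) +ₙ (-ₙ b) ≡ a
    +4-sub = toWitness {a? = Finₚ.all? λ a → Finₚ.all? λ b → ((a +ₙ b) +ₙ (-ₙ b)) Finₚ.≟ a} _

    sub-+4 : ∀ (a b : Fin 4) → (a +ₙ (-ₙ b)) +ₙ b ≡ a
    sub-+4 = toWitness {a? = Finₚ.all? λ a → Finₚ.all? λ b → ((a +ₙ (-ₙ b)) +ₙ b) Finₚ.≟ a} _

    sub-self4 : ∀ (a : Fin 4) → a +ₙ (-ₙ a) ≡ 0ₙ
    sub-self4 = toWitness {a? = Finₚ.all? λ a → (a +ₙ (-ₙ a)) Finₚ.≟ 0ₙ} _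

    +4-identityʳ : ∀ (a : Fin 4) → a +ₙ 0F ≡ a
    +4-identityʳ = toWitness {a? = Finₚ.all? λ a → (a +ₙ 0F) Finₚ.≟ a} _

    quadruple4 : ∀ (a : Fin 4) → (a +ₙ a) +ₙ (a +ₙ a) ≡ 0F
    quadruple4 = toWitness {a? = Finₚ.all? λ a → ((a +ₙ a) +ₙ (a +ₙ a)) Finₚ.≟ 0F} _

  sub-0₄ : ∀ (a b : Fin 4) → a +ₙ (-ₙ b) ≡ 0ₙ → a ≡ b
  sub-0₄ a b eq = trans (sym (sub-+4 a b)) (trans (cong (_+ₙ b) eq) (trans (cong (_+ₙ b) (sym (sub-self4 b))) (sub-+4 b b)))

  ind : Fin 4 → Fin 4 → ℤ
  ind j i = 𝟙 (i Finₚ.≟ j)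

  opaque
    ind-total : ∀ i → ind 0F i + ind 1F i + ind 2F i + ind 3F i ≡ 1ℤ
    ind-total = toWitness {a? = Finₚ.all? λ i → ind 0F i + ind 1F i + ind 2F i + ind 3F i ≟ 1ℤ} _

    ind-diff₀ : ∀ a b → ind 0F (a +ₙ (-ₙ b)) ≡ ind 0F a * ind 0F b + ind 1F a * ind 1F b + ind 2F a * ind 2F b + ind 3F a * ind 3F b
    ind-diff₀ = toWitness {a? = Finₚ.all? λ a → Finₚ.all? λ b → ind 0F (a +ₙ (-ₙ b)) ≟ _} _

    ind-diff₁ : ∀ a b → ind 1F (a +ₙ (-ₙ b)) ≡ ind 1F a * ind 0F b + ind 2F a * ind 1F b + ind 3F a * ind 2F b + ind 0F a * ind 3F b
    ind-diff₁ = toWitness {a? = Finₚ.all? λ a → Finₚ.all? λ b → ind 1F (a +ₙ (-ₙ b)) ≟ _} _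

    ind-diff₂ : ∀ a b → ind 2F (a +ₙ (-ₙ b)) ≡ ind 2F a * ind 0F b + ind 3F a * ind 1F b + ind 0F a * ind 2F b + ind 1F a * ind 3F b
    ind-diff₂ = toWitness {a? = Finₚ.all? λ a → Finₚ.all? λ b → ind 2F (a +ₙ (-ₙ b)) ≟ _} _

    ind-diff₃ : ∀ a b → ind 3F (a +ₙ (-ₙ b)) ≡ ind 3F a * ind 0F b + ind 0F a * ind 1F b + ind 1F a * ind 2F b + ind 2F a * ind 3F b
    ind-diff₃ = toWitness {a? = Finₚ.all? λ a → Finₚ.all? λ b → ind 3F (a +ₙ (-ₙ b)) ≟ _} _

  -- Representation counts as sums over the group.

  module Representations (p : ℕ) .{{nz : ℕ.NonZero p}} (pr : Prime p) (N R : List (G p)) (rds : IsRDS (4 ℕ.* p) p (4 ℕ.* p) 4 N R) where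
    open Residues p pr
    open Coordinates p pr
    open IsRDS rds
    open IsSubgroup subgroup-N
    open Pick (_≟G_ {p})
    open DecMembership (_≟G_ {p}) using (_∈?_)

    Gp : Set
    Gp = G p

    ⊕-⊘ : ∀ (x y : Gp) → (x ⊕ y) ⊘ y ≡ x
    ⊕-⊘ (i , b , c) (i' , b' , c') = cong₂ _,_ (+4-sub i i') (cong₂ _,_ (+-sub b b') (+-sub c c'))

    ⊘-⊕ : ∀ (x y : Gp) → (x ⊘ y) ⊕ y ≡ x
    ⊘-⊕ (i , b , c) (i' , b' , c') = cong₂ _,_ (sub-+4 i i') (cong₂ _,_ (sub-+ b b') (sub-+ c c'))

    ⊘-self : ∀ (x : Gp) → x ⊘ x ≡ e₀
    ⊘-self (i , b , c) = cong₂ _,_ (sub-self4 i) (cong₂ _,_ (sub-self b) (sub-self c))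

    ⊘≡e : ∀ (x y : Gp) → x ⊘ y ≡ e₀ → x ≡ y
    ⊘≡e (i , b , c) (i' , b' , c') eq = cong₂ _,_ (sub-0₄ i i' (cong proj₁ eq))
      (cong₂ _,_ (sub-0 b b' (cong (λ t → proj₁ (proj₂ t)) eq)) (sub-0 c c' (cong (λ t → proj₂ (proj₂ t)) eq)))

    reps-∑ : ∀ g → + reps R g ≡ ∑ R (λ r → ∑ R (λ r' → 𝟙 ((r ⊘ r') ≟G g)))
    reps-∑ g = trans (length-filter≡∑ (λ rr → (proj₁ rr ⊘ proj₂ rr) ≟G g) (cartesianProduct R R)) (∑-cartesianProduct R R _)

    reps-e : + reps R e₀ ≡ + 4 * P
    reps-e = trans (reps-∑ e₀) (trans (∑-cong-∈ R (λ r r∈ → trans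
        (∑-cong R (λ r' → 𝟙-cong ((r ⊘ r') ≟G e₀) (r ≟G r') (⊘≡e r r') (λ { refl → ⊘-self r })))
        (count-∈ unique-R r∈)))
      (trans (∑-length R) (trans (cong +_ size-R) (pos-* 4 p))))

    -- In ℤ[G] this reads R R⁻¹ = 4G - 4N + 4p·e; at the identity the count is the size 4p of R.
    reps-formula : ∀ g → + reps R g ≡ + 4 - + 4 * count N g + + 4 * P * 𝟙 (e₀ ≟G g)
    reps-formula g = go (g ∈? N) (e₀ ≟G g)
      where
      go : Dec (g ∈ N) → (e? : Dec (e₀ ≡ g)) → + reps R g ≡ + 4 - + 4 * count N g + + 4 * P * 𝟙 e?
      go (yes g∈) (yes refl) = trans reps-e (sym (trans (cong (λ t → + 4 - + 4 * t + + 4 * P * 1ℤ) (count-∈ unique g∈)) (l P)))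
        where
        l : ∀ P → + 4 - + 4 * 1ℤ + + 4 * P * 1ℤ ≡ + 4 * P
        l = solve-∀
      go (yes g∈) (no ne) = trans (cong +_ (inside-N g g∈ (λ eq → ne (sym eq)))) (sym (trans (cong (λ t → + 4 - + 4 * t + + 4 * P * 0ℤ) (count-∈ unique g∈)) (l P)))
        where
        l : ∀ P → + 4 - + 4 * 1ℤ + + 4 * P * 0ℤ ≡ 0ℤ
        l = solve-∀
      go (no g∉) (yes refl) = contradiction has-e g∉
      go (no g∉) (no ne) = trans (cong +_ (outside-N g g∉)) (sym (trans (cong (λ t → + 4 - + 4 * t + + 4 * P * 0ℤ) (count-∉ N g∉)) (l P)))
        where
        l : ∀ P → + 4 - + 4 * 0ℤ + + 4 * P * 0ℤ ≡ + 4
        l = solve-∀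

    allG : List Gp
    allG = cartesianProduct (allFin 4) (cartesianProduct (allFin p) (allFin p))

    allG-unique : Unique allG
    allG-unique = Uniqueₚ.cartesianProduct⁺ (Uniqueₚ.allFin⁺ 4) (Uniqueₚ.cartesianProduct⁺ (Uniqueₚ.allFin⁺ p) (Uniqueₚ.allFin⁺ p))

    ∈-allG : ∀ g → g ∈ allG
    ∈-allG (i , b , c) = ∈-cartesianProduct⁺ (∈-allFin i) (∈-cartesianProduct⁺ (∈-allFin b) (∈-allFin c))

    pick-allG : ∀ x (F : Gp → ℤ) → ∑ allG (λ g → 𝟙 (x ≟G g) * F g) ≡ F x
    pick-allG x F = pick allG-unique (∈-allG x) F

    -- The equation R R⁻¹ = 4G - 4N + 4p·e paired with an arbitrary weight F. Taking F as the
    -- indicator of a class and a value of φ gives the correlations.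
    difference-sum : ∀ (F : Gp → ℤ) → ∑ R (λ r → ∑ R (λ r' → F (r ⊘ r'))) ≡ + 4 * ∑ allG F - + 4 * ∑ N F + + 4 * P * F e₀
    difference-sum F = begin
      ∑ R (λ r → ∑ R (λ r' → F (r ⊘ r')))
        ≡⟨ ∑-cong R (λ r → ∑-cong R (λ r' → sym (pick-allG (r ⊘ r') F))) ⟩
      ∑ R (λ r → ∑ R (λ r' → ∑ allG (λ g → 𝟙 ((r ⊘ r') ≟G g) * F g)))
        ≡⟨ ∑-cong R (λ r → ∑-swap R allG _) ⟩
      ∑ R (λ r → ∑ allG (λ g → ∑ R (λ r' → 𝟙 ((r ⊘ r') ≟G g) * F g)))
        ≡⟨ ∑-swap R allG _ ⟩
      ∑ allG (λ g → ∑ R (λ r → ∑ R (λ r' → 𝟙 ((r ⊘ r') ≟G g) * F g)))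
        ≡⟨ ∑-cong allG (λ g → trans (∑-cong R (λ r → ∑-*ʳ R _ (F g))) (trans (∑-*ʳ R _ (F g)) (cong (_* F g) (trans (sym (reps-∑ g)) (reps-formula g))))) ⟩
      ∑ allG (λ g → (+ 4 - + 4 * count N g + + 4 * P * 𝟙 (e₀ ≟G g)) * F g)
        ≡⟨ ∑-cong allG (λ g → l (count N g) P (𝟙 (e₀ ≟G g)) (F g)) ⟩
      ∑ allG (λ g → + 4 * F g - + 4 * (count N g * F g) + + 4 * P * (𝟙 (e₀ ≟G g) * F g))
        ≡⟨ ∑-+ allG _ _ ⟩
      ∑ allG (λ g → + 4 * F g - + 4 * (count N g * F g)) + ∑ allG (λ g → + 4 * P * (𝟙 (e₀ ≟G g) * F g))
        ≡⟨ cong₂ _+_ (trans (∑-- allG _ _) (cong₂ _-_ (∑-*ˡ allG (+ 4) F) (trans (∑-*ˡ allG (+ 4) _) (cong (+ 4 *_) N-part))))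
             (trans (∑-*ˡ allG (+ 4 * P) _) (cong (+ 4 * P *_) (pick-allG e₀ F))) ⟩
      + 4 * ∑ allG F - + 4 * ∑ N F + + 4 * P * F e₀ ∎
      where
      open ≡-Reasoning
      l : ∀ c P d f → (+ 4 - + 4 * c + + 4 * P * d) * f ≡ + 4 * f - + 4 * (c * f) + + 4 * P * (d * f)
      l = solve-∀
      N-part : ∑ allG (λ g → count N g * F g) ≡ ∑ N F
      N-part = trans (∑-cong allG (λ g → sym (∑-*ʳ N (λ x → 𝟙 (g ≟G x)) (F g)))) (trans (∑-swap allG N _)
        (∑-cong N (λ x → trans (∑-cong allG (λ g → cong (_* F g) (𝟙-cong (g ≟G x) (x ≟G g) sym sym))) (pick-allG x F))))

    translate : ∀ h → h ∈ N → ∀ (F : Gp → ℤ) → ∑ N (λ x → F (x ⊕ h)) ≡ ∑ N F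
    translate h h∈ F = begin
      ∑ N (λ x → F (x ⊕ h))
        ≡⟨ ∑-cong-∈ N (λ x x∈ → sym (pick unique (closed-⊕ x∈ h∈) F)) ⟩
      ∑ N (λ x → ∑ N (λ y → 𝟙 ((x ⊕ h) ≟G y) * F y))
        ≡⟨ ∑-swap N N _ ⟩
      ∑ N (λ y → ∑ N (λ x → 𝟙 ((x ⊕ h) ≟G y) * F y))
        ≡⟨ ∑-cong-∈ N (λ y y∈ → trans (∑-*ʳ N _ (F y)) (trans (cong (_* F y) (trans
             (∑-cong N (λ x → 𝟙-cong ((x ⊕ h) ≟G y) ((y ⊘ h) ≟G x) (λ eq → trans (cong (_⊘ h) (sym eq)) (⊕-⊘ x h)) (λ eq → trans (cong (_⊕ h) (sym eq)) (⊘-⊕ y h))))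
             (count-∈ unique (closed-⊕ y∈ (closed-⊖ h∈))))) (*-identityˡ (F y)))) ⟩
      ∑ N F ∎
      where open ≡-Reasoning

    ∑N1 : ∑ N (λ _ → 1ℤ) ≡ P
    ∑N1 = trans (∑-length N) (cong +_ order-N)

  -- Correlations of the class counts under a linear functional.

  *-nonneg : ∀ {i j} → 0ℤ ≤ i → 0ℤ ≤ j → 0ℤ ≤ i * j
  *-nonneg {+ m} {+ n} _ _ = subst (0ℤ ≤_) (pos-* m n) (+≤+ ℕ.z≤n)

  private
    split-unit : ∀ s₀ s₁ s₂ s₃ → 1ℤ ≤ s₀ → 0ℤ ≤ s₁ → 0ℤ ≤ s₂ → 0ℤ ≤ s₃ → s₀ + s₁ + s₂ + s₃ ≡ 1ℤ →
      s₀ ≡ 1ℤ × s₁ ≡ 0ℤ × s₂ ≡ 0ℤ × s₃ ≡ 0ℤ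
    split-unit s₀ s₁ s₂ s₃ b₀ b₁ b₂ b₃ eq =
        ≤-antisym (≤-trans (≤-steps₁ s₀ s₁ b₁) (≤-trans (≤-steps₁ (s₀ + s₁) s₂ b₂) (≤-trans (≤-steps₁ (s₀ + s₁ + s₂) s₃ b₃) (≤-reflexive eq)))) b₀
      , ≤-antisym (bound s₁ s₂ s₃ b₂ b₃ (trans (l₁ s₀ s₁ s₂ s₃) eq)) b₁
      , ≤-antisym (bound s₂ s₁ s₃ b₁ b₃ (trans (l₂ s₀ s₁ s₂ s₃) eq)) b₂
      , ≤-antisym (bound s₃ s₁ s₂ b₁ b₂ (trans (l₃ s₀ s₁ s₂ s₃) eq)) b₃
      where
      ≤-steps₁ : ∀ a b → 0ℤ ≤ b → a ≤ a + b
      ≤-steps₁ a b le = subst (_≤ a + b) (+-identityʳ a) (+-monoʳ-≤ a le)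
      bound : ∀ a b c → 0ℤ ≤ b → 0ℤ ≤ c → s₀ + (a + b + c) ≡ 1ℤ → a ≤ 0ℤ
      bound a b c lb lc e = ≤-trans (≤-trans (≤-steps₁ a b lb) (≤-steps₁ (a + b) c lc))
        (subst (_≤ 0ℤ) (l s₀ (a + b + c)) (subst (λ t → t - s₀ ≤ 0ℤ) (sym e) (i≤j⇒i-j≤0 b₀)))
        where
        l : ∀ s r → s + r - s ≡ r
        l = solve-∀
      l₁ : ∀ s a b c → s + (a + b + c) ≡ s + a + b + c
      l₁ = solve-∀
      l₂ : ∀ s a b c → s + (b + a + c) ≡ s + a + b + c
      l₂ = solve-∀
      l₃ : ∀ s a b c → s + (c + a + b) ≡ s + a + b + c
      l₃ = solve-∀

  opaque
    ∑-ind : ∀ j → ∑ (allFin 4) (ind j) ≡ 1ℤ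
    ∑-ind = toWitness {a? = Finₚ.all? λ j → ∑ (allFin 4) (ind j) ≟ 1ℤ} _

  module Projection (p : ℕ) .{{nz : ℕ.NonZero p}} (pr : Prime p) (h : ℕ) (p-odd : p ≡ suc (h ℕ.+ h))
      (N R : List (G p)) (rds : IsRDS (4 ℕ.* p) p (4 ℕ.* p) 4 N R) where
    open GroupRing p pr h p-odd
    open Coordinates p pr public
    open Representations p pr N R rds public
    open IsSubgroup (IsRDS.subgroup-N rds)
    open S using (_:=_; _:+_; _:*_; _:-_; :-_; con)

    φ : ℤ → ℤ → Gp → ℤ
    φ α β (_ , b , c) = α * ι b + β * ι c

    φ-⊘ : ∀ α β x y → P ∣ φ α β (x ⊘ y) - (φ α β x - φ α β y)
    φ-⊘ α β (_ , b , c) (_ , b' , c') = ∣-resp (l α β (ι (b +ₙ (-ₙ b'))) (ι (c +ₙ (-ₙ c'))) (ι b) (ι b') (ι c) (ι c'))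
        (∣m∣n⇒∣m+n (∣n⇒∣m*n α (ι-- b b')) (∣n⇒∣m*n β (ι-- c c')))
      where
      l : ∀ α β x y b b' c c' → α * (x - (b - b')) + β * (y - (c - c')) ≡ α * x + β * y - (α * b + β * c - (α * b' + β * c'))
      l = solve-∀

    φ-⊕ : ∀ α β x y → P ∣ φ α β (x ⊕ y) - (φ α β x + φ α β y)
    φ-⊕ α β (_ , b , c) (_ , b' , c') = ∣-resp (l α β (ι (b +ₙ b')) (ι (c +ₙ c')) (ι b) (ι b') (ι c) (ι c'))
        (∣m∣n⇒∣m+n (∣n⇒∣m*n α (ι-+ b b')) (∣n⇒∣m*n β (ι-+ c c')))
      where
      l : ∀ α β x y b b' c c' → α * (x - (b + b')) + β * (y - (c + c')) ≡ α * x + β * y - (α * b + β * c + (α * b' + β * c'))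
      l = solve-∀

    φ-e : ∀ α β → P ∣ φ α β e₀
    φ-e α β = ∣m∣n⇒∣m+n (∣n⇒∣m*n α ι-0) (∣n⇒∣m*n β ι-0)

    plane-count : ∀ α β → ¬ (P ∣ α × P ∣ β) → ∀ t → ∑ rng (λ v → ∑ rng (λ w → δ (t - (α * v + β * w)))) ≡ P
    plane-count α β ¬αβ t = go (P ∣? β)
      where
      l₁ : ∀ t α β v w → t - (α * v + β * w) ≡ t - α * v - β * w
      l₁ = solve-∀
      l₂ : ∀ t α β v w → t - (α * v + β * w) ≡ t - β * w - α * v
      l₂ = solve-∀
      total : ∑ rng (λ _ → 1ℤ) ≡ P
      total = trans (∑-const p 1ℤ) (*-identityʳ P)
      go : Dec (P ∣ β) → ∑ rng (λ v → ∑ rng (λ w → δ (t - (α * v + β * w)))) ≡ P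
      go (no ¬β) = trans (∑-cong rng (λ v → trans (∑-cong rng (λ w → cong δ (l₁ t α β v w))) (∑-δ-linear (t - α * v) β ¬β))) total
      go (yes β∣) = trans (∑-swap rng rng _) (trans (∑-cong rng (λ w → trans (∑-cong rng (λ v → cong δ (l₂ t α β v w)))
        (∑-δ-linear (t - β * w) α (λ α∣ → ¬αβ (α∣ , β∣))))) total)

    module Along (α β : ℤ) (k : Gp) (k∈ : k ∈ N) (k₁ : proj₁ k ≡ 0F) (φk : ¬ P ∣ φ α β k) where

      weight : Fin 4 → ℤ → Gp → ℤ
      weight j t x = ind j (proj₁ x) * δ (t - φ α β x)

      S[_] : Fin 4 → ℤ → ℤ
      S[ j ] t = ∑ N (weight j t)

      S-shift : ∀ j t → S[ j ] (t - φ α β k) ≡ S[ j ] t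
      S-shift j t = sym (trans (sym (translate k k∈ (weight j t))) (∑-cong N (λ x → cong₂ _*_
          (cong (ind j) (trans (cong (proj₁ x +ₙ_) k₁) (+4-identityʳ (proj₁ x))))
          (δ-per (t - φ α β (x ⊕ k)) (t - φ α β k - φ α β x) (∣-resp (l t (φ α β (x ⊕ k)) (φ α β x) (φ α β k)) (∣m⇒∣-m (φ-⊕ α β x k)))))))
        where
        l : ∀ t s x k → - (s - (x + k)) ≡ t - s - (t - k - x)
        l = solve-∀

      S-shifts : ∀ j t i → S[ j ] (t - φ α β k * + i) ≡ S[ j ] t
      S-shifts j t zero    = cong S[ j ] (l t (φ α β k))
        where
        l : ∀ t k → t - k * 0ℤ ≡ t
        l = solve-∀
      S-shifts j t (suc i) = trans (cong S[ j ] (l t (φ α β k) (+ i))) (trans (S-shift j (t - φ α β k * + i)) (S-shifts j t i))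
        where
        l : ∀ t k i → t - k * (1ℤ + i) ≡ t - k * i - k
        l = solve-∀

      total : Fin 4 → ℤ
      total j = ∑ N (λ x → ind j (proj₁ x))

      -- The fibre counts of N are invariant under translation by k. Averaged over the p multiples
      -- of k, every element of N is met once, because φ(k) is invertible.
      P*S : ∀ j t → P * S[ j ] t ≡ total j
      P*S j t = begin
        P * S[ j ] t
          ≡⟨ sym (∑-const p (S[ j ] t)) ⟩
        ∑ rng (λ _ → S[ j ] t)
          ≡⟨ ∑-cong-∈ rng (λ v v∈ → shifted v (∈-range⁻ v∈)) ⟩
        ∑ rng (λ v → S[ j ] (t - φ α β k * v))
          ≡⟨ ∑-swap rng N _ ⟩
        ∑ N (λ x → ∑ rng (λ v → ind j (proj₁ x) * δ (t - φ α β k * v - φ α β x)))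
          ≡⟨ ∑-cong N (λ x → trans (∑-*ˡ rng (ind j (proj₁ x)) _) (trans (cong (ind j (proj₁ x) *_)
               (trans (∑-cong rng (λ v → cong δ (l t (φ α β k * v) (φ α β x)))) (∑-δ-linear (t - φ α β x) (φ α β k) φk))) (*-identityʳ _))) ⟩
        total j ∎
        where
        open ≡-Reasoning
        shifted : ∀ v → ∃[ i ] (i ℕ.< p × v ≡ + i) → S[ j ] t ≡ S[ j ] (t - φ α β k * v)
        shifted _ (i , _ , refl) = sym (S-shifts j t i)
        l : ∀ t k x → t - k - x ≡ t - x - k
        l = solve-∀

      S-nonneg : ∀ j t → 0ℤ ≤ S[ j ] t
      S-nonneg j t = ∑-nonneg N (weight-nonneg j t)
        where
        weight-nonneg : ∀ j t x → 0ℤ ≤ weight j t x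
        weight-nonneg j t x = *-nonneg (𝟙-nonneg (proj₁ x Finₚ.≟ j)) (δ-nonneg p (t - φ α β x))

      S-sum : S[ 0F ] 0ℤ + S[ 1F ] 0ℤ + S[ 2F ] 0ℤ + S[ 3F ] 0ℤ ≡ 1ℤ
      S-sum = *-cancelˡ P P≢0 (begin
        P * (S[ 0F ] 0ℤ + S[ 1F ] 0ℤ + S[ 2F ] 0ℤ + S[ 3F ] 0ℤ)
          ≡⟨ l P (S[ 0F ] 0ℤ) (S[ 1F ] 0ℤ) (S[ 2F ] 0ℤ) (S[ 3F ] 0ℤ) ⟩
        P * S[ 0F ] 0ℤ + P * S[ 1F ] 0ℤ + P * S[ 2F ] 0ℤ + P * S[ 3F ] 0ℤ
          ≡⟨ cong₂ _+_ (cong₂ _+_ (cong₂ _+_ (P*S 0F 0ℤ) (P*S 1F 0ℤ)) (P*S 2F 0ℤ)) (P*S 3F 0ℤ) ⟩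
        total 0F + total 1F + total 2F + total 3F
          ≡⟨ sym (trans (∑-+ N _ _) (cong (_+ total 3F) (trans (∑-+ N _ _) (cong (_+ total 2F) (∑-+ N _ _))))) ⟩
        ∑ N (λ x → ind 0F (proj₁ x) + ind 1F (proj₁ x) + ind 2F (proj₁ x) + ind 3F (proj₁ x))
          ≡⟨ ∑-cong N (λ x → ind-total (proj₁ x)) ⟩
        ∑ N (λ _ → 1ℤ)
          ≡⟨ trans ∑N1 (sym (*-identityʳ P)) ⟩
        P * 1ℤ ∎)
        where
        open ≡-Reasoning
        l : ∀ P a b c d → P * (a + b + c + d) ≡ P * a + P * b + P * c + P * d
        l = solve-∀

      S-at-e : 1ℤ ≤ S[ 0F ] 0ℤ
      S-at-e = subst (_≤ S[ 0F ] 0ℤ) (cong (1ℤ *_) (δ-∣ (∣-resp (sym (+-identityˡ _)) (∣m⇒∣-m (φ-e α β)))))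
        (term≤∑ {f = weight 0F 0ℤ} (λ x → *-nonneg (𝟙-nonneg (proj₁ x Finₚ.≟ 0F)) (δ-nonneg p (0ℤ - φ α β x))) has-e)

      -- The four fibre counts are nonnegative with sum |N|/p = 1, and the identity already
      -- contributes to class 0. So the projection of N is 𝐙 in class 0 and nothing elsewhere.
      S-values : S[ 0F ] 0ℤ ≡ 1ℤ × S[ 1F ] 0ℤ ≡ 0ℤ × S[ 2F ] 0ℤ ≡ 0ℤ × S[ 3F ] 0ℤ ≡ 0ℤ
      S-values = split-unit _ _ _ _ S-at-e (S-nonneg 1F 0ℤ) (S-nonneg 2F 0ℤ) (S-nonneg 3F 0ℤ) S-sum

      S-const : ∀ j t → S[ j ] t ≡ S[ j ] 0ℤ
      S-const j t = *-cancelˡ P P≢0 (trans (P*S j t) (sym (P*S j 0ℤ)))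

      ¬αβ : ¬ (P ∣ α × P ∣ β)
      ¬αβ (α∣ , β∣) = φk (∣m∣n⇒∣m+n (∣m⇒∣m*n _ α∣) (∣m⇒∣m*n _ β∣))

      ∑-allG : ∀ j t → ∑ allG (weight j t) ≡ P
      ∑-allG j t = begin
        ∑ allG (weight j t)
          ≡⟨ ∑-cartesianProduct (allFin 4) pairs (weight j t) ⟩
        ∑ (allFin 4) (λ i → ∑ pairs (λ x → ind j i * δ (t - φ α β (i , x))))
          ≡⟨ ∑-cong (allFin 4) (λ i → ∑-*ˡ pairs (ind j i) (λ x → δ (t - φ α β (i , x)))) ⟩
        ∑ (allFin 4) (λ i → ind j i * ∑ pairs (λ x → δ (t - φ α β (i , x))))
          ≡⟨ ∑-cong (allFin 4) (λ i → cong (ind j i *_) (∑-pairs i)) ⟩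
        ∑ (allFin 4) (λ i → ind j i * P)
          ≡⟨ trans (∑-*ʳ (allFin 4) (ind j) P) (trans (cong (_* P) (∑-ind j)) (*-identityˡ P)) ⟩
        P ∎
        where
        open ≡-Reasoning
        pairs = cartesianProduct (allFin p) (allFin p)
        ∑-pairs : ∀ i → ∑ pairs (λ x → δ (t - φ α β (i , x))) ≡ P
        ∑-pairs i = trans (∑-cartesianProduct (allFin p) (allFin p) _) (trans
          (∑-tabulate p (λ b → b) _ (λ v → ∑ rng (λ w → δ (t - (α * v + β * w))))
            (λ b → ∑-tabulate p (λ c → c) _ (λ w → δ (t - (α * ι b + β * w))) (λ c → refl)))
          (plane-count α β ¬αβ t))

      weight-sum : ∀ j t → ∑ R (λ r → ∑ R (λ r' → weight j t (r ⊘ r'))) ≡ + 4 * P - + 4 * S[ j ] 0ℤ + + 4 * P * (ind j 0F * δ t)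
      weight-sum j t = trans (difference-sum (weight j t)) (cong₂ _+_ (cong₂ (λ a b → + 4 * a - + 4 * b) (∑-allG j t) (S-const j t))
        (cong (λ y → + 4 * P * (ind j 0F * y)) (δ-per (t - φ α β e₀) t (∣-resp (l t (φ α β e₀)) (∣m⇒∣-m (φ-e α β))))))
        where
        l : ∀ t e → - e ≡ t - e - t
        l = solve-∀

      n : Fin 4 → El
      n i = ⊞∑ R (λ r → κ (ind i (proj₁ r)) ⊛ [ φ α β r ])

      n-at : ∀ i v → at (n i) v ≡ ∑ R (λ r → ind i (proj₁ r) * δ (v - φ α β r))
      n-at i v = trans (⊞∑-at R _ v) (∑-cong R (λ r → trans (κ-scale (ind i (proj₁ r)) [ φ α β r ] v) (cong (ind i (proj₁ r) *_) ([]-at (φ α β r) v))))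

      n-nonneg : ∀ i v → 0ℤ ≤ at (n i) v
      n-nonneg i v = subst (0ℤ ≤_) (sym (n-at i v)) (∑-nonneg R (λ r → *-nonneg (𝟙-nonneg (proj₁ r Finₚ.≟ i)) (δ-nonneg p (v - φ α β r))))

      pair : Fin 4 → Fin 4 → ℤ → Gp → Gp → ℤ
      pair i k t r r' = ind i (proj₁ r) * ind k (proj₁ r') * δ (t - (φ α β r - φ α β r'))

      correlation : ∀ i k t → at (n i ⊛ n k ᵒ) t ≡ ∑ R (λ r → ∑ R (pair i k t r))
      correlation i k t = trans (pt (≈-trans (⊛-cong ≈-refl (ᵒ-⊞∑ R _)) (⊞∑-⊛-⊞∑ R R _ _)) t)
        (trans (⊞∑-at R _ t) (∑-cong R (λ r → trans (⊞∑-at R _ t) (∑-cong R (λ r' → term r r')))))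
        where
        term : ∀ r r' → at (κ (ind i (proj₁ r)) ⊛ [ φ α β r ] ⊛ (κ (ind k (proj₁ r')) ⊛ [ φ α β r' ]) ᵒ) t ≡ pair i k t r r'
        term r r' = trans (pt (≈-trans (⊛-cong ≈-refl (≈-trans (ᵒ-⊛ (κ b) [ y ]) (⊛-cong (ᵒ-κ b) (ᵒ-[] y))))
            (≈-trans (S.solve 4 (λ a x b y → a :* x :* (b :* y) := a :* b :* (x :* y)) ≈-refl (κ a) [ x ] (κ b) [ - y ])
              (⊛-cong (≈-sym (κ-* a b)) ([]-+ x (- y))))) t) (trans (κ-scale (a * b) [ x - y ] t) (cong (a * b *_) ([]-at (x - y) t)))
          where
          a = ind i (proj₁ r)
          b = ind k (proj₁ r')
          x = φ α β r
          y = φ α β r'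

      -- `split` resolves the class j of a difference into the classes of its two members; with the
      -- eight indices free, one computation covers all four j.
      correlations : ∀ j a a' b b' c c' d d' →
        (∀ x y → ind j (x +ₙ (-ₙ y)) ≡ ind a x * ind a' y + ind b x * ind b' y + ind c x * ind c' y + ind d x * ind d' y) →
        ∀ t → at (n a ⊛ n a' ᵒ ⊞ n b ⊛ n b' ᵒ ⊞ n c ⊛ n c' ᵒ ⊞ n d ⊛ n d' ᵒ) t ≡ + 4 * P - + 4 * S[ j ] 0ℤ + + 4 * P * (ind j 0F * δ t)
      correlations j a a' b b' c c' d d' split t = begin
        at (n a ⊛ n a' ᵒ ⊞ n b ⊛ n b' ᵒ ⊞ n c ⊛ n c' ᵒ ⊞ n d ⊛ n d' ᵒ) t
          ≡⟨ trans (⊞-at _ _ t) (cong₂ _+_ (trans (⊞-at _ _ t) (cong₂ _+_ (trans (⊞-at _ _ t)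
               (cong₂ _+_ (correlation a a' t) (correlation b b' t))) (correlation c c' t))) (correlation d d' t)) ⟩
        ∑∑ (pair a a' t) + ∑∑ (pair b b' t) + ∑∑ (pair c c' t) + ∑∑ (pair d d' t)
          ≡⟨ sym (trans (∑∑-+ _ _) (cong (_+ ∑∑ (pair d d' t)) (trans (∑∑-+ _ _) (cong (_+ ∑∑ (pair c c' t)) (∑∑-+ _ _))))) ⟩
        ∑∑ (λ r r' → pair a a' t r r' + pair b b' t r r' + pair c c' t r r' + pair d d' t r r')
          ≡⟨ ∑-cong R (λ r → ∑-cong R (λ r' → sym (collect r r'))) ⟩
        ∑∑ (λ r r' → weight j t (r ⊘ r'))
          ≡⟨ weight-sum j t ⟩
        + 4 * P - + 4 * S[ j ] 0ℤ + + 4 * P * (ind j 0F * δ t) ∎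
        where
        open ≡-Reasoning
        ∑∑ : (Gp → Gp → ℤ) → ℤ
        ∑∑ F = ∑ R (λ r → ∑ R (F r))
        ∑∑-+ : ∀ F H → ∑∑ (λ r r' → F r r' + H r r') ≡ ∑∑ F + ∑∑ H
        ∑∑-+ F H = trans (∑-cong R (λ r → ∑-+ R (F r) (H r))) (∑-+ R _ _)
        l : ∀ a b c d y → (a + b + c + d) * y ≡ a * y + b * y + c * y + d * y
        l = solve-∀
        l' : ∀ t s d → - (s - d) ≡ t - s - (t - d)
        l' = solve-∀
        collect : ∀ r r' → weight j t (r ⊘ r') ≡ pair a a' t r r' + pair b b' t r r' + pair c c' t r r' + pair d d' t r r'
        collect r r' = trans (cong₂ _*_ (split (proj₁ r) (proj₁ r'))
            (δ-per (t - φ α β (r ⊘ r')) (t - (φ α β r - φ α β r')) (∣-resp (l' t (φ α β (r ⊘ r')) (φ α β r - φ α β r')) (∣m⇒∣-m (φ-⊘ α β r r')))))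
          (l (ind a (proj₁ r) * ind a' (proj₁ r')) (ind b (proj₁ r) * ind b' (proj₁ r')) (ind c (proj₁ r) * ind c' (proj₁ r')) (ind d (proj₁ r) * ind d' (proj₁ r')) _)

      Co : Correlations (n 0F) (n 1F) (n 2F) (n 3F)
      Co = record
        { nn₀ = n-nonneg 0F ; nn₁ = n-nonneg 1F ; nn₂ = n-nonneg 2F ; nn₃ = n-nonneg 3F
        ; c₀ = pw (λ t → trans (correlations 0F 0F 0F 1F 1F 2F 2F 3F 3F ind-diff₀ t) (trans (cong (λ s → + 4 * P - + 4 * s + + 4 * P * (1ℤ * δ t)) (proj₁ S-values)) (sym (rhs₀ t))))
        ; c₁ = pw (λ t → trans (correlations 1F 1F 0F 2F 1F 3F 2F 0F 3F ind-diff₁ t) (trans (cong (λ s → + 4 * P - + 4 * s + + 4 * P * (0ℤ * δ t)) (proj₁ (proj₂ S-values))) (sym (rhs t))))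
        ; c₂ = pw (λ t → trans (correlations 2F 2F 0F 3F 1F 0F 2F 1F 3F ind-diff₂ t) (trans (cong (λ s → + 4 * P - + 4 * s + + 4 * P * (0ℤ * δ t)) (proj₁ (proj₂ (proj₂ S-values)))) (sym (rhs t))))
        ; c₃ = pw (λ t → trans (correlations 3F 3F 0F 0F 1F 1F 2F 2F 3F ind-diff₃ t) (trans (cong (λ s → + 4 * P - + 4 * s + + 4 * P * (0ℤ * δ t)) (proj₂ (proj₂ (proj₂ S-values)))) (sym (rhs t)))) }
        where
        4P : κ (+ 4) ⊛ κ P ≈ κ (+ 4 * P)
        4P = ≈-sym (κ-* (+ 4) P)
        rhs : ∀ t → at (κ (+ 4) ⊛ κ P ⊛ 𝐙) t ≡ + 4 * P - + 4 * 0ℤ + + 4 * P * (0ℤ * δ t)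
        rhs t = trans (pt (⊛-cong 4P ≈-refl) t) (trans (cst-at (+ 4 * P) t) (l P (δ t)))
          where
          l : ∀ P d → + 4 * P ≡ + 4 * P - + 4 * 0ℤ + + 4 * P * (0ℤ * d)
          l = solve-∀
        rhs₀ : ∀ t → at (κ (+ 4) ⊛ κ P ⊞ (κ (+ 4) ⊛ κ P ⊞ ⊟ κ (+ 4)) ⊛ 𝐙) t ≡ + 4 * P - + 4 * 1ℤ + + 4 * P * (1ℤ * δ t)
        rhs₀ t = trans (⊞-at _ _ t) (trans (cong₂ _+_ (trans (pt 4P t) (κ-at (+ 4 * P) t))
            (trans (pt (⊛-cong (≈-trans (⊞-cong 4P (≈-sym (κ-neg (+ 4)))) (≈-sym (κ-+ (+ 4 * P) (- + 4)))) ≈-refl) t) (cst-at (+ 4 * P + - + 4) t))) (l P (δ t)))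
          where
          l : ∀ P d → + 4 * P * d + (+ 4 * P + - + 4) ≡ + 4 * P - + 4 * 1ℤ + + 4 * P * (1ℤ * d)
          l = solve-∀

      even-differences : (∀ v → + 2 ∣ at (n 0F) v - at (n 2F) v) × (∀ v → + 2 ∣ at (n 1F) v - at (n 3F) v)
      even-differences = unpack (n 0F) (n 2F) (proj₁ both) , unpack (n 1F) (n 3F) (proj₂ both)
        where
        both = differences-even (n 0F) (n 1F) (n 2F) (n 3F) Co
        unpack : ∀ f f' → f ⊞ ⊟ f' ≋ κ 0ℤ [ + 2 ] → ∀ v → + 2 ∣ at f v - at f' v
        unpack f f' ev v = ∣-resp (trans (⊞-at f (⊟ f') v) (cong (_+_ (at f v)) (⊟-at f' v))) (even-at ev v)

  -- From the parity of line counts to translation invariance.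

  ∑-mono-∈ : ∀ {A : Set} (xs : List A) {f g : A → ℤ} → (∀ x → x ∈ xs → f x ≤ g x) → ∑ xs f ≤ ∑ xs g
  ∑-mono-∈ []       le = ≤-refl
  ∑-mono-∈ (x ∷ xs) le = +-mono-≤ (le x (here refl)) (∑-mono-∈ xs (λ y y∈ → le y (there y∈)))

  ind-+2 : ∀ a → ind 0F (a +ₙ 2F) ≡ ind 2F a × ind 1F (a +ₙ 2F) ≡ ind 3F a
  ind-+2 0F = refl , refl
  ind-+2 1F = refl , refl
  ind-+2 2F = refl , refl
  ind-+2 3F = refl , refl

  module Nonexistence (p : ℕ) .{{nz : ℕ.NonZero p}} (pr : Prime p) (h : ℕ) (p-odd : p ≡ suc (h ℕ.+ h))
      (N R : List (G p)) (rds : IsRDS (4 ℕ.* p) p (4 ℕ.* p) 4 N R) where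
    open GroupRing p pr h p-odd
    open Projection p pr h p-odd N R rds
    open IsRDS rds
    open IsSubgroup subgroup-N
    open Pick (_≟G_ {p})

    record Generator : Set where
      field
        k       : Gp
        k∈      : k ∈ N
        k₁      : proj₁ k ≡ 0F
        nonzero : ¬ (P ∣ ι (proj₁ (proj₂ k)) × P ∣ ι (proj₂ (proj₂ k)))

    ι-double : ∀ b → P ∣ ι (b +ₙ b) → P ∣ ι b
    ι-double b d = P∣2* (ι b) (∣-resp (l (ι (b +ₙ b)) (ι b)) (∣m∣n⇒∣m-n d (ι-+ b b)))
      where
      l : ∀ s b → s - (s - (b + b)) ≡ + 2 * b
      l = solve-∀

    -- Translation by an element of class 2 exchanges the classes 0, 2 and 1, 3 within N, so the
    -- order p of N would be even.
    no-involution : ∀ w → w ∈ N → proj₁ w ≡ 2F → ⊥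
    no-involution w w∈ w₁ = contradiction (∣-resp (trans (cong (_- + h * + 2) P-odd) (l (+ h * + 2))) (∣m∣n⇒∣m-n 2∣P (divides (+ h) refl)))
        (from-no (+ 2 ∣? 1ℤ))
      where
      l : ∀ x → 1ℤ + x - x ≡ 1ℤ
      l = solve-∀
      l' : ∀ a b → a + b + a + b ≡ (a + b) * + 2
      l' = solve-∀
      t : Fin 4 → ℤ
      t j = ∑ N (λ x → ind j (proj₁ x))
      shift : ∀ j j' → (∀ a → ind j (a +ₙ 2F) ≡ ind j' a) → t j' ≡ t j
      shift j j' e = trans (∑-cong N (λ x → trans (sym (e (proj₁ x))) (cong (λ y → ind j (proj₁ x +ₙ y)) (sym w₁)))) (translate w w∈ (λ x → ind j (proj₁ x)))
      2∣P : + 2 ∣ P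
      2∣P = divides (t 0F + t 1F) (trans (sym ∑N1) (trans (∑-cong N (λ x → sym (ind-total (proj₁ x))))
        (trans (trans (∑-+ N _ _) (cong (_+ t 3F) (trans (∑-+ N _ _) (cong (_+ t 2F) (∑-+ N _ _)))))
          (trans (cong₂ (λ a b → t 0F + t 1F + a + b) (shift 0F 2F (λ a → proj₁ (ind-+2 a))) (shift 1F 3F (λ a → proj₂ (ind-+2 a)))) (l' (t 0F) (t 1F))))))

    -- Multiplication by 4 kills the ℤ₄ part, and doubling twice is injective on residues modulo the
    -- odd prime p.
    quadruple : ∀ x → x ∈ N → ¬ (P ∣ ι (proj₁ (proj₂ x)) × P ∣ ι (proj₂ (proj₂ x))) → Generator
    quadruple x@(i , b , c) x∈ nz = record
      { k = (x ⊕ x) ⊕ (x ⊕ x) ; k∈ = closed-⊕ (closed-⊕ x∈ x∈) (closed-⊕ x∈ x∈) ; k₁ = quadruple4 i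
      ; nonzero = λ { (db , dc) → nz (ι-double b (ι-double (b +ₙ b) db) , ι-double c (ι-double (c +ₙ c) dc)) } }

    -- N has p > 1 elements, so some x differs from the identity. If its ℤ_p² part is nonzero, 4x
    -- serves; otherwise x or 2x has class 2, which is excluded.
    generator : Generator
    generator = go (search-∈ (λ x → x ≟G e₀) N)
      where
      from : ∀ x → x ∈ N → x ≢ e₀ → Dec (P ∣ ι (proj₁ (proj₂ x))) → Dec (P ∣ ι (proj₂ (proj₂ x))) → Generator
      from x x∈ ne (no ¬b) _ = quadruple x x∈ (λ z → ¬b (proj₁ z))
      from x x∈ ne (yes _) (no ¬c) = quadruple x x∈ (λ z → ¬c (proj₂ z))
      from (0F , b , c) x∈ ne (yes db) (yes dc) = contradiction (cong₂ (λ y z → 0F , y , z) (zero≡ b db) (zero≡ c dc)) ne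
        where
        zero≡ : ∀ b → P ∣ ι b → b ≡ 0ₙ
        zero≡ b d = ι-inj b 0ₙ (∣m∣n⇒∣m-n d ι-0)
      from x@(1F , _) x∈ ne (yes _) (yes _) = ⊥-elim (no-involution (x ⊕ x) (closed-⊕ x∈ x∈) refl)
      from x@(2F , _) x∈ ne (yes _) (yes _) = ⊥-elim (no-involution x x∈ refl)
      from x@(3F , _) x∈ ne (yes _) (yes _) = ⊥-elim (no-involution (x ⊕ x) (closed-⊕ x∈ x∈) refl)
      go : (∀ x → x ∈ N → x ≡ e₀) ⊎ ∃[ x ] (x ∈ N × ¬ x ≡ e₀) → Generator
      go (inj₂ (x , x∈ , ne)) = from x x∈ ne (P ∣? ι (proj₁ (proj₂ x))) (P ∣? ι (proj₂ (proj₂ x)))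
      go (inj₁ all) = contradiction (+-injective (sym P≡1)) (ℕₚ.<⇒≢ 1<p)
        where
        P≡1 : P ≡ 1ℤ
        P≡1 = trans (sym ∑N1) (trans (∑-cong-∈ N (λ x x∈ → sym (𝟙-yes (e₀ ≟G x) (sym (all x x∈))))) (count-∈ unique has-e))

    open Generator generator

    kb kc : ℤ
    kb = ι (proj₁ (proj₂ k))
    kc = ι (proj₂ (proj₂ k))

    transversal : ∃[ α ] ∃[ β ] ¬ P ∣ α * kb + β * kc
    transversal = go (P ∣? kb)
      where
      l₁ : ∀ b c → 1ℤ * b + 0ℤ * c ≡ b
      l₁ = solve-∀
      l₂ : ∀ b c → 0ℤ * b + 1ℤ * c ≡ c
      l₂ = solve-∀
      go : Dec (P ∣ kb) → ∃[ α ] ∃[ β ] ¬ P ∣ α * kb + β * kc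
      go (no ¬b) = 1ℤ , 0ℤ , λ d → ¬b (∣-resp (l₁ kb kc) d)
      go (yes b) = 0ℤ , 1ℤ , λ d → nonzero (b , ∣-resp (l₂ kb kc) d)

    α₀ β₀ : ℤ
    α₀ = proj₁ transversal
    β₀ = proj₁ (proj₂ transversal)

    -- All these functionals take the same nonzero value on k. As s runs modulo p, their kernels run
    -- through the p directions other than that of k.
    α β : ℤ → ℤ
    α s = α₀ + s * kc
    β s = β₀ - s * kb

    φk : ∀ s → ¬ P ∣ φ (α s) (β s) k
    φk s d = proj₂ (proj₂ transversal) (∣-resp (l α₀ β₀ s kb kc) d)
      where
      l : ∀ α β s b c → (α + s * c) * b + (β - s * b) * c ≡ α * b + β * c
      l = solve-∀

    module Dir (s : ℤ) = Along (α s) (β s) k k∈ k₁ (φk s)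

    n[_] : ℤ → Fin 4 → ℤ → ℤ
    n[ s ] i v = at (Dir.n s i) v

    -- ρ counts the points of R of class i at (a , b), K those on the line through (a , b) in
    -- direction k.
    ρ K : Fin 4 → ℤ → ℤ → ℤ
    ρ i a b = ∑ R (λ r → ind i (proj₁ r) * (δ (a - ι (proj₁ (proj₂ r))) * δ (b - ι (proj₂ (proj₂ r)))))
    K i a b = ∑ R (λ r → ind i (proj₁ r) * δ (kb * (b - ι (proj₂ (proj₂ r))) - kc * (a - ι (proj₁ (proj₂ r)))))

    size : Fin 4 → ℤ
    size i = ∑ R (λ r → ind i (proj₁ r))

    -- Every point off the line through (a , b) in direction k lies on exactly one of the lines α s , β s through (a , b).
    pencil : ∀ x y → ∑ rng (λ s → δ (α₀ * x + β₀ * y - (kb * y - kc * x) * s)) ≡ 1ℤ - δ (kb * y - kc * x) + P * (δ x * δ y)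
    pencil x y = go (P ∣? Ψ)
      where
      A = α₀ * x + β₀ * y
      Ψ = kb * y - kc * x
      det = α₀ * kb + β₀ * kc
      Ψ-zero : P ∣ x → P ∣ y → P ∣ Ψ
      Ψ-zero dx dy = ∣m∣n⇒∣m-n (∣n⇒∣m*n kb dy) (∣n⇒∣m*n kc dx)
      product-0 : ¬ (P ∣ x × P ∣ y) → δ x * δ y ≡ 0ℤ
      product-0 ¬xy with P ∣? x
      ... | no ¬x = trans (cong (_* δ y) (δ-∤ ¬x)) (*-zeroˡ (δ y))
      ... | yes dx = trans (cong (δ x *_) (δ-∤ (λ dy → ¬xy (dx , dy)))) (*-zeroʳ (δ x))
      cancel : ∀ z → P ∣ det * z → P ∣ z
      cancel z d = cancel∣ det z (proj₂ (proj₂ transversal)) d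
      l₁ : ∀ α β x y b c → b * (α * x + β * y) - β * (b * y - c * x) ≡ (α * b + β * c) * x
      l₁ = solve-∀
      l₂ : ∀ α β x y b c → c * (α * x + β * y) + α * (b * y - c * x) ≡ (α * b + β * c) * y
      l₂ = solve-∀
      go : Dec (P ∣ Ψ) → ∑ rng (λ s → δ (A - Ψ * s)) ≡ 1ℤ - δ Ψ + P * (δ x * δ y)
      go (no ¬Ψ) = trans (∑-δ-linear A Ψ ¬Ψ) (sym (trans (cong₂ (λ u v → 1ℤ - u + P * v) (δ-∤ ¬Ψ) (product-0 (λ { (dx , dy) → ¬Ψ (Ψ-zero dx dy) }))) (l P)))
        where
        l : ∀ P → 1ℤ - 0ℤ + P * 0ℤ ≡ 1ℤ
        l = solve-∀
      go (yes dΨ) = trans (∑-cong rng (λ s → δ-per (A - Ψ * s) A (∣-resp (l A Ψ s) (∣m⇒∣-m (∣m⇒∣m*n s dΨ))))) (trans (∑-const p (δ A))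
          (sym (trans (cong₂ (λ u v → 1ℤ - u + P * v) (δ-∣ dΨ) (both (P ∣? A))) (+-identityˡ (P * δ A)))))
        where
        l : ∀ A Ψ s → - (Ψ * s) ≡ A - Ψ * s - A
        l = solve-∀
        both : Dec (P ∣ A) → δ x * δ y ≡ δ A
        both (yes dA) = trans (cong₂ _*_ (δ-∣ (cancel x (∣-resp (l₁ α₀ β₀ x y kb kc) (∣m∣n⇒∣m-n (∣n⇒∣m*n kb dA) (∣n⇒∣m*n β₀ dΨ)))))
            (δ-∣ (cancel y (∣-resp (l₂ α₀ β₀ x y kb kc) (∣m∣n⇒∣m+n (∣n⇒∣m*n kc dA) (∣n⇒∣m*n α₀ dΨ)))))) (sym (δ-∣ dA))
        both (no ¬A) = trans (product-0 (λ { (dx , dy) → ¬A (∣m∣n⇒∣m+n (∣n⇒∣m*n α₀ dx) (∣n⇒∣m*n β₀ dy)) })) (sym (δ-∤ ¬A))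

    -- Of the lines counted, a point off the line in direction k lies on one, a point of that line
    -- other than (a , b) on none, and (a , b) itself on all p.
    line-sum : ∀ i a b → ∑ rng (λ s → n[ s ] i (α s * a + β s * b)) ≡ size i - K i a b + P * ρ i a b
    line-sum i a b = begin
      ∑ rng (λ s → n[ s ] i (α s * a + β s * b))
        ≡⟨ ∑-cong rng (λ s → Dir.n-at s i (α s * a + β s * b)) ⟩
      ∑ rng (λ s → ∑ R (λ r → ind i (proj₁ r) * δ (α s * a + β s * b - φ (α s) (β s) r)))
        ≡⟨ ∑-swap rng R _ ⟩
      ∑ R (λ r → ∑ rng (λ s → ind i (proj₁ r) * δ (α s * a + β s * b - φ (α s) (β s) r)))
        ≡⟨ ∑-cong R (λ r → trans (∑-*ˡ rng (ind i (proj₁ r)) _) (cong (ind i (proj₁ r) *_) (inner r))) ⟩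
      ∑ R (λ r → ind i (proj₁ r) * (1ℤ - Kδ r + P * ρδ r))
        ≡⟨ ∑-cong R (λ r → l (ind i (proj₁ r)) (Kδ r) P (ρδ r)) ⟩
      ∑ R (λ r → ind i (proj₁ r) - ind i (proj₁ r) * Kδ r + P * (ind i (proj₁ r) * ρδ r))
        ≡⟨ trans (∑-+ R _ _) (cong₂ _+_ (∑-- R _ _) (∑-*ˡ R P _)) ⟩
      size i - K i a b + P * ρ i a b ∎
      where
      open ≡-Reasoning
      Kδ ρδ : Gp → ℤ
      Kδ r = δ (kb * (b - ι (proj₂ (proj₂ r))) - kc * (a - ι (proj₁ (proj₂ r))))
      ρδ r = δ (a - ι (proj₁ (proj₂ r))) * δ (b - ι (proj₂ (proj₂ r)))
      l : ∀ u k P r → u * (1ℤ - k + P * r) ≡ u - u * k + P * (u * r)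
      l = solve-∀
      l' : ∀ α β s kb kc a b x y → (α + s * kc) * a + (β - s * kb) * b - ((α + s * kc) * x + (β - s * kb) * y)
        ≡ α * (a - x) + β * (b - y) - (kb * (b - y) - kc * (a - x)) * s
      l' = solve-∀
      inner : ∀ r → ∑ rng (λ s → δ (α s * a + β s * b - φ (α s) (β s) r)) ≡ 1ℤ - Kδ r + P * ρδ r
      inner (_ , x , y) = trans (∑-cong rng (λ s → cong δ (l' α₀ β₀ s kb kc a b (ι x) (ι y)))) (pencil (a - ι x) (b - ι y))

    K-invariant : ∀ i a b → K i (a + kb) (b + kc) ≡ K i a b
    K-invariant i a b = ∑-cong R (λ r → cong (λ y → ind i (proj₁ r) * δ y) (l kb kc a b (ι (proj₁ (proj₂ r))) (ι (proj₂ (proj₂ r)))))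
      where
      l : ∀ kb kc a b x y → kb * (b + kc - y) - kc * (a + kb - x) ≡ kb * (b - y) - kc * (a - x)
      l = solve-∀

    Occupied : Fin 4 → ℤ → ℤ → Set
    Occupied i a b = ∃[ r ] (r ∈ R × proj₁ r ≡ i × P ∣ a - ι (proj₁ (proj₂ r)) × P ∣ b - ι (proj₂ (proj₂ r)))

    occupied : ∀ i a b → ρ i a b ≢ 0ℤ → Occupied i a b
    occupied i a b ne = go (∑≢0⇒∃ R _ ne)
      where
      go : ∃[ r ] (r ∈ R × ind i (proj₁ r) * (δ (a - ι (proj₁ (proj₂ r))) * δ (b - ι (proj₂ (proj₂ r)))) ≢ 0ℤ) → Occupied i a b
      go (r , r∈ , z) = r , r∈ , 𝟙≢0 (proj₁ r Finₚ.≟ i) (λ e → z (trans (cong (_* w) e) (*-zeroˡ w)))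
          , δ≢0 p (λ e → z (trans (cong (λ t → u * (t * δy)) e) (l₁ u δy)))
          , δ≢0 p (λ e → z (trans (cong (λ t → u * (δx * t)) e) (l₂ u δx)))
        where
        u = ind i (proj₁ r)
        δx = δ (a - ι (proj₁ (proj₂ r)))
        δy = δ (b - ι (proj₂ (proj₂ r)))
        w = δx * δy
        l₁ : ∀ u y → u * (0ℤ * y) ≡ 0ℤ
        l₁ = solve-∀
        l₂ : ∀ u x → u * (x * 0ℤ) ≡ 0ℤ
        l₂ = solve-∀

    reps≥1 : ∀ {r r'} → r ∈ R → r' ∈ R → reps R (r ⊘ r') ≢ 0
    reps≥1 {r} {r'} r∈ r'∈ z = contradiction (subst (1ℤ ≤_) (trans (sym (reps-∑ (r ⊘ r'))) (cong +_ z)) (≤-trans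
        (subst (_≤ ∑ R (λ y → 𝟙 ((r ⊘ y) ≟G (r ⊘ r')))) (𝟙-yes ((r ⊘ r') ≟G (r ⊘ r')) refl) (term≤∑ {f = λ y → 𝟙 ((r ⊘ y) ≟G (r ⊘ r'))} (λ y → 𝟙-nonneg ((r ⊘ y) ≟G (r ⊘ r'))) r'∈))
        (term≤∑ {f = λ x → ∑ R (λ y → 𝟙 ((x ⊘ y) ≟G (r ⊘ r')))} (λ x → ∑-nonneg R (λ y → 𝟙-nonneg ((x ⊘ y) ≟G (r ⊘ r')))) r∈))) (λ { (+≤+ ()) })

    -- Two points of R in one class whose ℤ_p² parts differ by g would represent the non-identity
    -- element g of N.
    conflict : ∀ g → g ∈ N → proj₁ g ≡ 0F → ¬ (P ∣ ι (proj₁ (proj₂ g)) × P ∣ ι (proj₂ (proj₂ g))) →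
      ∀ {i a b a' b'} → P ∣ a' - a - ι (proj₁ (proj₂ g)) → P ∣ b' - b - ι (proj₂ (proj₂ g)) → Occupied i a b → Occupied i a' b' → ⊥
    conflict g@(g₁ , gb , gc) g∈ g₁≡0 gnz {i} {a} {b} {a'} {b'} da db (r@(i₁ , x , y) , r∈ , refl , ax , by) (r'@(_ , x' , y') , r'∈ , refl , ax' , by') =
        reps≥1 r'∈ r∈ (subst (λ t → reps R t ≡ 0) (sym diff) (inside-N g g∈ g≢e))
      where
      l : ∀ a a' x x' g → a' - a - g + (a - x) - (a' - x') ≡ x' - x - g
      l = solve-∀
      diff : r' ⊘ r ≡ g
      diff = cong₂ _,_ (trans (sub-self4 i₁) (sym g₁≡0)) (cong₂ _,_
        (sub-unique x' x gb (∣-resp (l a a' (ι x) (ι x') (ι gb)) (∣m∣n⇒∣m-n (∣m∣n⇒∣m+n da ax) ax')))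
        (sub-unique y' y gc (∣-resp (l b b' (ι y) (ι y') (ι gc)) (∣m∣n⇒∣m-n (∣m∣n⇒∣m+n db by) by'))))
      g≢e : g ≢ e₀
      g≢e e = gnz (subst (λ t → P ∣ ι (proj₁ (proj₂ t))) (sym e) ι-0 , subst (λ t → P ∣ ι (proj₂ (proj₂ t))) (sym e) ι-0)

    module Pair (i i' : Fin 4) (even : ∀ s v → + 2 ∣ n[ s ] i v - n[ s ] i' v) where

      D : ℤ → ℤ → ℤ
      D a b = ρ i a b - ρ i' a b

      -- A step along k changes neither `size` nor K, so the difference of two even line sums is p
      -- times the change of D, and p is odd.
      D-step : ∀ a b → + 2 ∣ D (a + kb) (b + kc) - D a b
      D-step a b = ∣-resp (trans (cong (_- + 2 * (+ h * X)) (trans (cong₂ (λ u v → size i - u + P * ρ i a⁺ b⁺ - (size i' - v + P * ρ i' a⁺ b⁺) - (size i - K i a b + P * ρ i a b - (size i' - K i' a b + P * ρ i' a b)))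
            (K-invariant i a b) (K-invariant i' a b)) (trans (l₁ (size i) (size i') (K i a b) (K i' a b) P (ρ i a⁺ b⁺) (ρ i' a⁺ b⁺) (ρ i a b) (ρ i' a b)) (cong (_* X) P-odd)))) (l₂ (+ h) X))
          (∣m∣n⇒∣m-n (∣m∣n⇒∣m-n (lines a⁺ b⁺) (lines a b)) (∣m⇒∣m*n (+ h * X) (divides 1ℤ refl)))
        where
        a⁺ = a + kb
        b⁺ = b + kc
        X = D a⁺ b⁺ - D a b
        lines : ∀ a b → + 2 ∣ size i - K i a b + P * ρ i a b - (size i' - K i' a b + P * ρ i' a b)
        lines a b = ∣-resp (trans (∑-- rng _ _) (cong₂ _-_ (line-sum i a b) (line-sum i' a b))) (∣∑ rng (λ s → even s (α s * a + β s * b)))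
        l₁ : ∀ s s' u v P x x' y y' → s - u + P * x - (s' - v + P * x') - (s - u + P * y - (s' - v + P * y')) ≡ P * (x - x' - (y - y'))
        l₁ = solve-∀
        l₂ : ∀ h X → (1ℤ + h * + 2) * X - + 2 * (h * X) ≡ X
        l₂ = solve-∀

      odd⇒occupied : ∀ a b → ¬ (+ 2 ∣ D a b) → Occupied i a b ⊎ Occupied i' a b
      odd⇒occupied a b odd = go (ρ i a b ≟ 0ℤ) (ρ i' a b ≟ 0ℤ)
        where
        go : Dec (ρ i a b ≡ 0ℤ) → Dec (ρ i' a b ≡ 0ℤ) → Occupied i a b ⊎ Occupied i' a b
        go (no ne) _        = inj₁ (occupied i a b ne)
        go (yes _) (no ne)  = inj₂ (occupied i' a b ne)
        go (yes z) (yes z') = contradiction (∣-resp (sym (cong₂ _-_ z z')) (divides 0ℤ refl)) odd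

      -- Among (a , b), (a , b) + k and (a , b) + 2k two would be occupied in the same class.
      D-even : ∀ a b → + 2 ∣ D a b
      D-even a b = go (+ 2 ∣? D a b)
        where
        next-odd : ∀ a b → ¬ (+ 2 ∣ D a b) → ¬ (+ 2 ∣ D (a + kb) (b + kc))
        next-odd a b odd d = odd (∣-resp (l (D (a + kb) (b + kc)) (D a b)) (∣m∣n⇒∣m-n d (D-step a b)))
          where
          l : ∀ x y → x - (x - y) ≡ y
          l = solve-∀
        self : ∀ a k → P ∣ a + k - a - k
        self a k = divides 0ℤ (l a k)
          where
          l : ∀ a k → a + k - a - k ≡ 0ℤ
          l = solve-∀
        twice : ∀ a b → P ∣ a + ι b + ι b - a - ι (b +ₙ b)
        twice a b = ∣-resp (l a (ι b) (ι (b +ₙ b))) (∣m⇒∣-m (ι-+ b b))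
          where
          l : ∀ a b s → - (s - (b + b)) ≡ a + b + b - a - s
          l = solve-∀
        near : ∀ {j} a b → Occupied j a b → Occupied j (a + kb) (b + kc) → ⊥
        near {j} a b = conflict k k∈ k₁ nonzero {j} {a} {b} {a + kb} {b + kc} (self a kb) (self b kc)
        -- 2k is again an element of N of class 0 with nonzero ℤ_p² part, because p is odd.
        far : ∀ {j} → Occupied j a b → Occupied j (a + kb + kb) (b + kc + kc) → ⊥
        far {j} = conflict (k ⊕ k) (closed-⊕ k∈ k∈) (trans (cong₂ _+ₙ_ k₁ k₁) refl)
          (λ { (db , dc) → nonzero (ι-double (proj₁ (proj₂ k)) db , ι-double (proj₂ (proj₂ k)) dc) })
          {j} {a} {b} {a + kb + kb} {b + kc + kc} (twice a (proj₁ (proj₂ k))) (twice b (proj₂ (proj₂ k)))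
        a₁ = a + kb
        b₁ = b + kc
        pigeon : Occupied i a b ⊎ Occupied i' a b → Occupied i a₁ b₁ ⊎ Occupied i' a₁ b₁ → Occupied i (a₁ + kb) (b₁ + kc) ⊎ Occupied i' (a₁ + kb) (b₁ + kc) → ⊥
        pigeon (inj₁ x) (inj₁ y) _        = near a b x y
        pigeon (inj₂ x) (inj₂ y) _        = near a b x y
        pigeon _        (inj₁ y) (inj₁ z) = near a₁ b₁ y z
        pigeon _        (inj₂ y) (inj₂ z) = near a₁ b₁ y z
        pigeon (inj₁ x) _        (inj₁ z) = far x z
        pigeon (inj₂ x) _        (inj₂ z) = far x z
        go : Dec (+ 2 ∣ D a b) → + 2 ∣ D a b
        go (yes d) = d
        go (no odd) = ⊥-elim (pigeon (odd⇒occupied a b odd) (odd⇒occupied a₁ b₁ (next-odd a b odd)) (odd⇒occupied (a₁ + kb) (b₁ + kc) (next-odd a₁ b₁ (next-odd a b odd))))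

      ρ-self : ∀ r → r ∈ R → proj₁ r ≡ i → ρ i (ι (proj₁ (proj₂ r))) (ι (proj₂ (proj₂ r))) ≡ 1ℤ
      ρ-self r@(_ , x , y) r∈ refl = trans (∑-cong R term) (count-∈ unique-R r∈)
        where
        term : ∀ r' → ind i (proj₁ r') * (δ (ι x - ι (proj₁ (proj₂ r'))) * δ (ι y - ι (proj₂ (proj₂ r')))) ≡ 𝟙 (r ≟G r')
        term r'@(j , x' , y') = go (j Finₚ.≟ i) (P ∣? (ι x - ι x')) (P ∣? (ι y - ι y'))
          where
          w = δ (ι x - ι x') * δ (ι y - ι y')
          go : (j≟i : Dec (j ≡ i)) → Dec (P ∣ ι x - ι x') → Dec (P ∣ ι y - ι y') → 𝟙 j≟i * w ≡ 𝟙 (r ≟G r')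
          go (no ne) _ _ = trans (*-zeroˡ w) (sym (𝟙-no (r ≟G r') (λ e → ne (sym (cong proj₁ e)))))
          go (yes _) (no ¬d) _ = trans (cong (λ t → 1ℤ * (t * δ (ι y - ι y'))) (δ-∤ ¬d)) (trans (l (δ (ι y - ι y'))) (sym (𝟙-no (r ≟G r')
              (λ { refl → ¬d (divides 0ℤ (+-inverseʳ (ι x))) }))))
            where
            l : ∀ t → 1ℤ * (0ℤ * t) ≡ 0ℤ
            l = solve-∀
          go (yes _) (yes _) (no ¬d) = trans (cong (λ t → 1ℤ * (δ (ι x - ι x') * t)) (δ-∤ ¬d)) (trans (l (δ (ι x - ι x'))) (sym (𝟙-no (r ≟G r')
              (λ { refl → ¬d (divides 0ℤ (+-inverseʳ (ι y))) }))))
            where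
            l : ∀ t → 1ℤ * (t * 0ℤ) ≡ 0ℤ
            l = solve-∀
          go (yes refl) (yes dx) (yes dy) = trans (cong₂ (λ s t → 1ℤ * (s * t)) (δ-∣ dx) (δ-∣ dy))
            (sym (𝟙-yes (r ≟G r') (cong₂ (λ s t → i , s , t) (ι-inj x x' dx) (ι-inj y y' dy))))

      -- At its own position r makes the count of its class 1; since D is even there, the count of
      -- the other class is odd and hence nonzero.
      partner : ∀ r → r ∈ R → proj₁ r ≡ i → Occupied i' (ι (proj₁ (proj₂ r))) (ι (proj₂ (proj₂ r)))
      partner r r∈ e = occupied i' a b (λ z → contradiction (∣-resp (cong₂ _-_ (ρ-self r r∈ e) z) (D-even a b)) (from-no (+ 2 ∣? 1ℤ)))
        where
        a = ι (proj₁ (proj₂ r))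
        b = ι (proj₂ (proj₂ r))

    w : Gp
    w = 2F , 0ₙ , 0ₙ

    translate-partner : ∀ r → r ∈ R → ∃[ r' ] (r' ∈ R × r' ⊘ r ≡ w)
    translate-partner r@(i , x , y) r∈ = by-class i refl
      where
      ev : ∀ s → (∀ v → + 2 ∣ n[ s ] 0F v - n[ s ] 2F v) × (∀ v → + 2 ∣ n[ s ] 1F v - n[ s ] 3F v)
      ev s = Dir.even-differences s
      flip : ∀ j j' → (∀ s v → + 2 ∣ n[ s ] j v - n[ s ] j' v) → ∀ s v → + 2 ∣ n[ s ] j' v - n[ s ] j v
      flip j j' f s v = ∣-resp (l (n[ s ] j v) (n[ s ] j' v)) (∣m⇒∣-m (f s v))
        where
        l : ∀ x y → - (x - y) ≡ y - x
        l = solve-∀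
      finish : ∀ j → j +ₙ (-ₙ i) ≡ 2F → Occupied j (ι x) (ι y) → ∃[ r' ] (r' ∈ R × r' ⊘ r ≡ w)
      finish j e (r'@(_ , x' , y') , r'∈ , refl , dx , dy) = r' , r'∈ , cong₂ _,_ e (cong₂ _,_ (same x x' dx) (same y y' dy))
        where
        same : ∀ x x' → P ∣ ι x - ι x' → x' +ₙ (-ₙ x) ≡ 0ₙ
        same x x' d = sub-unique x' x 0ₙ (∣m∣n⇒∣m-n (∣-diff-sym (ι x) (ι x') d) ι-0)
      by-class : ∀ j → i ≡ j → ∃[ r' ] (r' ∈ R × r' ⊘ r ≡ w)
      by-class 0F refl = finish 2F refl (Pair.partner 0F 2F (λ s → proj₁ (ev s)) r r∈ refl)
      by-class 1F refl = finish 3F refl (Pair.partner 1F 3F (λ s → proj₂ (ev s)) r r∈ refl)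
      by-class 2F refl = finish 0F refl (Pair.partner 2F 0F (flip 0F 2F (λ s → proj₁ (ev s))) r r∈ refl)
      by-class 3F refl = finish 1F refl (Pair.partner 3F 1F (flip 1F 3F (λ s → proj₂ (ev s))) r r∈ refl)

    impossible : ⊥
    impossible = contradiction (≤-trans many few) λ le → ℕₚ.<⇒≱ (ℕₚ.*-monoʳ-< 4 1<p) (drop‿+≤+ (subst (_≤ + 4) (sym (pos-* 4 p)) le))
      where
      -- As w is not the identity, the formula gives 4 or 4 - 4 according to membership in N; the
      -- bound covers both cases.
      few : + reps R w ≤ + 4
      few = subst (_≤ + 4) (sym (reps-formula w)) (subst (λ t → + 4 - + 4 * count N w + + 4 * P * t ≤ + 4) (sym (𝟙-no (e₀ ≟G w) (λ ())))
        (subst (_≤ + 4) (l (count N w) P) (+-monoʳ-≤ (+ 4) (neg-mono-≤ (*-nonneg {+ 4} {count N w} (+≤+ ℕ.z≤n) (∑-nonneg N (λ x → 𝟙-nonneg (w ≟G x))))))))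
        where
        l : ∀ c P → + 4 + - (+ 4 * c) ≡ + 4 - + 4 * c + + 4 * P * 0ℤ
        l = solve-∀
      many : + 4 * P ≤ + reps R w
      many = subst₂ _≤_ (trans (∑-length R) (trans (cong +_ size-R) (pos-* 4 p))) (trans (∑-swap R R _) (sym (reps-∑ w)))
        (∑-mono-∈ R (λ r r∈ → one r (translate-partner r r∈)))
        where
        one : ∀ r → ∃[ r' ] (r' ∈ R × r' ⊘ r ≡ w) → 1ℤ ≤ ∑ R (λ r' → 𝟙 ((r' ⊘ r) ≟G w))
        one r (r' , r'∈ , e) = subst (_≤ ∑ R (λ r' → 𝟙 ((r' ⊘ r) ≟G w))) (𝟙-yes ((r' ⊘ r) ≟G w) e)
          (term≤∑ {f = λ r' → 𝟙 ((r' ⊘ r) ≟G w)} (λ y → 𝟙-nonneg ((y ⊘ r) ≟G w)) r'∈)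

  half : ∀ n → ¬ (2 ℕ∣.∣ n) → ∃[ h ] n ≡ suc (h ℕ.+ h)
  half zero          odd = contradiction (2 ℕ∣.∣0) odd
  half (suc zero)    odd = 0 , refl
  half (suc (suc n)) odd with half n (λ d → odd (ℕ∣.∣m∣n⇒∣m+n ℕ∣.∣-refl d))
  ... | h , eq = suc h , trans (cong (λ m → suc (suc m)) eq) (cong (λ m → suc (suc m)) (sym (ℕₚ.+-suc h h)))

open import Defs
open import Data.Nat using (ℕ; NonZero; _*_)
open import Data.Nat.Divisibility using (_∣_)
open import Data.Nat.Primality using (Prime)
open import Data.List using (List)
open import Relation.Nullary using (¬_)
open import Data.Product using (proj₁; proj₂)
open Development using (module Nonexistence; half)

theorem4p2 : (p : ℕ) .{{_ : NonZero p}} → Prime p → ¬ (2 ∣ p) →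
    (N R : List (G p)) → ¬ IsRDS (4 * p) p (4 * p) 4 N R
theorem4p2 p pr odd N R rds = Nonexistence.impossible p pr (proj₁ (half p odd)) (proj₂ (half p odd)) N R rds
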